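{- Let $t, t_1, t_2$ be terms of the call-by-value $\lambda\mu^{\wedge\vee}$-calculus. If $t \triangleright^*_v t_1$ and $t \triangleright^*_v t_2$, then there exists a term $t_3$ such that $t_1 \triangleright^*_v t_3$ and $t_2 \triangleright^*_v t_3$.
   Context: Fix two disjoint infinite sets of variables: $\lambda$-variables $x,y,\dots$ and $\mu$-variables $a,b,\dots$. (Untyped) terms $\mathcal{T}$ and $\mathcal{E}$-terms $\mathcal{E}$ are given by the grammar $\mathcal{T} ::= x \mid \lambda x.\mathcal{T} \mid (\mathcal{T}\ \mathcal{E}) \mid \langle \mathcal{T},\mathcal{T}\rangle \mid \omega_1\mathcal{T} \mid \omega_2 \mathcal{T} \mid \mu a.\mathcal{T} \mid (a\ \mathcal{T})$, $\mathcal{E} ::= \mathcal{T} \mid \pi_1 \mid \pi_2 \mid [x.\mathcal{T}, y.\mathcal{T}]$ (with $\lambda x$, $\mu a$, and $x.$ , $y.$ inside $[\,\cdot\,,\cdot\,]$ binding as usual; terms are taken up to $\alpha$-conversion). Values are given by $V ::= x \mid \lambda x.\mathcal{T} \mid \langle V, V\rangle \mid \omega_1 V \mid \omega_2 V \mid (a\ \mathcal{T})$. For a term $t$, a $\mu$-variable $a$, an $\mathcal{E}$-term $\varepsilon$ and a value $V$: $t[a:=^*\varepsilon]$ is obtained from $t$ by replacing inductively each subterm of the form $(a\ v)$ by $(a\ (v\ \varepsilon))$, and $t[a:=_*V]$ is obtained by replacing inductively each subterm of the form $(a\ u)$ by $(a\ (V\ u))$. The one-step reduction $\triangleright_v$ is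 the compatible closure of the rules (where $V, V_i$ range over values, $i\in\{1,2\}$): $(\lambda x.t\ V) \triangleright t[x:=V]$; $(\langle V_1,V_2\rangle\ \pi_i) \triangleright V_i$; $(\omega_i V\ [x_1.t_1,x_2.t_2]) \triangleright t_i[x_i:=V]$; $((t\ [x_1.t_1,x_2.t_2])\ \varepsilon) \triangleright (t\ [x_1.(t_1\ \varepsilon), x_2.(t_2\ \varepsilon)])$; $(V\ (t\ [x_1.t_1,x_2.t_2])) \triangleright (t\ [x_1.(V\ t_1), x_2.(V\ t_2)])$; $(\mu a.t\ \varepsilon) \triangleright \mu a.t[a:=^*\varepsilon]$; $(V\ \mu a.t) \triangleright \mu a.t[a:=_*V]$. $\triangleright^*_v$ denotes the reflexive–transitive closure of $\triangleright_v$. -}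

module Defs where

-- Call-by-value λμ^{∧∨}-calculus, well-scoped de Bruijn syntax.
-- Term n m : terms with (at most) n free λ-variables and m free μ-variables.
-- α-conversion is built in via de Bruijn indices.

open import Data.Nat using (ℕ; zero; suc)
open import Data.Fin using (Fin; zero; suc; _≟_)
open import Data.Bool using (if_then_else_)
open import Relation.Nullary using (does)
open import Relation.Binary.Construct.Closure.ReflexiveTransitive using (Star)

mutual
  data Term (n m : ℕ) : Set where
    var  : Fin n → Term n m
    lam  : Term (suc n) m → Term n m
    app  : Term n m → ETerm n m → Term n m
    pair : Term n m → Term n m → Term n m
    ω₁   : Term n m → Term n m
    ω₂   : Term n m → Term n m
    mu   : Term n (suc m) → Term n m
    nam  : Fin m → Term n m → Term n m

  data ETerm (n m : ℕ) : Set where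
    tm   : Term n m → ETerm n m
    π₁   : ETerm n m
    π₂   : ETerm n m
    case : Term (suc n) m → Term (suc n) m → ETerm n m

data Value {n m : ℕ} : Term n m → Set where
  v-var  : ∀ {x} → Value (var x)
  v-lam  : ∀ {t} → Value (lam t)
  v-pair : ∀ {V₁ V₂} → Value V₁ → Value V₂ → Value (pair V₁ V₂)
  v-ω₁   : ∀ {V} → Value V → Value (ω₁ V)
  v-ω₂   : ∀ {V} → Value V → Value (ω₂ V)
  v-nam  : ∀ {a t} → Value (nam a t)

ext : ∀ {k l} → (Fin k → Fin l) → Fin (suc k) → Fin (suc l)
ext ρ zero    = zero
ext ρ (suc i) = suc (ρ i)

mutual
  ren : ∀ {n n' m m'} → (Fin n → Fin n') → (Fin m → Fin m') → Term n m → Term n' m'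
  ren ρ θ (var x)    = var (ρ x)
  ren ρ θ (lam t)    = lam (ren (ext ρ) θ t)
  ren ρ θ (app t e)  = app (ren ρ θ t) (renE ρ θ e)
  ren ρ θ (pair t u) = pair (ren ρ θ t) (ren ρ θ u)
  ren ρ θ (ω₁ t)     = ω₁ (ren ρ θ t)
  ren ρ θ (ω₂ t)     = ω₂ (ren ρ θ t)
  ren ρ θ (mu t)     = mu (ren ρ (ext θ) t)
  ren ρ θ (nam a t)  = nam (θ a) (ren ρ θ t)

  renE : ∀ {n n' m m'} → (Fin n → Fin n') → (Fin m → Fin m') → ETerm n m → ETerm n' m'
  renE ρ θ (tm t)       = tm (ren ρ θ t)
  renE ρ θ π₁           = π₁
  renE ρ θ π₂           = π₂
  renE ρ θ (case t₁ t₂) = case (ren (ext ρ) θ t₁) (ren (ext ρ) θ t₂)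

wkλ : ∀ {n m} → Term n m → Term (suc n) m
wkλ = ren suc (λ a → a)

wkμ : ∀ {n m} → Term n m → Term n (suc m)
wkμ = ren (λ x → x) suc

wkλE : ∀ {n m} → ETerm n m → ETerm (suc n) m
wkλE = renE suc (λ a → a)

wkμE : ∀ {n m} → ETerm n m → ETerm n (suc m)
wkμE = renE (λ x → x) suc

exts : ∀ {n n' m} → (Fin n → Term n' m) → Fin (suc n) → Term (suc n') m
exts σ zero    = var zero
exts σ (suc i) = wkλ (σ i)

mutual
  sub : ∀ {n n' m} → (Fin n → Term n' m) → Term n m → Term n' m
  sub σ (var x)    = σ x
  sub σ (lam t)    = lam (sub (exts σ) t)
  sub σ (app t e)  = app (sub σ t) (subE σ e)
  sub σ (pair t u) = pair (sub σ t) (sub σ u)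
  sub σ (ω₁ t)     = ω₁ (sub σ t)
  sub σ (ω₂ t)     = ω₂ (sub σ t)
  sub σ (mu t)     = mu (sub (λ i → wkμ (σ i)) t)
  sub σ (nam a t)  = nam a (sub σ t)

  subE : ∀ {n n' m} → (Fin n → Term n' m) → ETerm n m → ETerm n' m
  subE σ (tm t)       = tm (sub σ t)
  subE σ π₁           = π₁
  subE σ π₂           = π₂
  subE σ (case t₁ t₂) = case (sub (exts σ) t₁) (sub (exts σ) t₂)

_[0≔_] : ∀ {n m} → Term (suc n) m → Term n m → Term n m
t [0≔ V ] = sub (λ { zero → V ; (suc i) → var i }) t

-- t[a :=^* ε] : replace each (a v) by (a (v ε)), inductively
mutual
  substR : ∀ {n m} → Fin m → ETerm n m → Term n m → Term n m
  substR a ε (var x)    = var x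
  substR a ε (lam t)    = lam (substR a (wkλE ε) t)
  substR a ε (app t e)  = app (substR a ε t) (substRE a ε e)
  substR a ε (pair t u) = pair (substR a ε t) (substR a ε u)
  substR a ε (ω₁ t)     = ω₁ (substR a ε t)
  substR a ε (ω₂ t)     = ω₂ (substR a ε t)
  substR a ε (mu t)     = mu (substR (suc a) (wkμE ε) t)
  substR a ε (nam b t)  =
    if does (b ≟ a) then nam b (app (substR a ε t) ε) else nam b (substR a ε t)

  substRE : ∀ {n m} → Fin m → ETerm n m → ETerm n m → ETerm n m
  substRE a ε (tm t)       = tm (substR a ε t)
  substRE a ε π₁           = π₁
  substRE a ε π₂           = π₂
  substRE a ε (case t₁ t₂) = case (substR a (wkλE ε) t₁) (substR a (wkλE ε) t₂)

-- t[a :=_* V] : replace each (a u) by (a (V u)), inductively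
mutual
  substL : ∀ {n m} → Fin m → Term n m → Term n m → Term n m
  substL a V (var x)    = var x
  substL a V (lam t)    = lam (substL a (wkλ V) t)
  substL a V (app t e)  = app (substL a V t) (substLE a V e)
  substL a V (pair t u) = pair (substL a V t) (substL a V u)
  substL a V (ω₁ t)     = ω₁ (substL a V t)
  substL a V (ω₂ t)     = ω₂ (substL a V t)
  substL a V (mu t)     = mu (substL (suc a) (wkμ V) t)
  substL a V (nam b t)  =
    if does (b ≟ a) then nam b (app V (tm (substL a V t))) else nam b (substL a V t)

  substLE : ∀ {n m} → Fin m → Term n m → ETerm n m → ETerm n m
  substLE a V (tm t)       = tm (substL a V t)
  substLE a V π₁           = π₁
  substLE a V π₂           = π₂
  substLE a V (case t₁ t₂) = case (substL a (wkλ V) t₁) (substL a (wkλ V) t₂)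

mutual
  data _▷_ {n m : ℕ} : Term n m → Term n m → Set where
    β     : ∀ {t V} → Value V → app (lam t) (tm V) ▷ (t [0≔ V ])
    proj₁ : ∀ {V₁ V₂} → Value V₁ → Value V₂ → app (pair V₁ V₂) π₁ ▷ V₁
    proj₂ : ∀ {V₁ V₂} → Value V₁ → Value V₂ → app (pair V₁ V₂) π₂ ▷ V₂
    cas₁  : ∀ {V t₁ t₂} → Value V → app (ω₁ V) (case t₁ t₂) ▷ (t₁ [0≔ V ])
    cas₂  : ∀ {V t₁ t₂} → Value V → app (ω₂ V) (case t₁ t₂) ▷ (t₂ [0≔ V ])
    comR  : ∀ {t t₁ t₂ ε} →
            app (app t (case t₁ t₂)) ε ▷
            app t (case (app t₁ (wkλE ε)) (app t₂ (wkλE ε)))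
    comL  : ∀ {V t t₁ t₂} → Value V →
            app V (tm (app t (case t₁ t₂))) ▷
            app t (case (app (wkλ V) (tm t₁)) (app (wkλ V) (tm t₂)))
    μR    : ∀ {t ε} → app (mu t) ε ▷ mu (substR zero (wkμE ε) t)
    μL    : ∀ {V t} → Value V → app V (tm (mu t)) ▷ mu (substL zero (wkμ V) t)
    ξ-lam   : ∀ {t t'} → t ▷ t' → lam t ▷ lam t'
    ξ-appˡ  : ∀ {t t' e} → t ▷ t' → app t e ▷ app t' e
    ξ-appʳ  : ∀ {t e e'} → e ▷E e' → app t e ▷ app t e'
    ξ-pairˡ : ∀ {t t' u} → t ▷ t' → pair t u ▷ pair t' u
    ξ-pairʳ : ∀ {t u u'} → u ▷ u' → pair t u ▷ pair t u'
    ξ-ω₁    : ∀ {t t'} → t ▷ t' → ω₁ t ▷ ω₁ t'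
    ξ-ω₂    : ∀ {t t'} → t ▷ t' → ω₂ t ▷ ω₂ t'
    ξ-mu    : ∀ {t t'} → t ▷ t' → mu t ▷ mu t'
    ξ-nam   : ∀ {a t t'} → t ▷ t' → nam a t ▷ nam a t'

  data _▷E_ {n m : ℕ} : ETerm n m → ETerm n m → Set where
    ξ-tm    : ∀ {t t'} → t ▷ t' → tm t ▷E tm t'
    ξ-caseˡ : ∀ {t₁ t₁' t₂} → t₁ ▷ t₁' → case t₁ t₂ ▷E case t₁' t₂
    ξ-caseʳ : ∀ {t₁ t₂ t₂'} → t₂ ▷ t₂' → case t₁ t₂ ▷E case t₁ t₂'

_▷*_ : ∀ {n m} → Term n m → Term n m → Set
_▷*_ = Star _▷_

-- Proof by the Z property of Dehornoy and van Oostrom: if some map dev satisfies t ▷* dev t, and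
-- s ▷* dev t ▷* dev s whenever t ▷ s, then ▷ is confluent.
--
-- dev is a complete development. Call-by-value redexes are only created in evaluation position, and the
-- commuting conversions and μ-rules move whole evaluation contexts around, so the development is taken
-- relative to a stack k of pending frames and an environment η recording, for every μ-name a, the frames
-- that μ-reductions have attached to a. develop t k η contracts the redex formed by the head of t and the
-- first frame of k, and pushes k into both branches of a case and, through η, under a μ-binder down to the
-- named subterms (a u).
-- The three properties are proved by induction on t or on the reduction step, from the facts that
-- development commutes with renaming, with substitution of values and with pushing stacks under names,
-- and is monotone both in its stack and under reduction.

module Submission where

open import Defs
open import Data.Nat using (ℕ; zero; suc; _+_)
open import Data.Nat.Properties using (+-comm)
open import Data.Fin using (Fin; zero; suc; _≟_)
open import Data.Bool using (Bool; true; false; _∧_; if_then_else_)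
open import Data.Bool.Properties using (if-float)
open import Data.List using (List; []; _∷_; map; _++_)
open import Data.List.Properties using (++-identityʳ; map-++; map-∘; map-cong; map-id)
open import Data.List.Relation.Unary.All using (All; []; _∷_)
open import Data.List.Relation.Unary.All.Properties using (gmap⁺; ++⁺; ++⁻ˡ; ++⁻ʳ)
open import Data.Product using (Σ; ∃; _×_; _,_; ∃-syntax)
open import Data.Unit using (⊤; tt)
open import Relation.Nullary using (does; yes; no)
open import Relation.Nullary.Decidable using (dec-true; dec-false)
open import Relation.Binary.PropositionalEquality
open import Relation.Binary.Construct.Closure.ReflexiveTransitive using (Star; ε; _◅_; _◅◅_; gmap)
open import Function using (_∘_; id)
open import Level using (_⊔_)
open import Relation.Binary.Core using (Rel)
open import Relation.Binary.Rewriting using (Confluent)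

-- The Z property

module ZProperty {a ℓ} {A : Set a} {_⟶_ : Rel A ℓ} (f : A → A)
  (extensive : ∀ x → Star _⟶_ x (f x))
  (reduct-⟶*-f : ∀ {x y} → x ⟶ y → Star _⟶_ y (f x))
  (f-mono : ∀ {x y} → x ⟶ y → Star _⟶_ (f x) (f y)) where

  private
    _⟶*_ : Rel A (a ⊔ ℓ)
    _⟶*_ = Star _⟶_

    iterate : ℕ → A → A
    iterate zero x = x
    iterate (suc i) x = iterate i (f x)

    f-mono* : ∀ {y z} → y ⟶* z → f y ⟶* f z
    f-mono* ε = ε
    f-mono* (r ◅ rs) = f-mono r ◅◅ f-mono* rs

    iterate-mono : ∀ i {y z} → y ⟶* z → iterate i y ⟶* iterate i z
    iterate-mono zero p = p
    iterate-mono (suc i) p = iterate-mono i (f-mono* p)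

    reach : ∀ {x y} → x ⟶* y → ∃ λ i → y ⟶* iterate i x
    reach ε = zero , ε
    reach (r ◅ rs) with reach rs
    ... | i , p = suc i , p ◅◅ iterate-mono i (reduct-⟶*-f r)

    climb : ∀ j i x → iterate i x ⟶* iterate (j + i) x
    climb zero i x = ε
    climb (suc j) i x = climb j i x ◅◅ iterate-mono (j + i) (extensive x)

  confluent : Confluent _⟶_
  confluent {x} p q with reach p | reach q
  ... | i , p' | j , q' = iterate (j + i) x , p' ◅◅ climb j i x ,
                          q' ◅◅ subst (λ l → iterate j x ⟶* iterate l x) (+-comm i j) (climb i j x)

-- Renaming and substitution

ext-cong : ∀ {k l} {ρ ρ' : Fin k → Fin l} → ρ ≗ ρ' → ext ρ ≗ ext ρ'
ext-cong e zero = refl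
ext-cong e (suc i) = cong suc (e i)

ext-id : ∀ {k} {ρ : Fin k → Fin k} → ρ ≗ id → ext ρ ≗ id
ext-id e zero = refl
ext-id e (suc i) = cong suc (e i)

ext-∘ : ∀ {k l o} {ρ : Fin l → Fin o} {ρ' : Fin k → Fin l} {ρ'' : Fin k → Fin o} →
        (λ i → ρ (ρ' i)) ≗ ρ'' → (λ i → ext ρ (ext ρ' i)) ≗ ext ρ''
ext-∘ e zero = refl
ext-∘ e (suc i) = cong suc (e i)

mutual
  ren-cong : ∀ {n n' m m'} {ρ ρ' : Fin n → Fin n'} {θ θ' : Fin m → Fin m'} →
             ρ ≗ ρ' → θ ≗ θ' → (t : Term n m) → ren ρ θ t ≡ ren ρ' θ' t
  ren-cong e f (var x) = cong var (e x)
  ren-cong e f (lam t) = cong lam (ren-cong (ext-cong e) f t)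
  ren-cong e f (app t u) = cong₂ app (ren-cong e f t) (renE-cong e f u)
  ren-cong e f (pair t u) = cong₂ pair (ren-cong e f t) (ren-cong e f u)
  ren-cong e f (ω₁ t) = cong ω₁ (ren-cong e f t)
  ren-cong e f (ω₂ t) = cong ω₂ (ren-cong e f t)
  ren-cong e f (mu t) = cong mu (ren-cong e (ext-cong f) t)
  ren-cong e f (nam a t) = cong₂ nam (f a) (ren-cong e f t)

  renE-cong : ∀ {n n' m m'} {ρ ρ' : Fin n → Fin n'} {θ θ' : Fin m → Fin m'} →
             ρ ≗ ρ' → θ ≗ θ' → (t : ETerm n m) → renE ρ θ t ≡ renE ρ' θ' t
  renE-cong e f (tm t) = cong tm (ren-cong e f t)
  renE-cong e f π₁ = refl
  renE-cong e f π₂ = refl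
  renE-cong e f (case t u) = cong₂ case (ren-cong (ext-cong e) f t) (ren-cong (ext-cong e) f u)

mutual
  ren-comp : ∀ {n n' n'' m m' m''} (ρ : Fin n' → Fin n'') (ρ' : Fin n → Fin n')
             (θ : Fin m' → Fin m'') (θ' : Fin m → Fin m') (t : Term n m) →
             ren ρ θ (ren ρ' θ' t) ≡ ren (ρ ∘ ρ') (θ ∘ θ') t
  ren-comp ρ ρ' θ θ' (var x) = refl
  ren-comp ρ ρ' θ θ' (lam t) = cong lam (trans (ren-comp (ext ρ) (ext ρ') θ θ' t)
     (ren-cong (λ { zero → refl ; (suc i) → refl }) (λ _ → refl) t))
  ren-comp ρ ρ' θ θ' (app t u) = cong₂ app (ren-comp ρ ρ' θ θ' t) (renE-comp ρ ρ' θ θ' u)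
  ren-comp ρ ρ' θ θ' (pair t u) = cong₂ pair (ren-comp ρ ρ' θ θ' t) (ren-comp ρ ρ' θ θ' u)
  ren-comp ρ ρ' θ θ' (ω₁ t) = cong ω₁ (ren-comp ρ ρ' θ θ' t)
  ren-comp ρ ρ' θ θ' (ω₂ t) = cong ω₂ (ren-comp ρ ρ' θ θ' t)
  ren-comp ρ ρ' θ θ' (mu t) = cong mu (trans (ren-comp ρ ρ' (ext θ) (ext θ') t)
     (ren-cong (λ _ → refl) (λ { zero → refl ; (suc i) → refl }) t))
  ren-comp ρ ρ' θ θ' (nam a t) = cong (nam _) (ren-comp ρ ρ' θ θ' t)

  renE-comp : ∀ {n n' n'' m m' m''} (ρ : Fin n' → Fin n'') (ρ' : Fin n → Fin n')
             (θ : Fin m' → Fin m'') (θ' : Fin m → Fin m') (t : ETerm n m) →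
             renE ρ θ (renE ρ' θ' t) ≡ renE (ρ ∘ ρ') (θ ∘ θ') t
  renE-comp ρ ρ' θ θ' (tm t) = cong tm (ren-comp ρ ρ' θ θ' t)
  renE-comp ρ ρ' θ θ' π₁ = refl
  renE-comp ρ ρ' θ θ' π₂ = refl
  renE-comp ρ ρ' θ θ' (case t u) = cong₂ case
    (trans (ren-comp (ext ρ) (ext ρ') θ θ' t) (ren-cong (λ { zero → refl ; (suc i) → refl }) (λ _ → refl) t))
    (trans (ren-comp (ext ρ) (ext ρ') θ θ' u) (ren-cong (λ { zero → refl ; (suc i) → refl }) (λ _ → refl) u))

ren-comp-≗ : ∀ {n n' n'' m m' m''} {ρ : Fin n' → Fin n''} {ρ' : Fin n → Fin n'}
            {θ : Fin m' → Fin m''} {θ' : Fin m → Fin m'} {ρ'' : Fin n → Fin n''} {θ'' : Fin m → Fin m''} →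
            (λ i → ρ (ρ' i)) ≗ ρ'' → (λ i → θ (θ' i)) ≗ θ'' → (t : Term n m) →
            ren ρ θ (ren ρ' θ' t) ≡ ren ρ'' θ'' t
ren-comp-≗ {ρ = ρ} {ρ'} {θ} {θ'} e f t = trans (ren-comp ρ ρ' θ θ' t) (ren-cong e f t)

mutual
  ren-id : ∀ {n m} {ρ : Fin n → Fin n} {θ : Fin m → Fin m} → ρ ≗ id → θ ≗ id →
           (t : Term n m) → ren ρ θ t ≡ t
  ren-id e f (var x) = cong var (e x)
  ren-id e f (lam t) = cong lam (ren-id (ext-id e) f t)
  ren-id e f (app t u) = cong₂ app (ren-id e f t) (renE-id e f u)
  ren-id e f (pair t u) = cong₂ pair (ren-id e f t) (ren-id e f u)
  ren-id e f (ω₁ t) = cong ω₁ (ren-id e f t)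
  ren-id e f (ω₂ t) = cong ω₂ (ren-id e f t)
  ren-id e f (mu t) = cong mu (ren-id e (ext-id f) t)
  ren-id e f (nam a t) = cong₂ nam (f a) (ren-id e f t)

  renE-id : ∀ {n m} {ρ : Fin n → Fin n} {θ : Fin m → Fin m} → ρ ≗ id → θ ≗ id →
           (t : ETerm n m) → renE ρ θ t ≡ t
  renE-id e f (tm t) = cong tm (ren-id e f t)
  renE-id e f π₁ = refl
  renE-id e f π₂ = refl
  renE-id e f (case t u) = cong₂ case (ren-id (ext-id e) f t) (ren-id (ext-id e) f u)

exts-cong : ∀ {n n' m} {σ σ' : Fin n → Term n' m} → σ ≗ σ' → exts σ ≗ exts σ'
exts-cong e zero = refl
exts-cong e (suc i) = cong wkλ (e i)

mutual
  sub-cong : ∀ {n n' m} {σ σ' : Fin n → Term n' m} → σ ≗ σ' → (t : Term n m) → sub σ t ≡ sub σ' t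
  sub-cong e (var x) = e x
  sub-cong e (lam t) = cong lam (sub-cong (exts-cong e) t)
  sub-cong e (app t u) = cong₂ app (sub-cong e t) (subE-cong e u)
  sub-cong e (pair t u) = cong₂ pair (sub-cong e t) (sub-cong e u)
  sub-cong e (ω₁ t) = cong ω₁ (sub-cong e t)
  sub-cong e (ω₂ t) = cong ω₂ (sub-cong e t)
  sub-cong e (mu t) = cong mu (sub-cong (λ i → cong wkμ (e i)) t)
  sub-cong e (nam a t) = cong (nam a) (sub-cong e t)

  subE-cong : ∀ {n n' m} {σ σ' : Fin n → Term n' m} → σ ≗ σ' → (t : ETerm n m) → subE σ t ≡ subE σ' t
  subE-cong e (tm t) = cong tm (sub-cong e t)
  subE-cong e π₁ = refl
  subE-cong e π₂ = refl
  subE-cong e (case t u) = cong₂ case (sub-cong (exts-cong e) t) (sub-cong (exts-cong e) u)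

mutual
  sub-ren : ∀ {n n' n'' m} (σ : Fin n' → Term n'' m) (ρ : Fin n → Fin n') {θ : Fin m → Fin m} →
            θ ≗ id → (t : Term n m) → sub σ (ren ρ θ t) ≡ sub (σ ∘ ρ) t
  sub-ren σ ρ f (var x) = refl
  sub-ren σ ρ f (lam t) = cong lam (trans (sub-ren (exts σ) (ext ρ) f t)
    (sub-cong (λ { zero → refl ; (suc i) → refl }) t))
  sub-ren σ ρ f (app t u) = cong₂ app (sub-ren σ ρ f t) (subE-ren σ ρ f u)
  sub-ren σ ρ f (pair t u) = cong₂ pair (sub-ren σ ρ f t) (sub-ren σ ρ f u)
  sub-ren σ ρ f (ω₁ t) = cong ω₁ (sub-ren σ ρ f t)
  sub-ren σ ρ f (ω₂ t) = cong ω₂ (sub-ren σ ρ f t)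
  sub-ren σ ρ f (mu t) = cong mu (sub-ren (λ i → wkμ (σ i)) ρ (ext-id f) t)
  sub-ren σ ρ f (nam a t) = cong₂ nam (f a) (sub-ren σ ρ f t)

  subE-ren : ∀ {n n' n'' m} (σ : Fin n' → Term n'' m) (ρ : Fin n → Fin n') {θ : Fin m → Fin m} →
            θ ≗ id → (t : ETerm n m) → subE σ (renE ρ θ t) ≡ subE (σ ∘ ρ) t
  subE-ren σ ρ f (tm t) = cong tm (sub-ren σ ρ f t)
  subE-ren σ ρ f π₁ = refl
  subE-ren σ ρ f π₂ = refl
  subE-ren σ ρ f (case t u) = cong₂ case
    (trans (sub-ren (exts σ) (ext ρ) f t) (sub-cong (λ { zero → refl ; (suc i) → refl }) t))
    (trans (sub-ren (exts σ) (ext ρ) f u) (sub-cong (λ { zero → refl ; (suc i) → refl }) u))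

mutual
  ren-sub : ∀ {n n' n'' m m'} (ρ : Fin n' → Fin n'') (θ : Fin m → Fin m') (σ : Fin n → Term n' m)
            {ρ0 : Fin n → Fin n} → ρ0 ≗ id → (t : Term n m) →
            ren ρ θ (sub σ t) ≡ sub (λ i → ren ρ θ (σ i)) (ren ρ0 θ t)
  ren-sub ρ θ σ e (var x) = cong (λ z → ren ρ θ (σ z)) (sym (e x))
  ren-sub ρ θ σ e (lam t) = cong lam (ren-sub-exts ρ θ σ e t)
  ren-sub ρ θ σ e (app t u) = cong₂ app (ren-sub ρ θ σ e t) (renE-sub ρ θ σ e u)
  ren-sub ρ θ σ e (pair t u) = cong₂ pair (ren-sub ρ θ σ e t) (ren-sub ρ θ σ e u)
  ren-sub ρ θ σ e (ω₁ t) = cong ω₁ (ren-sub ρ θ σ e t)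
  ren-sub ρ θ σ e (ω₂ t) = cong ω₂ (ren-sub ρ θ σ e t)
  ren-sub ρ θ σ e (mu t) = cong mu (trans (ren-sub ρ (ext θ) (λ i → wkμ (σ i)) e t)
    (sub-cong (λ i → trans (ren-comp ρ (λ x → x) (ext θ) suc (σ i))
                 (sym (ren-comp (λ x → x) ρ suc θ (σ i)))) (ren _ (ext θ) t)))
  ren-sub ρ θ σ e (nam a t) = cong (nam (θ a)) (ren-sub ρ θ σ e t)

  renE-sub : ∀ {n n' n'' m m'} (ρ : Fin n' → Fin n'') (θ : Fin m → Fin m') (σ : Fin n → Term n' m)
            {ρ0 : Fin n → Fin n} → ρ0 ≗ id → (t : ETerm n m) →
            renE ρ θ (subE σ t) ≡ subE (λ i → ren ρ θ (σ i)) (renE ρ0 θ t)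
  renE-sub ρ θ σ e (tm t) = cong tm (ren-sub ρ θ σ e t)
  renE-sub ρ θ σ e π₁ = refl
  renE-sub ρ θ σ e π₂ = refl
  renE-sub ρ θ σ e (case t u) = cong₂ case (ren-sub-exts ρ θ σ e t) (ren-sub-exts ρ θ σ e u)

  ren-sub-exts : ∀ {n n' n'' m m'} (ρ : Fin n' → Fin n'') (θ : Fin m → Fin m') (σ : Fin n → Term n' m)
                 {ρ0 : Fin n → Fin n} → ρ0 ≗ id → (t : Term (suc n) m) →
                 ren (ext ρ) θ (sub (exts σ) t) ≡ sub (exts (λ i → ren ρ θ (σ i))) (ren (ext ρ0) θ t)
  ren-sub-exts ρ θ σ {ρ0} e t = trans (ren-sub (ext ρ) θ (exts σ) (ext-id e) t)
    (sub-cong (λ { zero → refl ; (suc i) → trans (ren-comp (ext ρ) suc θ (λ a → a) (σ i))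
                 (sym (ren-comp suc ρ (λ a → a) θ (σ i))) }) (ren (ext ρ0) θ t))

exts-var : ∀ {n m} {σ : Fin n → Term n m} → σ ≗ var → exts σ ≗ var
exts-var e zero = refl
exts-var e (suc i) = cong wkλ (e i)

mutual
  sub-id : ∀ {n m} {σ : Fin n → Term n m} → σ ≗ var → (t : Term n m) → sub σ t ≡ t
  sub-id e (var x) = e x
  sub-id e (lam t) = cong lam (sub-id (exts-var e) t)
  sub-id e (app t u) = cong₂ app (sub-id e t) (subE-id e u)
  sub-id e (pair t u) = cong₂ pair (sub-id e t) (sub-id e u)
  sub-id e (ω₁ t) = cong ω₁ (sub-id e t)
  sub-id e (ω₂ t) = cong ω₂ (sub-id e t)
  sub-id e (mu t) = cong mu (sub-id (λ i → cong wkμ (e i)) t)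
  sub-id e (nam a t) = cong (nam a) (sub-id e t)

  subE-id : ∀ {n m} {σ : Fin n → Term n m} → σ ≗ var → (t : ETerm n m) → subE σ t ≡ t
  subE-id e (tm t) = cong tm (sub-id e t)
  subE-id e π₁ = refl
  subE-id e π₂ = refl
  subE-id e (case t u) = cong₂ case (sub-id (exts-var e) t) (sub-id (exts-var e) u)

wkλ-sub : ∀ {n n' m} (σ : Fin n → Term n' m) (t : Term n m) →
          wkλ (sub σ t) ≡ sub (exts σ) (wkλ t)
wkλ-sub σ t = trans (ren-sub suc (λ a → a) σ (λ _ → refl) t)
  (trans (cong (sub _) (ren-id (λ _ → refl) (λ _ → refl) t)) (sym (sub-ren (exts σ) suc (λ _ → refl) t)))

wkμ-sub : ∀ {n n' m} (σ : Fin n → Term n' m) (t : Term n m) →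
          wkμ (sub σ t) ≡ sub (λ i → wkμ (σ i)) (wkμ t)
wkμ-sub σ t = ren-sub (λ x → x) suc σ (λ _ → refl) t

wkλE-sub : ∀ {n n' m} (σ : Fin n → Term n' m) (t : ETerm n m) →
          wkλE (subE σ t) ≡ subE (exts σ) (wkλE t)
wkλE-sub σ t = trans (renE-sub suc (λ a → a) σ (λ _ → refl) t)
  (trans (cong (subE _) (renE-id (λ _ → refl) (λ _ → refl) t)) (sym (subE-ren (exts σ) suc (λ _ → refl) t)))

wkμE-sub : ∀ {n n' m} (σ : Fin n → Term n' m) (t : ETerm n m) →
          wkμE (subE σ t) ≡ subE (λ i → wkμ (σ i)) (wkμE t)
wkμE-sub σ t = renE-sub (λ x → x) suc σ (λ _ → refl) t

mutual
  sub-sub : ∀ {n n' n'' m} (σ : Fin n' → Term n'' m) (τ : Fin n → Term n' m) (t : Term n m) →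
            sub σ (sub τ t) ≡ sub (λ i → sub σ (τ i)) t
  sub-sub σ τ (var x) = refl
  sub-sub σ τ (lam t) = cong lam (trans (sub-sub (exts σ) (exts τ) t)
    (sub-cong (λ { zero → refl ; (suc i) → sym (wkλ-sub σ (τ i)) }) t))
  sub-sub σ τ (app t u) = cong₂ app (sub-sub σ τ t) (subE-sub σ τ u)
  sub-sub σ τ (pair t u) = cong₂ pair (sub-sub σ τ t) (sub-sub σ τ u)
  sub-sub σ τ (ω₁ t) = cong ω₁ (sub-sub σ τ t)
  sub-sub σ τ (ω₂ t) = cong ω₂ (sub-sub σ τ t)
  sub-sub σ τ (mu t) = cong mu (trans (sub-sub _ _ t) (sub-cong (λ i → sym (wkμ-sub σ (τ i))) t))
  sub-sub σ τ (nam a t) = cong (nam a) (sub-sub σ τ t)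

  subE-sub : ∀ {n n' n'' m} (σ : Fin n' → Term n'' m) (τ : Fin n → Term n' m) (t : ETerm n m) →
            subE σ (subE τ t) ≡ subE (λ i → sub σ (τ i)) t
  subE-sub σ τ (tm t) = cong tm (sub-sub σ τ t)
  subE-sub σ τ π₁ = refl
  subE-sub σ τ π₂ = refl
  subE-sub σ τ (case t u) = cong₂ case
    (trans (sub-sub (exts σ) (exts τ) t) (sub-cong (λ { zero → refl ; (suc i) → sym (wkλ-sub σ (τ i)) }) t))
    (trans (sub-sub (exts σ) (exts τ) u) (sub-cong (λ { zero → refl ; (suc i) → sym (wkλ-sub σ (τ i)) }) u))

σ₀ : ∀ {n m} → Term n m → Fin (suc n) → Term n m
σ₀ V zero = V
σ₀ V (suc i) = var i

wkλ-cancel : ∀ {n m} (V : Term n m) (t : Term n m) → (wkλ t) [0≔ V ] ≡ t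
wkλ-cancel V t = trans (sub-ren _ suc (λ _ → refl) t) (sub-id (λ _ → refl) t)

sub-[0≔] : ∀ {n n' m} (σ : Fin n → Term n' m) (t : Term (suc n) m) (V : Term n m) →
           sub σ (t [0≔ V ]) ≡ (sub (exts σ) t) [0≔ sub σ V ]
sub-[0≔] σ t V = trans (sub-sub σ _ t) (trans
  (sub-cong (λ { zero → refl ; (suc i) → sym (wkλ-cancel (sub σ V) (σ i)) }) t)
  (sym (sub-sub _ (exts σ) t)))

[0≔]≡sub-σ₀ : ∀ {n m} (t : Term (suc n) m) (V : Term n m) → t [0≔ V ] ≡ sub (σ₀ V) t
[0≔]≡sub-σ₀ t V = sub-cong (λ { zero → refl ; (suc i) → refl }) t

ren-[0≔] : ∀ {n n' m m'} (ρ : Fin n → Fin n') (θ : Fin m → Fin m') (t : Term (suc n) m) (V : Term n m) →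
           ren ρ θ (t [0≔ V ]) ≡ (ren (ext ρ) θ t) [0≔ ren ρ θ V ]
ren-[0≔] ρ θ t V = trans (ren-sub ρ θ _ (λ _ → refl) t) (trans
  (sub-cong (λ { zero → refl ; (suc i) → refl }) (ren (λ x → x) θ t))
  (trans (sym (sub-ren (σ₀ (ren ρ θ V)) (ext ρ) (λ _ → refl) (ren (λ x → x) θ t)))
         (trans (cong (sub _) (trans (ren-comp (ext ρ) (λ x → x) (λ a → a) θ t)
                 (ren-cong (λ { zero → refl ; (suc i) → refl }) (λ _ → refl) t)))
                (sym ([0≔]≡sub-σ₀ (ren (ext ρ) θ t) (ren ρ θ V))))))

_▷*E_ : ∀ {n m} → ETerm n m → ETerm n m → Set
_▷*E_ = Star _▷E_

≡⇒▷* : ∀ {n m} {t u : Term n m} → t ≡ u → t ▷* u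
≡⇒▷* refl = ε

▷*-lam : ∀ {n m} {t t' : Term (suc n) m} → t ▷* t' → lam t ▷* lam t'
▷*-lam = gmap lam ξ-lam
▷*-mu : ∀ {n m} {t t' : Term n (suc m)} → t ▷* t' → mu t ▷* mu t'
▷*-mu = gmap mu ξ-mu
▷*-nam : ∀ {n m} {a : Fin m} {t t' : Term n m} → t ▷* t' → nam a t ▷* nam a t'
▷*-nam = gmap (nam _) ξ-nam
▷*-ω₁ : ∀ {n m} {t t' : Term n m} → t ▷* t' → ω₁ t ▷* ω₁ t'
▷*-ω₁ = gmap ω₁ ξ-ω₁
▷*-ω₂ : ∀ {n m} {t t' : Term n m} → t ▷* t' → ω₂ t ▷* ω₂ t'
▷*-ω₂ = gmap ω₂ ξ-ω₂
▷*-pair : ∀ {n m} {t t' u u' : Term n m} → t ▷* t' → u ▷* u' → pair t u ▷* pair t' u'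
▷*-pair p q = gmap (λ x → pair x _) ξ-pairˡ p ◅◅ gmap (pair _) ξ-pairʳ q
▷*-app : ∀ {n m} {t t' : Term n m} {e e'} → t ▷* t' → e ▷*E e' → app t e ▷* app t' e'
▷*-app p q = gmap (λ x → app x _) ξ-appˡ p ◅◅ gmap (app _) ξ-appʳ q
▷*-tm : ∀ {n m} {t t' : Term n m} → t ▷* t' → tm t ▷*E tm t'
▷*-tm = gmap tm ξ-tm
▷*-case : ∀ {n m} {t t' u u' : Term (suc n) m} → t ▷* t' → u ▷* u' → case t u ▷*E case t' u'
▷*-case p q = gmap (λ x → case x _) ξ-caseˡ p ◅◅ gmap (case _) ξ-caseʳ q
▷*-app-tm : ∀ {n m} {t t' u u' : Term n m} → t ▷* t' → u ▷* u' → app t (tm u) ▷* app t' (tm u')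
▷*-app-tm p q = ▷*-app p (▷*-tm q)
▷*-app-case : ∀ {n m} {t t' : Term n m} {u u' v v'} → t ▷* t' → u ▷* u' → v ▷* v' →
          app t (case u v) ▷* app t' (case u' v')
▷*-app-case p q r = ▷*-app p (▷*-case q r)

isValue : ∀ {n m} → Term n m → Bool
isValue (var x) = true
isValue (lam t) = true
isValue (app t e) = false
isValue (pair t u) = isValue t ∧ isValue u
isValue (ω₁ t) = isValue t
isValue (ω₂ t) = isValue t
isValue (mu t) = false
isValue (nam a t) = true

isValue⇒Value : ∀ {n m} {t : Term n m} → isValue t ≡ true → Value t
isValue⇒Value {t = var x} e = v-var
isValue⇒Value {t = lam t} e = v-lam
isValue⇒Value {t = pair t u} e with isValue t in p | isValue u in q
... | true | true = v-pair (isValue⇒Value p) (isValue⇒Value q)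
isValue⇒Value {t = ω₁ t} e = v-ω₁ (isValue⇒Value e)
isValue⇒Value {t = ω₂ t} e = v-ω₂ (isValue⇒Value e)
isValue⇒Value {t = nam a t} e = v-nam

Value⇒isValue : ∀ {n m} {t : Term n m} → Value t → isValue t ≡ true
Value⇒isValue v-var = refl
Value⇒isValue v-lam = refl
Value⇒isValue (v-pair p q) rewrite Value⇒isValue p | Value⇒isValue q = refl
Value⇒isValue (v-ω₁ p) = Value⇒isValue p
Value⇒isValue (v-ω₂ p) = Value⇒isValue p
Value⇒isValue v-nam = refl

isValue-ren : ∀ {n n' m m'} (ρ : Fin n → Fin n') (θ : Fin m → Fin m') (t : Term n m) → isValue (ren ρ θ t) ≡ isValue t
isValue-ren ρ θ (var x) = refl
isValue-ren ρ θ (lam t) = refl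
isValue-ren ρ θ (app t e) = refl
isValue-ren ρ θ (pair t u) = cong₂ _∧_ (isValue-ren ρ θ t) (isValue-ren ρ θ u)
isValue-ren ρ θ (ω₁ t) = isValue-ren ρ θ t
isValue-ren ρ θ (ω₂ t) = isValue-ren ρ θ t
isValue-ren ρ θ (mu t) = refl
isValue-ren ρ θ (nam a t) = refl

ValueSub : ∀ {n n' m} → (Fin n → Term n' m) → Set
ValueSub σ = ∀ x → Value (σ x)

isValue-sub : ∀ {n n' m} {σ : Fin n → Term n' m} → ValueSub σ → (t : Term n m) → isValue (sub σ t) ≡ isValue t
isValue-sub h (var x) = Value⇒isValue (h x)
isValue-sub h (lam t) = refl
isValue-sub h (app t e) = refl
isValue-sub h (pair t u) = cong₂ _∧_ (isValue-sub h t) (isValue-sub h u)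
isValue-sub h (ω₁ t) = isValue-sub h t
isValue-sub h (ω₂ t) = isValue-sub h t
isValue-sub h (mu t) = refl
isValue-sub h (nam a t) = refl

Value-ren : ∀ {n n' m m'} (ρ : Fin n → Fin n') (θ : Fin m → Fin m') {t : Term n m} → Value t → Value (ren ρ θ t)
Value-ren ρ θ {t} v = isValue⇒Value (trans (isValue-ren ρ θ t) (Value⇒isValue v))

Value-sub : ∀ {n n' m} (σ : Fin n → Term n' m) → ValueSub σ → {t : Term n m} → Value t → Value (sub σ t)
Value-sub σ h {t} v = isValue⇒Value (trans (isValue-sub h t) (Value⇒isValue v))

-- Frames, stacks, and environments of stacks for μ-names

-- fArg u b is the frame (□ u), with b set when u is a value, so that a β-redex with this argument
-- may be contracted; fL V is the frame (V □).
data Frame (n m : ℕ) : Set where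
  fArg  : Term n m → Bool → Frame n m
  fπ₁   : Frame n m
  fπ₂   : Frame n m
  fCase : Term (suc n) m → Term (suc n) m → Frame n m
  fL    : Term n m → Frame n m

-- The stack of frames waiting under each μ-name; push η plugs η a around every named subterm (a u).
Env : ℕ → ℕ → Set
Env n m = Fin m → List (Frame n m)

plug₁ : ∀ {n m} → Term n m → Frame n m → Term n m
plug₁ t (fArg u b) = app t (tm u)
plug₁ t fπ₁ = app t π₁
plug₁ t fπ₂ = app t π₂
plug₁ t (fCase c d) = app t (case c d)
plug₁ t (fL w) = app w (tm t)

plug : ∀ {n m} → Term n m → List (Frame n m) → Term n m
plug t [] = t
plug t (f ∷ k) = plug (plug₁ t f) k

renF : ∀ {n n' m m'} → (Fin n → Fin n') → (Fin m → Fin m') → Frame n m → Frame n' m'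
renF ρ θ (fArg u b) = fArg (ren ρ θ u) b
renF ρ θ fπ₁ = fπ₁
renF ρ θ fπ₂ = fπ₂
renF ρ θ (fCase c d) = fCase (ren (ext ρ) θ c) (ren (ext ρ) θ d)
renF ρ θ (fL w) = fL (ren ρ θ w)

subF : ∀ {n n' m} → (Fin n → Term n' m) → Frame n m → Frame n' m
subF σ (fArg u b) = fArg (sub σ u) b
subF σ fπ₁ = fπ₁
subF σ fπ₂ = fπ₂
subF σ (fCase c d) = fCase (sub (exts σ) c) (sub (exts σ) d)
subF σ (fL w) = fL (sub σ w)

wkλF : ∀ {n m} → Frame n m → Frame (suc n) m
wkλF = renF suc (λ a → a)
wkμF : ∀ {n m} → Frame n m → Frame n (suc m)
wkμF = renF (λ x → x) suc

wkλEnv : ∀ {n m} → Env n m → Env (suc n) m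
wkλEnv η a = map wkλF (η a)

emptyEnv : ∀ {n m} → Env n m
emptyEnv a = []

bindμ : ∀ {n m} → List (Frame n m) → Env n m → Env n (suc m)
bindμ k η zero = map wkμF k
bindμ k η (suc b) = map wkμF (η b)

liftμEnv : ∀ {n m} → Env n m → Env n (suc m)
liftμEnv = bindμ []

frameOf : ∀ {n m} → ETerm n m → Frame n m
frameOf (tm u) = fArg u false
frameOf π₁ = fπ₁
frameOf π₂ = fπ₂
frameOf (case c d) = fCase c d

plug₁-frameOf : ∀ {n m} (t : Term n m) (e : ETerm n m) → plug₁ t (frameOf e) ≡ app t e
plug₁-frameOf t (tm u) = refl
plug₁-frameOf t π₁ = refl
plug₁-frameOf t π₂ = refl
plug₁-frameOf t (case c d) = refl

renF-comp : ∀ {n n' n'' m m' m''} {ρ : Fin n' → Fin n''} {ρ' : Fin n → Fin n'}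
            {θ : Fin m' → Fin m''} {θ' : Fin m → Fin m'} {ρ'' : Fin n → Fin n''} {θ'' : Fin m → Fin m''} →
            (λ i → ρ (ρ' i)) ≗ ρ'' → (λ i → θ (θ' i)) ≗ θ'' → (f : Frame n m) →
            renF ρ θ (renF ρ' θ' f) ≡ renF ρ'' θ'' f
renF-comp e g (fArg u b) = cong (λ z → fArg z b) (ren-comp-≗ e g u)
renF-comp e g fπ₁ = refl
renF-comp e g fπ₂ = refl
renF-comp e g (fCase c d) = cong₂ fCase (ren-comp-≗ (ext-∘ e) g c) (ren-comp-≗ (ext-∘ e) g d)
renF-comp e g (fL w) = cong fL (ren-comp-≗ e g w)

renF-id : ∀ {n m} {ρ : Fin n → Fin n} {θ : Fin m → Fin m} → ρ ≗ id → θ ≗ id →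
          (f : Frame n m) → renF ρ θ f ≡ f
renF-id e g (fArg u b) = cong (λ z → fArg z b) (ren-id e g u)
renF-id e g fπ₁ = refl
renF-id e g fπ₂ = refl
renF-id e g (fCase c d) = cong₂ fCase (ren-id (ext-id e) g c) (ren-id (ext-id e) g d)
renF-id e g (fL w) = cong fL (ren-id e g w)

subF-ren : ∀ {n n' n'' m} (σ : Fin n' → Term n'' m) (ρ : Fin n → Fin n') →
           (f : Frame n m) → subF σ (renF ρ (λ a → a) f) ≡ subF (σ ∘ ρ) f
subF-ren σ ρ (fArg u b) = cong (λ z → fArg z b) (sub-ren σ ρ (λ _ → refl) u)
subF-ren σ ρ fπ₁ = refl
subF-ren σ ρ fπ₂ = refl
subF-ren σ ρ (fCase c d) = cong₂ fCase
  (trans (sub-ren (exts σ) (ext ρ) (λ _ → refl) c) (sub-cong (λ { zero → refl ; (suc i) → refl }) c))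
  (trans (sub-ren (exts σ) (ext ρ) (λ _ → refl) d) (sub-cong (λ { zero → refl ; (suc i) → refl }) d))
subF-ren σ ρ (fL w) = cong fL (sub-ren σ ρ (λ _ → refl) w)

renF-sub : ∀ {n n' n'' m m'} (ρ : Fin n' → Fin n'') (θ : Fin m → Fin m') (σ : Fin n → Term n' m)
           (f : Frame n m) → renF ρ θ (subF σ f) ≡ subF (λ i → ren ρ θ (σ i)) (renF (λ x → x) θ f)
renF-sub ρ θ σ (fArg u b) = cong (λ z → fArg z b) (ren-sub ρ θ σ (λ _ → refl) u)
renF-sub ρ θ σ fπ₁ = refl
renF-sub ρ θ σ fπ₂ = refl
renF-sub ρ θ σ (fCase c d) = cong₂ fCase (ren-sub-exts ρ θ σ (λ _ → refl) c) (ren-sub-exts ρ θ σ (λ _ → refl) d)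
renF-sub ρ θ σ (fL w) = cong fL (ren-sub ρ θ σ (λ _ → refl) w)

subF-id : ∀ {n m} {σ : Fin n → Term n m} → σ ≗ var → (f : Frame n m) → subF σ f ≡ f
subF-id e (fArg u b) = cong (λ z → fArg z b) (sub-id e u)
subF-id e fπ₁ = refl
subF-id e fπ₂ = refl
subF-id e (fCase c d) = cong₂ fCase (sub-id (exts-var e) c) (sub-id (exts-var e) d)
subF-id e (fL w) = cong fL (sub-id e w)

wkλF-cancel : ∀ {n m} (V : Term n m) (f : Frame n m) → subF (σ₀ V) (wkλF f) ≡ f
wkλF-cancel V f = trans (subF-ren _ suc f) (subF-id (λ _ → refl) f)

map-∘-≗ : ∀ {A B C : Set} {f : B → C} {g : A → B} {h : A → C} → (∀ x → f (g x) ≡ h x) →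
          (k : List A) → map f (map g k) ≡ map h k
map-∘-≗ e k = trans (sym (map-∘ k)) (map-cong e k)

map-≗-id : ∀ {A : Set} {f : A → A} → f ≗ id → (k : List A) → map f k ≡ k
map-≗-id e k = trans (map-cong e k) (map-id k)

map-subF-wkλF : ∀ {n m} (V : Term n m) (K : List (Frame n m)) → map (subF (σ₀ V)) (map wkλF K) ≡ K
map-subF-wkλF V K = trans (map-∘-≗ (λ _ → refl) K) (map-≗-id (wkλF-cancel V) K)

plug-++ : ∀ {n m} (t : Term n m) (k k' : List (Frame n m)) → plug t (k ++ k') ≡ plug (plug t k) k'
plug-++ t [] k' = refl
plug-++ t (f ∷ k) k' = plug-++ (plug₁ t f) k k'

ren-plug₁ : ∀ {n n' m m'} (ρ : Fin n → Fin n') (θ : Fin m → Fin m') (t : Term n m) (f : Frame n m) →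
           ren ρ θ (plug₁ t f) ≡ plug₁ (ren ρ θ t) (renF ρ θ f)
ren-plug₁ ρ θ t (fArg u b) = refl
ren-plug₁ ρ θ t fπ₁ = refl
ren-plug₁ ρ θ t fπ₂ = refl
ren-plug₁ ρ θ t (fCase c d) = refl
ren-plug₁ ρ θ t (fL w) = refl

plug-ren : ∀ {n n' m m'} (ρ : Fin n → Fin n') (θ : Fin m → Fin m') (t : Term n m) (k : List (Frame n m)) →
           ren ρ θ (plug t k) ≡ plug (ren ρ θ t) (map (renF ρ θ) k)
plug-ren ρ θ t [] = refl
plug-ren ρ θ t (f ∷ k) = trans (plug-ren ρ θ (plug₁ t f) k) (cong (λ z → plug z (map (renF ρ θ) k)) (ren-plug₁ ρ θ t f))

sub-plug₁ : ∀ {n n' m} (σ : Fin n → Term n' m) (t : Term n m) (f : Frame n m) →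
           sub σ (plug₁ t f) ≡ plug₁ (sub σ t) (subF σ f)
sub-plug₁ σ t (fArg u b) = refl
sub-plug₁ σ t fπ₁ = refl
sub-plug₁ σ t fπ₂ = refl
sub-plug₁ σ t (fCase c d) = refl
sub-plug₁ σ t (fL w) = refl

plug-sub : ∀ {n n' m} (σ : Fin n → Term n' m) (t : Term n m) (k : List (Frame n m)) →
           sub σ (plug t k) ≡ plug (sub σ t) (map (subF σ) k)
plug-sub σ t [] = refl
plug-sub σ t (f ∷ k) = trans (plug-sub σ (plug₁ t f) k) (cong (λ z → plug z (map (subF σ) k)) (sub-plug₁ σ t f))

plug-▷* : ∀ {n m} {t t' : Term n m} (k : List (Frame n m)) → t ▷* t' → plug t k ▷* plug t' k
plug-▷* [] p = p
plug-▷* (fArg u b ∷ k) p = plug-▷* k (▷*-app p ε)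
plug-▷* (fπ₁ ∷ k) p = plug-▷* k (▷*-app p ε)
plug-▷* (fπ₂ ∷ k) p = plug-▷* k (▷*-app p ε)
plug-▷* (fCase c d ∷ k) p = plug-▷* k (▷*-app p ε)
plug-▷* (fL w ∷ k) p = plug-▷* k (▷*-app-tm ε p)

wkλF-sub : ∀ {n n' m} (σ : Fin n → Term n' m) (f : Frame n m) → wkλF (subF σ f) ≡ subF (exts σ) (wkλF f)
wkλF-sub σ f = trans (renF-sub suc (λ a → a) σ f) (trans (cong (subF _) (renF-id (λ _ → refl) (λ _ → refl) f))
                  (sym (subF-ren (exts σ) suc f)))

wkμF-sub : ∀ {n n' m} (σ : Fin n → Term n' m) (f : Frame n m) → wkμF (subF σ f) ≡ subF (λ i → wkμ (σ i)) (wkμF f)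
wkμF-sub σ f = renF-sub (λ x → x) suc σ f

map-wkλF-renF : ∀ {n n' m m'} (ρ : Fin n → Fin n') (θ : Fin m → Fin m') (k : List (Frame n m)) →
                map wkλF (map (renF ρ θ) k) ≡ map (renF (ext ρ) θ) (map wkλF k)
map-wkλF-renF ρ θ k = trans (map-∘-≗ (renF-comp (λ _ → refl) (λ _ → refl)) k)
                            (sym (map-∘-≗ (renF-comp (λ _ → refl) (λ _ → refl)) k))

map-wkμF-renF : ∀ {n n' m m'} (ρ : Fin n → Fin n') (θ : Fin m → Fin m') (k : List (Frame n m)) →
                map wkμF (map (renF ρ θ) k) ≡ map (renF ρ (ext θ)) (map wkμF k)
map-wkμF-renF ρ θ k = trans (map-∘-≗ (renF-comp (λ _ → refl) (λ _ → refl)) k)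
                            (sym (map-∘-≗ (renF-comp (λ _ → refl) (λ _ → refl)) k))

map-wkλF-subF : ∀ {n n' m} (σ : Fin n → Term n' m) (k : List (Frame n m)) →
                map wkλF (map (subF σ) k) ≡ map (subF (exts σ)) (map wkλF k)
map-wkλF-subF σ k = trans (sym (map-∘ k)) (trans (map-cong (wkλF-sub σ) k) (map-∘ k))

map-wkμF-subF : ∀ {n n' m} (σ : Fin n → Term n' m) (k : List (Frame n m)) →
                map wkμF (map (subF σ) k) ≡ map (subF (λ i → wkμ (σ i))) (map wkμF k)
map-wkμF-subF σ k = trans (sym (map-∘ k)) (trans (map-cong (wkμF-sub σ) k) (map-∘ k))

record RenEnv {n n' m m'} (ρ : Fin n → Fin n') (θ : Fin m → Fin m') (η : Env n m) (η' : Env n' m') : Set where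
  constructor mkRenEnv
  field renEnv-at : ∀ a → η' (θ a) ≡ map (renF ρ θ) (η a)
open RenEnv

RenEnv-wkλEnv : ∀ {n n' m m'} {ρ : Fin n → Fin n'} {θ : Fin m → Fin m'} {η : Env n m} {η' : Env n' m'} →
                RenEnv ρ θ η η' → RenEnv (ext ρ) θ (wkλEnv η) (wkλEnv η')
RenEnv-wkλEnv {ρ = ρ} {θ} {η} h = mkRenEnv λ a → trans (cong (map wkλF) (renEnv-at h a)) (map-wkλF-renF ρ θ (η a))

RenEnv-bindμ : ∀ {n n' m m'} {ρ : Fin n → Fin n'} {θ : Fin m → Fin m'} {η : Env n m} {η' : Env n' m'}
               (k : List (Frame n m)) → RenEnv ρ θ η η' → RenEnv ρ (ext θ) (bindμ k η) (bindμ (map (renF ρ θ) k) η')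
RenEnv-bindμ {ρ = ρ} {θ} {η} k h = mkRenEnv λ
  { zero → map-wkμF-renF ρ θ k
  ; (suc a) → trans (cong (map wkμF) (renEnv-at h a)) (map-wkμF-renF ρ θ (η a)) }

SubEnv : ∀ {n n' m} → (Fin n → Term n' m) → Env n m → Env n' m → Set
SubEnv σ η η' = ∀ a → η' a ≡ map (subF σ) (η a)

SubEnv-wkλEnv : ∀ {n n' m} {σ : Fin n → Term n' m} {η : Env n m} {η' : Env n' m} →
                SubEnv σ η η' → SubEnv (exts σ) (wkλEnv η) (wkλEnv η')
SubEnv-wkλEnv {σ = σ} {η} h a = trans (cong (map wkλF) (h a)) (map-wkλF-subF σ (η a))

SubEnv-bindμ : ∀ {n n' m} {σ : Fin n → Term n' m} {η : Env n m} {η' : Env n' m} (k : List (Frame n m)) →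
               SubEnv σ η η' → SubEnv (λ i → wkμ (σ i)) (bindμ k η) (bindμ (map (subF σ) k) η')
SubEnv-bindμ {σ = σ} k h zero = map-wkμF-subF σ k
SubEnv-bindμ {σ = σ} {η} k h (suc a) = trans (cong (map wkμF) (h a)) (map-wkμF-subF σ (η a))

-- Pushing stacks under named subterms

mutual
  push : ∀ {n m} → Env n m → Term n m → Term n m
  push η (var x) = var x
  push η (lam t) = lam (push (wkλEnv η) t)
  push η (app t e) = app (push η t) (pushE η e)
  push η (pair t u) = pair (push η t) (push η u)
  push η (ω₁ t) = ω₁ (push η t)
  push η (ω₂ t) = ω₂ (push η t)
  push η (mu t) = mu (push (liftμEnv η) t)
  push η (nam a t) = nam a (plug (push η t) (η a))

  pushE : ∀ {n m} → Env n m → ETerm n m → ETerm n m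
  pushE η (tm t) = tm (push η t)
  pushE η π₁ = π₁
  pushE η π₂ = π₂
  pushE η (case c d) = case (push (wkλEnv η) c) (push (wkλEnv η) d)

pushF : ∀ {n m} → Env n m → Frame n m → Frame n m
pushF η (fArg u b) = fArg (push η u) b
pushF η fπ₁ = fπ₁
pushF η fπ₂ = fπ₂
pushF η (fCase c d) = fCase (push (wkλEnv η) c) (push (wkλEnv η) d)
pushF η (fL w) = fL (push η w)

wkλEnv-cong : ∀ {n m} {η η' : Env n m} → η ≗ η' → wkλEnv η ≗ wkλEnv η'
wkλEnv-cong e a = cong (map wkλF) (e a)

liftμEnv-cong : ∀ {n m} {η η' : Env n m} → η ≗ η' → liftμEnv η ≗ liftμEnv η'
liftμEnv-cong e zero = refl
liftμEnv-cong e (suc a) = cong (map wkμF) (e a)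

mutual
  push-cong : ∀ {n m} {η η' : Env n m} → η ≗ η' → (t : Term n m) → push η t ≡ push η' t
  push-cong e (var x) = refl
  push-cong e (lam t) = cong lam (push-cong (wkλEnv-cong e) t)
  push-cong e (app t u) = cong₂ app (push-cong e t) (pushE-cong e u)
  push-cong e (pair t u) = cong₂ pair (push-cong e t) (push-cong e u)
  push-cong e (ω₁ t) = cong ω₁ (push-cong e t)
  push-cong e (ω₂ t) = cong ω₂ (push-cong e t)
  push-cong e (mu t) = cong mu (push-cong (liftμEnv-cong e) t)
  push-cong e (nam a t) = cong₂ (λ x y → nam a (plug x y)) (push-cong e t) (e a)

  pushE-cong : ∀ {n m} {η η' : Env n m} → η ≗ η' → (t : ETerm n m) → pushE η t ≡ pushE η' t
  pushE-cong e (tm t) = cong tm (push-cong e t)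
  pushE-cong e π₁ = refl
  pushE-cong e π₂ = refl
  pushE-cong e (case c d) = cong₂ case (push-cong (wkλEnv-cong e) c) (push-cong (wkλEnv-cong e) d)

mutual
  push-[] : ∀ {n m} {η : Env n m} → (∀ a → η a ≡ []) → (t : Term n m) → push η t ≡ t
  push-[] e (var x) = refl
  push-[] e (lam t) = cong lam (push-[] (λ a → cong (map wkλF) (e a)) t)
  push-[] e (app t u) = cong₂ app (push-[] e t) (pushE-[] e u)
  push-[] e (pair t u) = cong₂ pair (push-[] e t) (push-[] e u)
  push-[] e (ω₁ t) = cong ω₁ (push-[] e t)
  push-[] e (ω₂ t) = cong ω₂ (push-[] e t)
  push-[] e (mu t) = cong mu (push-[] (λ { zero → refl ; (suc a) → cong (map wkμF) (e a) }) t)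
  push-[] e (nam a t) = cong₂ (λ x y → nam a (plug x y)) (push-[] e t) (e a)

  pushE-[] : ∀ {n m} {η : Env n m} → (∀ a → η a ≡ []) → (t : ETerm n m) → pushE η t ≡ t
  pushE-[] e (tm t) = cong tm (push-[] e t)
  pushE-[] e π₁ = refl
  pushE-[] e π₂ = refl
  pushE-[] e (case c d) = cong₂ case (push-[] (λ a → cong (map wkλF) (e a)) c) (push-[] (λ a → cong (map wkλF) (e a)) d)

mutual
  ren-push : ∀ {n n' m m'} (ρ : Fin n → Fin n') (θ : Fin m → Fin m') {η : Env n m} {η' : Env n' m'} →
             RenEnv ρ θ η η' → (t : Term n m) → ren ρ θ (push η t) ≡ push η' (ren ρ θ t)
  ren-push ρ θ h (var x) = refl
  ren-push ρ θ h (lam t) = cong lam (ren-push (ext ρ) θ (RenEnv-wkλEnv h) t)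
  ren-push ρ θ h (app t u) = cong₂ app (ren-push ρ θ h t) (renE-pushE ρ θ h u)
  ren-push ρ θ h (pair t u) = cong₂ pair (ren-push ρ θ h t) (ren-push ρ θ h u)
  ren-push ρ θ h (ω₁ t) = cong ω₁ (ren-push ρ θ h t)
  ren-push ρ θ h (ω₂ t) = cong ω₂ (ren-push ρ θ h t)
  ren-push ρ θ h (mu t) = cong mu (ren-push ρ (ext θ) (RenEnv-bindμ [] h) t)
  ren-push ρ θ {η} h (nam a t) = cong (nam (θ a)) (trans (plug-ren ρ θ (push η t) (η a))
    (cong₂ plug (ren-push ρ θ h t) (sym (renEnv-at h a))))

  renE-pushE : ∀ {n n' m m'} (ρ : Fin n → Fin n') (θ : Fin m → Fin m') {η : Env n m} {η' : Env n' m'} →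
               RenEnv ρ θ η η' → (t : ETerm n m) → renE ρ θ (pushE η t) ≡ pushE η' (renE ρ θ t)
  renE-pushE ρ θ h (tm t) = cong tm (ren-push ρ θ h t)
  renE-pushE ρ θ h π₁ = refl
  renE-pushE ρ θ h π₂ = refl
  renE-pushE ρ θ h (case c d) =
    cong₂ case (ren-push (ext ρ) θ (RenEnv-wkλEnv h) c) (ren-push (ext ρ) θ (RenEnv-wkλEnv h) d)

renF-pushF : ∀ {n n' m m'} (ρ : Fin n → Fin n') (θ : Fin m → Fin m') {η : Env n m} {η' : Env n' m'} →
             RenEnv ρ θ η η' → (f : Frame n m) → renF ρ θ (pushF η f) ≡ pushF η' (renF ρ θ f)
renF-pushF ρ θ h (fArg u b) = cong (λ z → fArg z b) (ren-push ρ θ h u)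
renF-pushF ρ θ h fπ₁ = refl
renF-pushF ρ θ h fπ₂ = refl
renF-pushF ρ θ h (fCase c d) =
  cong₂ fCase (ren-push (ext ρ) θ (RenEnv-wkλEnv h) c) (ren-push (ext ρ) θ (RenEnv-wkλEnv h) d)
renF-pushF ρ θ h (fL w) = cong fL (ren-push ρ θ h w)

map-pushF-wkλF : ∀ {n m} (θ : Env n m) (k : List (Frame n m)) →
                 map (pushF (wkλEnv θ)) (map wkλF k) ≡ map wkλF (map (pushF θ) k)
map-pushF-wkλF θ k = trans (sym (map-∘ k))
  (trans (map-cong (λ f → sym (renF-pushF suc (λ a → a) (mkRenEnv λ _ → refl) f)) k) (map-∘ k))

map-pushF-liftμEnv : ∀ {n m} (θ : Env n m) (k : List (Frame n m)) →
                     map (pushF (liftμEnv θ)) (map wkμF k) ≡ map wkμF (map (pushF θ) k)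
map-pushF-liftμEnv θ k = trans (sym (map-∘ k))
  (trans (map-cong (λ f → sym (renF-pushF (λ x → x) suc (mkRenEnv λ _ → refl) f)) k) (map-∘ k))

mutual
  sub-push : ∀ {n n' m} {σ : Fin n → Term n' m} {σ' : Fin n → Term n' m} {η : Env n m} {η' : Env n' m} →
             (∀ x → σ' x ≡ push η' (σ x)) → SubEnv σ' η η' → (t : Term n m) → sub σ' (push η t) ≡ push η' (sub σ t)
  sub-push hσ hη (var x) = hσ x
  sub-push hσ hη (lam t) = cong lam (sub-push (push-exts hσ) (SubEnv-wkλEnv hη) t)
  sub-push hσ hη (app t u) = cong₂ app (sub-push hσ hη t) (subE-pushE hσ hη u)
  sub-push hσ hη (pair t u) = cong₂ pair (sub-push hσ hη t) (sub-push hσ hη u)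
  sub-push hσ hη (ω₁ t) = cong ω₁ (sub-push hσ hη t)
  sub-push hσ hη (ω₂ t) = cong ω₂ (sub-push hσ hη t)
  sub-push {σ = σ} hσ hη (mu t) =
    cong mu (sub-push (λ x → trans (cong wkμ (hσ x)) (ren-push (λ x → x) suc (mkRenEnv λ _ → refl) (σ x))) (SubEnv-bindμ [] hη) t)
  sub-push {σ' = σ'} {η} hσ hη (nam a t) = cong (nam a) (trans (plug-sub σ' (push η t) (η a))
    (cong₂ plug (sub-push hσ hη t) (sym (hη a))))

  subE-pushE : ∀ {n n' m} {σ : Fin n → Term n' m} {σ' : Fin n → Term n' m} {η : Env n m} {η' : Env n' m} →
               (∀ x → σ' x ≡ push η' (σ x)) → SubEnv σ' η η' → (t : ETerm n m) → subE σ' (pushE η t) ≡ pushE η' (subE σ t)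
  subE-pushE hσ hη (tm t) = cong tm (sub-push hσ hη t)
  subE-pushE hσ hη π₁ = refl
  subE-pushE hσ hη π₂ = refl
  subE-pushE hσ hη (case c d) =
    cong₂ case (sub-push (push-exts hσ) (SubEnv-wkλEnv hη) c) (sub-push (push-exts hσ) (SubEnv-wkλEnv hη) d)

  push-exts : ∀ {n n' m} {σ σ' : Fin n → Term n' m} {η' : Env n' m} →
              (∀ x → σ' x ≡ push η' (σ x)) → ∀ x → exts σ' x ≡ push (wkλEnv η') (exts σ x)
  push-exts hσ zero = refl
  push-exts {σ = σ} hσ (suc x) = trans (cong wkλ (hσ x)) (ren-push suc (λ a → a) (mkRenEnv λ _ → refl) (σ x))

push-plug₁ : ∀ {n m} (η : Env n m) (t : Term n m) (f : Frame n m) → push η (plug₁ t f) ≡ plug₁ (push η t) (pushF η f)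
push-plug₁ η t (fArg u b) = refl
push-plug₁ η t fπ₁ = refl
push-plug₁ η t fπ₂ = refl
push-plug₁ η t (fCase c d) = refl
push-plug₁ η t (fL w) = refl

push-plug : ∀ {n m} (η : Env n m) (t : Term n m) (k : List (Frame n m)) → push η (plug t k) ≡ plug (push η t) (map (pushF η) k)
push-plug η t [] = refl
push-plug η t (f ∷ k) = trans (push-plug η (plug₁ t f) k) (cong (λ z → plug z (map (pushF η) k)) (push-plug₁ η t f))

IsComposite : ∀ {n m} → Env n m → Env n m → Env n m → Set
IsComposite η θ η'' = ∀ a → η'' a ≡ map (pushF θ) (η a) ++ θ a

IsComposite-wkλEnv : ∀ {n m} {η θ η'' : Env n m} → IsComposite η θ η'' → IsComposite (wkλEnv η) (wkλEnv θ) (wkλEnv η'')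
IsComposite-wkλEnv {η = η} {θ} h a = trans (cong (map wkλF) (h a)) (trans (map-++ wkλF (map (pushF θ) (η a)) (θ a))
  (cong (_++ wkλEnv θ a) (sym (map-pushF-wkλF θ (η a)))))

IsComposite-bindμ : ∀ {n m} {η θ η'' : Env n m} (k : List (Frame n m)) → IsComposite η θ η'' →
                    IsComposite (bindμ k η) (liftμEnv θ) (bindμ (map (pushF θ) k) η'')
IsComposite-bindμ {θ = θ} k h zero = sym (trans (++-identityʳ _) (map-pushF-liftμEnv θ k))
IsComposite-bindμ {η = η} {θ} k h (suc a) = trans (cong (map wkμF) (h a)) (trans (map-++ wkμF (map (pushF θ) (η a)) (θ a))
  (cong (_++ liftμEnv θ (suc a)) (sym (map-pushF-liftμEnv θ (η a)))))

mutual
  push-push : ∀ {n m} {η θ η'' : Env n m} → IsComposite η θ η'' → (t : Term n m) → push θ (push η t) ≡ push η'' t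
  push-push h (var x) = refl
  push-push {η = η} {θ} h (lam t) = cong lam (push-push (IsComposite-wkλEnv {η = η} {θ} h) t)
  push-push h (app t u) = cong₂ app (push-push h t) (pushE-pushE h u)
  push-push h (pair t u) = cong₂ pair (push-push h t) (push-push h u)
  push-push h (ω₁ t) = cong ω₁ (push-push h t)
  push-push h (ω₂ t) = cong ω₂ (push-push h t)
  push-push {θ = θ} h (mu t) = cong mu (push-push (IsComposite-bindμ {θ = θ} [] h) t)
  push-push {η = η} {θ} {η''} h (nam a t) = cong (nam a) (begin
    plug (push θ (plug (push η t) (η a))) (θ a)                 ≡⟨ cong (λ z → plug z (θ a)) (push-plug θ (push η t) (η a)) ⟩
    plug (plug (push θ (push η t)) (map (pushF θ) (η a))) (θ a) ≡⟨ plug-++ (push θ (push η t)) (map (pushF θ) (η a)) (θ a) ⟨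
    plug (push θ (push η t)) (map (pushF θ) (η a) ++ θ a)       ≡⟨ cong₂ plug (push-push h t) (sym (h a)) ⟩
    plug (push η'' t) (η'' a)                                   ∎)
    where open ≡-Reasoning

  pushE-pushE : ∀ {n m} {η θ η'' : Env n m} → IsComposite η θ η'' → (t : ETerm n m) → pushE θ (pushE η t) ≡ pushE η'' t
  pushE-pushE h (tm t) = cong tm (push-push h t)
  pushE-pushE h π₁ = refl
  pushE-pushE h π₂ = refl
  pushE-pushE {η = η} {θ} h (case c d) =
    cong₂ case (push-push (IsComposite-wkλEnv {η = η} {θ} h) c) (push-push (IsComposite-wkλEnv {η = η} {θ} h) d)

singleEnv : ∀ {n m} → Fin m → List (Frame n m) → Env n m
singleEnv a k b = if does (b ≟ a) then k else []

renF-frameOf : ∀ {n n' m m'} (ρ : Fin n → Fin n') (θ : Fin m → Fin m') (e : ETerm n m) → renF ρ θ (frameOf e) ≡ frameOf (renE ρ θ e)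
renF-frameOf ρ θ (tm u) = refl
renF-frameOf ρ θ π₁ = refl
renF-frameOf ρ θ π₂ = refl
renF-frameOf ρ θ (case c d) = refl

subF-frameOf : ∀ {n n' m} (σ : Fin n → Term n' m) (e : ETerm n m) → subF σ (frameOf e) ≡ frameOf (subE σ e)
subF-frameOf σ (tm u) = refl
subF-frameOf σ π₁ = refl
subF-frameOf σ π₂ = refl
subF-frameOf σ (case c d) = refl

singleEnv-wkλF : ∀ {n m} (a : Fin m) (f : Frame n m) → singleEnv a (wkλF f ∷ []) ≗ wkλEnv (singleEnv a (f ∷ []))
singleEnv-wkλF a f b with does (b ≟ a)
... | true = refl
... | false = refl

singleEnv-wkμF : ∀ {n m} (a : Fin m) (f : Frame n m) → singleEnv (suc a) (wkμF f ∷ []) ≗ liftμEnv (singleEnv a (f ∷ []))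
singleEnv-wkμF a f zero = refl
singleEnv-wkμF a f (suc b) with does (b ≟ a)
... | true = refl
... | false = refl

singleEnv-frameOf-wkλE : ∀ {n m} (a : Fin m) (e : ETerm n m) →
                         singleEnv a (frameOf (wkλE e) ∷ []) ≗ wkλEnv (singleEnv a (frameOf e ∷ []))
singleEnv-frameOf-wkλE a e b =
  trans (cong (λ z → singleEnv a (z ∷ []) b) (sym (renF-frameOf suc (λ a → a) e))) (singleEnv-wkλF a (frameOf e) b)

singleEnv-frameOf-wkμE : ∀ {n m} (a : Fin m) (e : ETerm n m) →
                         singleEnv (suc a) (frameOf (wkμE e) ∷ []) ≗ liftμEnv (singleEnv a (frameOf e ∷ []))
singleEnv-frameOf-wkμE a e b =
  trans (cong (λ z → singleEnv (suc a) (z ∷ []) b) (sym (renF-frameOf (λ x → x) suc e))) (singleEnv-wkμF a (frameOf e) b)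

mutual
  substR≡push : ∀ {n m} (a : Fin m) (e : ETerm n m) (t : Term n m) → substR a e t ≡ push (singleEnv a (frameOf e ∷ [])) t
  substR≡push a e (var x) = refl
  substR≡push a e (lam t) = cong lam (trans (substR≡push a (wkλE e) t) (push-cong (singleEnv-frameOf-wkλE a e) t))
  substR≡push a e (app t u) = cong₂ app (substR≡push a e t) (substRE≡pushE a e u)
  substR≡push a e (pair t u) = cong₂ pair (substR≡push a e t) (substR≡push a e u)
  substR≡push a e (ω₁ t) = cong ω₁ (substR≡push a e t)
  substR≡push a e (ω₂ t) = cong ω₂ (substR≡push a e t)
  substR≡push a e (mu t) = cong mu (trans (substR≡push (suc a) (wkμE e) t) (push-cong (singleEnv-frameOf-wkμE a e) t))
  substR≡push a e (nam b t) with does (b ≟ a)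
  ... | true = cong (nam b) (trans (cong (λ z → app z e) (substR≡push a e t)) (sym (plug₁-frameOf _ e)))
  ... | false = cong (nam b) (substR≡push a e t)

  substRE≡pushE : ∀ {n m} (a : Fin m) (e : ETerm n m) (t : ETerm n m) → substRE a e t ≡ pushE (singleEnv a (frameOf e ∷ [])) t
  substRE≡pushE a e (tm t) = cong tm (substR≡push a e t)
  substRE≡pushE a e π₁ = refl
  substRE≡pushE a e π₂ = refl
  substRE≡pushE a e (case c d) = cong₂ case
    (trans (substR≡push a (wkλE e) c) (push-cong (singleEnv-frameOf-wkλE a e) c))
    (trans (substR≡push a (wkλE e) d) (push-cong (singleEnv-frameOf-wkλE a e) d))

mutual
  substL≡push : ∀ {n m} (a : Fin m) (V : Term n m) (t : Term n m) → substL a V t ≡ push (singleEnv a (fL V ∷ [])) t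
  substL≡push a V (var x) = refl
  substL≡push a V (lam t) = cong lam (trans (substL≡push a (wkλ V) t) (push-cong (singleEnv-wkλF a (fL V)) t))
  substL≡push a V (app t u) = cong₂ app (substL≡push a V t) (substLE≡pushE a V u)
  substL≡push a V (pair t u) = cong₂ pair (substL≡push a V t) (substL≡push a V u)
  substL≡push a V (ω₁ t) = cong ω₁ (substL≡push a V t)
  substL≡push a V (ω₂ t) = cong ω₂ (substL≡push a V t)
  substL≡push a V (mu t) = cong mu (trans (substL≡push (suc a) (wkμ V) t) (push-cong (singleEnv-wkμF a (fL V)) t))
  substL≡push a V (nam b t) with does (b ≟ a)
  ... | true = cong (λ z → nam b (app V (tm z))) (substL≡push a V t)
  ... | false = cong (nam b) (substL≡push a V t)

  substLE≡pushE : ∀ {n m} (a : Fin m) (V : Term n m) (t : ETerm n m) → substLE a V t ≡ pushE (singleEnv a (fL V ∷ [])) t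
  substLE≡pushE a V (tm t) = cong tm (substL≡push a V t)
  substLE≡pushE a V π₁ = refl
  substLE≡pushE a V π₂ = refl
  substLE≡pushE a V (case c d) = cong₂ case
    (trans (substL≡push a (wkλ V) c) (push-cong (singleEnv-wkλF a (fL V)) c))
    (trans (substL≡push a (wkλ V) d) (push-cong (singleEnv-wkλF a (fL V)) d))

eraseFlag : ∀ {n m} → Frame n m → Frame n m
eraseFlag (fArg U b) = fArg U false
eraseFlag fπ₁ = fπ₁
eraseFlag fπ₂ = fπ₂
eraseFlag (fCase c d) = fCase c d
eraseFlag (fL W) = fL W

plug-eraseFlag : ∀ {n m} (t : Term n m) (k : List (Frame n m)) → plug t (map eraseFlag k) ≡ plug t k
plug-eraseFlag t [] = refl
plug-eraseFlag t (fArg U b ∷ k) = plug-eraseFlag _ k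
plug-eraseFlag t (fπ₁ ∷ k) = plug-eraseFlag _ k
plug-eraseFlag t (fπ₂ ∷ k) = plug-eraseFlag _ k
plug-eraseFlag t (fCase c d ∷ k) = plug-eraseFlag _ k
plug-eraseFlag t (fL W ∷ k) = plug-eraseFlag _ k

eraseFlag-renF : ∀ {n n' m m'} (ρ : Fin n → Fin n') (θ : Fin m → Fin m') (f : Frame n m) → eraseFlag (renF ρ θ f) ≡ renF ρ θ (eraseFlag f)
eraseFlag-renF ρ θ (fArg U b) = refl
eraseFlag-renF ρ θ fπ₁ = refl
eraseFlag-renF ρ θ fπ₂ = refl
eraseFlag-renF ρ θ (fCase c d) = refl
eraseFlag-renF ρ θ (fL W) = refl

-- push only plugs frames, and plug ignores the flag of an argument frame.
EqualUpToFlags : ∀ {n m} → Env n m → Env n m → Set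
EqualUpToFlags η η' = ∀ a → map eraseFlag (η a) ≡ map eraseFlag (η' a)

EqualUpToFlags-ren : ∀ {n n' m m'} (ρ : Fin n → Fin n') (θ : Fin m → Fin m') (k k' : List (Frame n m)) →
          map eraseFlag k ≡ map eraseFlag k' → map eraseFlag (map (renF ρ θ) k) ≡ map eraseFlag (map (renF ρ θ) k')
EqualUpToFlags-ren ρ θ k k' e = trans (map-∘-≗ (eraseFlag-renF ρ θ) k) (trans (sym (map-∘-≗ (λ _ → refl) k))
  (trans (cong (map (renF ρ θ)) e) (trans (map-∘-≗ (λ _ → refl) k') (sym (map-∘-≗ (eraseFlag-renF ρ θ) k')))))

mutual
  push-eraseFlags : ∀ {n m} {η η' : Env n m} → EqualUpToFlags η η' → (t : Term n m) → push η t ≡ push η' t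
  push-eraseFlags e (var x) = refl
  push-eraseFlags {η = η} {η'} e (lam t) = cong lam (push-eraseFlags (λ a → EqualUpToFlags-ren suc (λ a → a) (η a) (η' a) (e a)) t)
  push-eraseFlags e (app t u) = cong₂ app (push-eraseFlags e t) (pushE-eraseFlags e u)
  push-eraseFlags e (pair t u) = cong₂ pair (push-eraseFlags e t) (push-eraseFlags e u)
  push-eraseFlags e (ω₁ t) = cong ω₁ (push-eraseFlags e t)
  push-eraseFlags e (ω₂ t) = cong ω₂ (push-eraseFlags e t)
  push-eraseFlags {η = η} {η'} e (mu t) = cong mu (push-eraseFlags h t)
    where h : EqualUpToFlags (liftμEnv η) (liftμEnv η')
          h zero = refl
          h (suc a) = EqualUpToFlags-ren (λ x → x) suc (η a) (η' a) (e a)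
  push-eraseFlags {η = η} {η'} e (nam a t) = cong (nam a) (trans (sym (plug-eraseFlag _ (η a)))
     (trans (cong₂ plug (push-eraseFlags e t) (e a)) (plug-eraseFlag _ (η' a))))

  pushE-eraseFlags : ∀ {n m} {η η' : Env n m} → EqualUpToFlags η η' → (t : ETerm n m) → pushE η t ≡ pushE η' t
  pushE-eraseFlags e (tm t) = cong tm (push-eraseFlags e t)
  pushE-eraseFlags e π₁ = refl
  pushE-eraseFlags e π₂ = refl
  pushE-eraseFlags {η = η} {η'} e (case c d) = cong₂ case (push-eraseFlags (λ a → EqualUpToFlags-ren suc (λ a → a) (η a) (η' a) (e a)) c)
                                                 (push-eraseFlags (λ a → EqualUpToFlags-ren suc (λ a → a) (η a) (η' a) (e a)) d)

pushF-[] : ∀ {n m} {θ : Env n m} → (∀ a → θ a ≡ []) → (f : Frame n m) → pushF θ f ≡ f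
pushF-[] h (fArg U b) = cong (λ z → fArg z b) (push-[] h U)
pushF-[] h fπ₁ = refl
pushF-[] h fπ₂ = refl
pushF-[] h (fCase c d) = cong₂ fCase (push-[] (λ a → cong (map wkλF) (h a)) c) (push-[] (λ a → cong (map wkλF) (h a)) d)
pushF-[] h (fL W) = cong fL (push-[] h W)

pushF-wkμF : ∀ {n m} {θ : Env n (suc m)} → (∀ a → θ (suc a) ≡ []) → (f : Frame n m) → pushF θ (wkμF f) ≡ wkμF f
pushF-wkμF {θ = θ} h f =
  trans (sym (renF-pushF (λ x → x) suc {η = emptyEnv} {η' = θ} (mkRenEnv h) f)) (cong wkμF (pushF-[] (λ _ → refl) f))

map-pushF-wkμF : ∀ {n m} {θ : Env n (suc m)} → (∀ a → θ (suc a) ≡ []) → (k : List (Frame n m)) → map (pushF θ) (map wkμF k) ≡ map wkμF k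
map-pushF-wkμF h [] = refl
map-pushF-wkμF h (f ∷ k) = cong₂ _∷_ (pushF-wkμF h f) (map-pushF-wkμF h k)

env₀ : ∀ {n m} → List (Frame n (suc m)) → Env n (suc m)
env₀ k zero = k
env₀ k (suc a) = []

ren-push₀ : ∀ {n n' m m'} (ρ : Fin n → Fin n') (θ : Fin m → Fin m') (f : Frame n (suc m)) (t : Term n (suc m)) →
         ren ρ (ext θ) (push (singleEnv zero (f ∷ [])) t) ≡ push (singleEnv zero (renF ρ (ext θ) f ∷ [])) (ren ρ (ext θ) t)
ren-push₀ ρ θ f t = ren-push ρ (ext θ) (mkRenEnv λ { zero → refl ; (suc a) → refl }) t

sub-push₀ : ∀ {n n' m} (σ : Fin n → Term n' m) (f : Frame n (suc m)) (t : Term n (suc m)) →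
            sub (λ i → wkμ (σ i)) (push (singleEnv zero (f ∷ [])) t) ≡
            push (singleEnv zero (subF (λ i → wkμ (σ i)) f ∷ [])) (sub (λ i → wkμ (σ i)) t)
sub-push₀ σ f t = sub-push fresh-name (λ { zero → refl ; (suc a) → refl }) t
  where
  fresh-name : ∀ x → wkμ (σ x) ≡ push (singleEnv zero (subF (λ i → wkμ (σ i)) f ∷ [])) (wkμ (σ x))
  fresh-name x = sym (trans (sym (ren-push (λ x → x) suc {η = λ _ → []} (mkRenEnv λ _ → refl) (σ x)))
                   (cong wkμ (push-[] (λ _ → refl) (σ x))))

ren-substR₀ : ∀ {n n' m m'} (ρ : Fin n → Fin n') (θ : Fin m → Fin m') (e : ETerm n (suc m)) (t : Term n (suc m)) →
              ren ρ (ext θ) (substR zero e t) ≡ substR zero (renE ρ (ext θ) e) (ren ρ (ext θ) t)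
ren-substR₀ ρ θ e t = trans (cong (ren ρ (ext θ)) (substR≡push zero e t)) (trans (ren-push₀ ρ θ (frameOf e) t)
  (trans (cong (λ z → push (singleEnv zero (z ∷ [])) _) (renF-frameOf ρ (ext θ) e)) (sym (substR≡push zero _ _))))

ren-substL₀ : ∀ {n n' m m'} (ρ : Fin n → Fin n') (θ : Fin m → Fin m') (V : Term n (suc m)) (t : Term n (suc m)) →
              ren ρ (ext θ) (substL zero V t) ≡ substL zero (ren ρ (ext θ) V) (ren ρ (ext θ) t)
ren-substL₀ ρ θ V t = trans (cong (ren ρ (ext θ)) (substL≡push zero V t)) (trans (ren-push₀ ρ θ (fL V) t)
  (sym (substL≡push zero _ _)))

sub-substR₀ : ∀ {n n' m} (σ : Fin n → Term n' m) (e : ETerm n (suc m)) (t : Term n (suc m)) →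
              sub (λ i → wkμ (σ i)) (substR zero e t) ≡ substR zero (subE (λ i → wkμ (σ i)) e) (sub (λ i → wkμ (σ i)) t)
sub-substR₀ σ e t = trans (cong (sub _) (substR≡push zero e t)) (trans (sub-push₀ σ (frameOf e) t)
  (trans (cong (λ z → push (singleEnv zero (z ∷ [])) _) (subF-frameOf _ e)) (sym (substR≡push zero _ _))))

sub-substL₀ : ∀ {n n' m} (σ : Fin n → Term n' m) (V : Term n (suc m)) (t : Term n (suc m)) →
              sub (λ i → wkμ (σ i)) (substL zero V t) ≡ substL zero (sub (λ i → wkμ (σ i)) V) (sub (λ i → wkμ (σ i)) t)
sub-substL₀ σ V t = trans (cong (sub _) (substL≡push zero V t)) (trans (sub-push₀ σ (fL V) t)
  (sym (substL≡push zero _ _)))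

wkλ-ren : ∀ {n n' m m'} (ρ : Fin n → Fin n') (θ : Fin m → Fin m') (t : Term n m) →
          ren (ext ρ) θ (wkλ t) ≡ wkλ (ren ρ θ t)
wkλ-ren ρ θ t = trans (ren-comp-≗ (λ _ → refl) (λ _ → refl) t) (sym (ren-comp-≗ (λ _ → refl) (λ _ → refl) t))

wkλE-ren : ∀ {n n' m m'} (ρ : Fin n → Fin n') (θ : Fin m → Fin m') (t : ETerm n m) →
          renE (ext ρ) θ (wkλE t) ≡ wkλE (renE ρ θ t)
wkλE-ren ρ θ t = trans (renE-comp _ _ _ _ t) (trans (renE-cong (λ _ → refl) (λ _ → refl) t) (sym (renE-comp _ _ _ _ t)))

wkμ-ren : ∀ {n n' m m'} (ρ : Fin n → Fin n') (θ : Fin m → Fin m') (t : Term n m) →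
          ren ρ (ext θ) (wkμ t) ≡ wkμ (ren ρ θ t)
wkμ-ren ρ θ t = trans (ren-comp-≗ (λ _ → refl) (λ _ → refl) t) (sym (ren-comp-≗ (λ _ → refl) (λ _ → refl) t))

wkμE-ren : ∀ {n n' m m'} (ρ : Fin n → Fin n') (θ : Fin m → Fin m') (t : ETerm n m) →
          renE ρ (ext θ) (wkμE t) ≡ wkμE (renE ρ θ t)
wkμE-ren ρ θ t = trans (renE-comp _ _ _ _ t) (trans (renE-cong (λ _ → refl) (λ _ → refl) t) (sym (renE-comp _ _ _ _ t)))

▷-≡ : ∀ {n m} {t u u' : Term n m} → t ▷ u → u ≡ u' → t ▷ u'
▷-≡ r refl = r

mutual
  ren-▷ : ∀ {n n' m m'} (ρ : Fin n → Fin n') (θ : Fin m → Fin m') {t t' : Term n m} → t ▷ t' → ren ρ θ t ▷ ren ρ θ t'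
  ren-▷ ρ θ (β {t} {V} v) = ▷-≡ (β (Value-ren ρ θ v)) (sym (ren-[0≔] ρ θ t V))
  ren-▷ ρ θ (proj₁ v w) = proj₁ (Value-ren ρ θ v) (Value-ren ρ θ w)
  ren-▷ ρ θ (proj₂ v w) = proj₂ (Value-ren ρ θ v) (Value-ren ρ θ w)
  ren-▷ ρ θ (cas₁ {V} {t₁} v) = ▷-≡ (cas₁ (Value-ren ρ θ v)) (sym (ren-[0≔] ρ θ t₁ V))
  ren-▷ ρ θ (cas₂ {V} {_} {t₂} v) = ▷-≡ (cas₂ (Value-ren ρ θ v)) (sym (ren-[0≔] ρ θ t₂ V))
  ren-▷ ρ θ (comR {t} {t₁} {t₂} {e}) = ▷-≡ comR (cong (λ z → app _ (case (app _ z) (app _ z))) (sym (wkλE-ren ρ θ e)))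
  ren-▷ ρ θ (comL {V} v) = ▷-≡ (comL (Value-ren ρ θ v)) (cong (λ z → app _ (case (app z _) (app z _))) (sym (wkλ-ren ρ θ V)))
  ren-▷ ρ θ (μR {t} {e}) = ▷-≡ μR (cong mu (sym (trans (ren-substR₀ ρ θ (wkμE e) t)
                              (cong (λ z → substR zero z (ren ρ (ext θ) t)) (wkμE-ren ρ θ e)))))
  ren-▷ ρ θ (μL {V} {t} v) = ▷-≡ (μL (Value-ren ρ θ v)) (cong mu (sym (trans (ren-substL₀ ρ θ (wkμ V) t)
                              (cong (λ z → substL zero z (ren ρ (ext θ) t)) (wkμ-ren ρ θ V)))))
  ren-▷ ρ θ (ξ-lam r) = ξ-lam (ren-▷ (ext ρ) θ r)
  ren-▷ ρ θ (ξ-appˡ r) = ξ-appˡ (ren-▷ ρ θ r)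
  ren-▷ ρ θ (ξ-appʳ r) = ξ-appʳ (ren-▷E ρ θ r)
  ren-▷ ρ θ (ξ-pairˡ r) = ξ-pairˡ (ren-▷ ρ θ r)
  ren-▷ ρ θ (ξ-pairʳ r) = ξ-pairʳ (ren-▷ ρ θ r)
  ren-▷ ρ θ (ξ-ω₁ r) = ξ-ω₁ (ren-▷ ρ θ r)
  ren-▷ ρ θ (ξ-ω₂ r) = ξ-ω₂ (ren-▷ ρ θ r)
  ren-▷ ρ θ (ξ-mu r) = ξ-mu (ren-▷ ρ (ext θ) r)
  ren-▷ ρ θ (ξ-nam r) = ξ-nam (ren-▷ ρ θ r)

  ren-▷E : ∀ {n n' m m'} (ρ : Fin n → Fin n') (θ : Fin m → Fin m') {t t' : ETerm n m} → t ▷E t' → renE ρ θ t ▷E renE ρ θ t'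
  ren-▷E ρ θ (ξ-tm r) = ξ-tm (ren-▷ ρ θ r)
  ren-▷E ρ θ (ξ-caseˡ r) = ξ-caseˡ (ren-▷ (ext ρ) θ r)
  ren-▷E ρ θ (ξ-caseʳ r) = ξ-caseʳ (ren-▷ (ext ρ) θ r)

ren-▷* : ∀ {n n' m m'} (ρ : Fin n → Fin n') (θ : Fin m → Fin m') {t t' : Term n m} → t ▷* t' → ren ρ θ t ▷* ren ρ θ t'
ren-▷* ρ θ = gmap (ren ρ θ) (ren-▷ ρ θ)

ValueSub-exts : ∀ {n n' m} {σ : Fin n → Term n' m} → ValueSub σ → ValueSub (exts σ)
ValueSub-exts h zero = v-var
ValueSub-exts h (suc x) = Value-ren suc (λ a → a) (h x)

ValueSub-wkμ : ∀ {n n' m} {σ : Fin n → Term n' m} → ValueSub σ → ValueSub (λ i → wkμ (σ i))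
ValueSub-wkμ h x = Value-ren (λ x → x) suc (h x)

mutual
  sub-▷ : ∀ {n n' m} (σ : Fin n → Term n' m) → ValueSub σ → {t t' : Term n m} → t ▷ t' → sub σ t ▷ sub σ t'
  sub-▷ σ h (β {t} {V} v) = ▷-≡ (β (Value-sub σ h v)) (sym (sub-[0≔] σ t V))
  sub-▷ σ h (proj₁ v w) = proj₁ (Value-sub σ h v) (Value-sub σ h w)
  sub-▷ σ h (proj₂ v w) = proj₂ (Value-sub σ h v) (Value-sub σ h w)
  sub-▷ σ h (cas₁ {V} {t₁} v) = ▷-≡ (cas₁ (Value-sub σ h v)) (sym (sub-[0≔] σ t₁ V))
  sub-▷ σ h (cas₂ {V} {_} {t₂} v) = ▷-≡ (cas₂ (Value-sub σ h v)) (sym (sub-[0≔] σ t₂ V))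
  sub-▷ σ h (comR {t} {t₁} {t₂} {e}) = ▷-≡ comR (cong (λ z → app _ (case (app _ z) (app _ z))) (wkλE-sub σ e))
  sub-▷ σ h (comL {V} v) = ▷-≡ (comL (Value-sub σ h v)) (cong (λ z → app _ (case (app z _) (app z _))) (wkλ-sub σ V))
  sub-▷ σ h (μR {t} {e}) = ▷-≡ μR (cong mu (sym (trans (sub-substR₀ σ (wkμE e) t)
                              (cong (λ z → substR zero z (sub (λ i → wkμ (σ i)) t)) (sym (wkμE-sub σ e))))))
  sub-▷ σ h (μL {V} {t} v) = ▷-≡ (μL (Value-sub σ h v)) (cong mu (sym (trans (sub-substL₀ σ (wkμ V) t)
                              (cong (λ z → substL zero z (sub (λ i → wkμ (σ i)) t)) (sym (wkμ-sub σ V))))))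
  sub-▷ σ h (ξ-lam r) = ξ-lam (sub-▷ (exts σ) (ValueSub-exts h) r)
  sub-▷ σ h (ξ-appˡ r) = ξ-appˡ (sub-▷ σ h r)
  sub-▷ σ h (ξ-appʳ r) = ξ-appʳ (sub-▷E σ h r)
  sub-▷ σ h (ξ-pairˡ r) = ξ-pairˡ (sub-▷ σ h r)
  sub-▷ σ h (ξ-pairʳ r) = ξ-pairʳ (sub-▷ σ h r)
  sub-▷ σ h (ξ-ω₁ r) = ξ-ω₁ (sub-▷ σ h r)
  sub-▷ σ h (ξ-ω₂ r) = ξ-ω₂ (sub-▷ σ h r)
  sub-▷ σ h (ξ-mu r) = ξ-mu (sub-▷ _ (ValueSub-wkμ h) r)
  sub-▷ σ h (ξ-nam r) = ξ-nam (sub-▷ σ h r)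

  sub-▷E : ∀ {n n' m} (σ : Fin n → Term n' m) → ValueSub σ → {t t' : ETerm n m} → t ▷E t' → subE σ t ▷E subE σ t'
  sub-▷E σ h (ξ-tm r) = ξ-tm (sub-▷ σ h r)
  sub-▷E σ h (ξ-caseˡ r) = ξ-caseˡ (sub-▷ (exts σ) (ValueSub-exts h) r)
  sub-▷E σ h (ξ-caseʳ r) = ξ-caseʳ (sub-▷ (exts σ) (ValueSub-exts h) r)

sub-▷* : ∀ {n n' m} (σ : Fin n → Term n' m) → ValueSub σ → {t t' : Term n m} → t ▷* t' → sub σ t ▷* sub σ t'
sub-▷* σ h = gmap (sub σ) (sub-▷ σ h)

-- Development

-- fire b W f contracts the redex formed by a developed head W and the frame f, if there is one;
-- b records that W stands for a value, as projections, case and (V □) require.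
fireβ : ∀ {n m} → Term n m → Term n m → Term n m
fireβ (var x) U = app (var x) (tm U)
fireβ (lam s) U = s [0≔ U ]
fireβ (app t e) U = app (app t e) (tm U)
fireβ (pair t u) U = app (pair t u) (tm U)
fireβ (ω₁ t) U = app (ω₁ t) (tm U)
fireβ (ω₂ t) U = app (ω₂ t) (tm U)
fireβ (mu t) U = app (mu t) (tm U)
fireβ (nam a t) U = app (nam a t) (tm U)

fireπ₁ : ∀ {n m} → Bool → Term n m → Term n m
fireπ₁ b (var x) = app (var x) π₁
fireπ₁ b (lam s) = app (lam s) π₁
fireπ₁ b (app t e) = app (app t e) π₁
fireπ₁ b (ω₁ t) = app (ω₁ t) π₁
fireπ₁ b (ω₂ t) = app (ω₂ t) π₁
fireπ₁ b (mu t) = app (mu t) π₁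
fireπ₁ b (nam a t) = app (nam a t) π₁
fireπ₁ true (pair t u) = t
fireπ₁ false (pair t u) = app (pair t u) π₁

fireπ₂ : ∀ {n m} → Bool → Term n m → Term n m
fireπ₂ b (var x) = app (var x) π₂
fireπ₂ b (lam s) = app (lam s) π₂
fireπ₂ b (app t e) = app (app t e) π₂
fireπ₂ b (ω₁ t) = app (ω₁ t) π₂
fireπ₂ b (ω₂ t) = app (ω₂ t) π₂
fireπ₂ b (mu t) = app (mu t) π₂
fireπ₂ b (nam a t) = app (nam a t) π₂
fireπ₂ true (pair t u) = u
fireπ₂ false (pair t u) = app (pair t u) π₂

fireC : ∀ {n m} → Bool → Term n m → Term (suc n) m → Term (suc n) m → Term n m
fireC b (var x) c d = app (var x) (case c d)
fireC b (lam s) c d = app (lam s) (case c d)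
fireC b (app t e) c d = app (app t e) (case c d)
fireC b (pair t u) c d = app (pair t u) (case c d)
fireC b (mu t) c d = app (mu t) (case c d)
fireC b (nam a t) c d = app (nam a t) (case c d)
fireC true (ω₁ t) c d = c [0≔ t ]
fireC true (ω₂ t) c d = d [0≔ t ]
fireC false (ω₁ t) c d = app (ω₁ t) (case c d)
fireC false (ω₂ t) c d = app (ω₂ t) (case c d)

fireL : ∀ {n m} → Bool → Term n m → Term n m → Term n m
fireL b W (var x) = app (var x) (tm W)
fireL b W (app t e) = app (app t e) (tm W)
fireL b W (pair t u) = app (pair t u) (tm W)
fireL b W (ω₁ t) = app (ω₁ t) (tm W)
fireL b W (ω₂ t) = app (ω₂ t) (tm W)
fireL b W (mu t) = app (mu t) (tm W)
fireL b W (nam a t) = app (nam a t) (tm W)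
fireL true W (lam s) = s [0≔ W ]
fireL false W (lam s) = app (lam s) (tm W)

fire : ∀ {n m} → Bool → Term n m → Frame n m → Term n m
fire b W (fArg U true) = fireβ W U
fire b W (fArg U false) = app W (tm U)
fire b W fπ₁ = fireπ₁ b W
fire b W fπ₂ = fireπ₂ b W
fire b W (fCase c d) = fireC b W c d
fire b W (fL V) = fireL b W V

plugFire : ∀ {n m} → Bool → Term n m → List (Frame n m) → Term n m
plugFire b W [] = W
plugFire b W (f ∷ k) = plug (fire b W f) k

WfFrame : ∀ {n m} → Frame n m → Set
WfFrame (fArg U b) = b ≡ true → Value U
WfFrame fπ₁ = ⊤
WfFrame fπ₂ = ⊤
WfFrame (fCase c d) = ⊤
WfFrame (fL W) = Value W

WfStack : ∀ {n m} → List (Frame n m) → Set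
WfStack = All WfFrame

WfEnv : ∀ {n m} → Env n m → Set
WfEnv η = ∀ a → WfStack (η a)

ValueIf : ∀ {n m} → Bool → Term n m → Set
ValueIf b W = b ≡ true → Value W

mutual
  develop : ∀ {n m} → Term n m → List (Frame n m) → Env n m → Term n m
  develop (var x) k η = plugFire true (var x) k
  develop (lam t) k η = plugFire true (lam (develop t [] (wkλEnv η))) k
  develop (pair t u) k η = plugFire (isValue t ∧ isValue u) (pair (develop t [] η) (develop u [] η)) k
  develop (ω₁ t) k η = plugFire (isValue t) (ω₁ (develop t [] η)) k
  develop (ω₂ t) k η = plugFire (isValue t) (ω₂ (develop t [] η)) k
  develop (nam a t) k η = plugFire true (nam a (develop t (η a) η)) k
  develop (mu t) k η = mu (develop t [] (bindμ k η))
  develop (app t (tm u)) k η = developArg (isValue t) t u k η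
  develop (app t π₁) k η = develop t (fπ₁ ∷ k) η
  develop (app t π₂) k η = develop t (fπ₂ ∷ k) η
  develop (app t (case c d)) k η = develop t (fCase (develop c (map wkλF k) (wkλEnv η)) (develop d (map wkλF k) (wkλEnv η)) ∷ []) η

  developArg : ∀ {n m} → Bool → Term n m → Term n m → List (Frame n m) → Env n m → Term n m
  developArg true t u k η = develop u (fL (develop t [] η) ∷ k) η
  developArg false t u k η = develop t (fArg (develop u [] η) (isValue u) ∷ k) η

dev : ∀ {n m} → Term n m → Term n m
dev t = develop t [] emptyEnv

Value-▷ : ∀ {n m} {t t' : Term n m} → Value t → t ▷ t' → Value t'
Value-▷ v-lam (ξ-lam r) = v-lam
Value-▷ (v-pair v w) (ξ-pairˡ r) = v-pair (Value-▷ v r) w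
Value-▷ (v-pair v w) (ξ-pairʳ r) = v-pair v (Value-▷ w r)
Value-▷ (v-ω₁ v) (ξ-ω₁ r) = v-ω₁ (Value-▷ v r)
Value-▷ (v-ω₂ v) (ξ-ω₂ r) = v-ω₂ (Value-▷ v r)
Value-▷ v-nam (ξ-nam r) = v-nam

lam-▷*-inv : ∀ {n m} {s : Term (suc n) m} {W} → lam s ▷* W → Σ _ λ s' → (W ≡ lam s') × (s ▷* s')
lam-▷*-inv ε = _ , refl , ε
lam-▷*-inv (ξ-lam r ◅ rs) with lam-▷*-inv rs
... | s' , refl , q = s' , refl , r ◅ q

pair-▷*-inv : ∀ {n m} {a b : Term n m} {W} → pair a b ▷* W →
           Σ _ λ a' → Σ _ λ b' → (W ≡ pair a' b') × (a ▷* a') × (b ▷* b')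
pair-▷*-inv ε = _ , _ , refl , ε , ε
pair-▷*-inv (ξ-pairˡ r ◅ rs) with pair-▷*-inv rs
... | a' , b' , refl , p , q = a' , b' , refl , r ◅ p , q
pair-▷*-inv (ξ-pairʳ r ◅ rs) with pair-▷*-inv rs
... | a' , b' , refl , p , q = a' , b' , refl , p , r ◅ q

ω₁-▷*-inv : ∀ {n m} {a : Term n m} {W} → ω₁ a ▷* W → Σ _ λ a' → (W ≡ ω₁ a') × (a ▷* a')
ω₁-▷*-inv ε = _ , refl , ε
ω₁-▷*-inv (ξ-ω₁ r ◅ rs) with ω₁-▷*-inv rs
... | a' , refl , q = a' , refl , r ◅ q

ω₂-▷*-inv : ∀ {n m} {a : Term n m} {W} → ω₂ a ▷* W → Σ _ λ a' → (W ≡ ω₂ a') × (a ▷* a')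
ω₂-▷*-inv ε = _ , refl , ε
ω₂-▷*-inv (ξ-ω₂ r ◅ rs) with ω₂-▷*-inv rs
... | a' , refl , q = a' , refl , r ◅ q

plug₁-▷*-fire : ∀ {n m} (b : Bool) (W : Term n m) (f : Frame n m) → ValueIf b W → WfFrame f → plug₁ W f ▷* fire b W f
plug₁-▷*-fire b W (fArg U false) h w = ε
plug₁-▷*-fire b (lam s) (fArg U true) h w = β (w refl) ◅ ε
plug₁-▷*-fire b (var x) (fArg U true) h w = ε
plug₁-▷*-fire b (app t e) (fArg U true) h w = ε
plug₁-▷*-fire b (pair t u) (fArg U true) h w = ε
plug₁-▷*-fire b (ω₁ t) (fArg U true) h w = ε
plug₁-▷*-fire b (ω₂ t) (fArg U true) h w = ε
plug₁-▷*-fire b (mu t) (fArg U true) h w = ε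
plug₁-▷*-fire b (nam a t) (fArg U true) h w = ε
plug₁-▷*-fire true (pair t u) fπ₁ h w with h refl
... | v-pair p q = proj₁ p q ◅ ε
plug₁-▷*-fire false (pair t u) fπ₁ h w = ε
plug₁-▷*-fire b (var x) fπ₁ h w = ε
plug₁-▷*-fire b (lam s) fπ₁ h w = ε
plug₁-▷*-fire b (app t e) fπ₁ h w = ε
plug₁-▷*-fire b (ω₁ t) fπ₁ h w = ε
plug₁-▷*-fire b (ω₂ t) fπ₁ h w = ε
plug₁-▷*-fire b (mu t) fπ₁ h w = ε
plug₁-▷*-fire b (nam a t) fπ₁ h w = ε
plug₁-▷*-fire true (pair t u) fπ₂ h w with h refl
... | v-pair p q = proj₂ p q ◅ ε
plug₁-▷*-fire false (pair t u) fπ₂ h w = ε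
plug₁-▷*-fire b (var x) fπ₂ h w = ε
plug₁-▷*-fire b (lam s) fπ₂ h w = ε
plug₁-▷*-fire b (app t e) fπ₂ h w = ε
plug₁-▷*-fire b (ω₁ t) fπ₂ h w = ε
plug₁-▷*-fire b (ω₂ t) fπ₂ h w = ε
plug₁-▷*-fire b (mu t) fπ₂ h w = ε
plug₁-▷*-fire b (nam a t) fπ₂ h w = ε
plug₁-▷*-fire true (ω₁ t) (fCase c d) h w with h refl
... | v-ω₁ p = cas₁ p ◅ ε
plug₁-▷*-fire true (ω₂ t) (fCase c d) h w with h refl
... | v-ω₂ p = cas₂ p ◅ ε
plug₁-▷*-fire false (ω₁ t) (fCase c d) h w = ε
plug₁-▷*-fire false (ω₂ t) (fCase c d) h w = ε
plug₁-▷*-fire b (var x) (fCase c d) h w = ε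
plug₁-▷*-fire b (lam s) (fCase c d) h w = ε
plug₁-▷*-fire b (app t e) (fCase c d) h w = ε
plug₁-▷*-fire b (pair t u) (fCase c d) h w = ε
plug₁-▷*-fire b (mu t) (fCase c d) h w = ε
plug₁-▷*-fire b (nam a t) (fCase c d) h w = ε
plug₁-▷*-fire true W (fL (lam s)) h w = β (h refl) ◅ ε
plug₁-▷*-fire false W (fL (lam s)) h w = ε
plug₁-▷*-fire b W (fL (var x)) h w = ε
plug₁-▷*-fire b W (fL (app t e)) h w = ε
plug₁-▷*-fire b W (fL (pair t u)) h w = ε
plug₁-▷*-fire b W (fL (ω₁ t)) h w = ε
plug₁-▷*-fire b W (fL (ω₂ t)) h w = ε
plug₁-▷*-fire b W (fL (mu t)) h w = ε
plug₁-▷*-fire b W (fL (nam a t)) h w = ε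

ren-fire : ∀ {n n' m m'} (ρ : Fin n → Fin n') (θ : Fin m → Fin m') (b : Bool) (W : Term n m) (f : Frame n m) →
           ren ρ θ (fire b W f) ≡ fire b (ren ρ θ W) (renF ρ θ f)
ren-fire ρ θ b W (fArg U false) = refl
ren-fire ρ θ b (lam s) (fArg U true) = ren-[0≔] ρ θ s U
ren-fire ρ θ b (var x) (fArg U true) = refl
ren-fire ρ θ b (app t e) (fArg U true) = refl
ren-fire ρ θ b (pair t u) (fArg U true) = refl
ren-fire ρ θ b (ω₁ t) (fArg U true) = refl
ren-fire ρ θ b (ω₂ t) (fArg U true) = refl
ren-fire ρ θ b (mu t) (fArg U true) = refl
ren-fire ρ θ b (nam a t) (fArg U true) = refl
ren-fire ρ θ true (pair t u) fπ₁ = refl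
ren-fire ρ θ false (pair t u) fπ₁ = refl
ren-fire ρ θ b (var x) fπ₁ = refl
ren-fire ρ θ b (lam s) fπ₁ = refl
ren-fire ρ θ b (app t e) fπ₁ = refl
ren-fire ρ θ b (ω₁ t) fπ₁ = refl
ren-fire ρ θ b (ω₂ t) fπ₁ = refl
ren-fire ρ θ b (mu t) fπ₁ = refl
ren-fire ρ θ b (nam a t) fπ₁ = refl
ren-fire ρ θ true (pair t u) fπ₂ = refl
ren-fire ρ θ false (pair t u) fπ₂ = refl
ren-fire ρ θ b (var x) fπ₂ = refl
ren-fire ρ θ b (lam s) fπ₂ = refl
ren-fire ρ θ b (app t e) fπ₂ = refl
ren-fire ρ θ b (ω₁ t) fπ₂ = refl
ren-fire ρ θ b (ω₂ t) fπ₂ = refl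
ren-fire ρ θ b (mu t) fπ₂ = refl
ren-fire ρ θ b (nam a t) fπ₂ = refl
ren-fire ρ θ true (ω₁ t) (fCase c d) = ren-[0≔] ρ θ c t
ren-fire ρ θ true (ω₂ t) (fCase c d) = ren-[0≔] ρ θ d t
ren-fire ρ θ false (ω₁ t) (fCase c d) = refl
ren-fire ρ θ false (ω₂ t) (fCase c d) = refl
ren-fire ρ θ b (var x) (fCase c d) = refl
ren-fire ρ θ b (lam s) (fCase c d) = refl
ren-fire ρ θ b (app t e) (fCase c d) = refl
ren-fire ρ θ b (pair t u) (fCase c d) = refl
ren-fire ρ θ b (mu t) (fCase c d) = refl
ren-fire ρ θ b (nam a t) (fCase c d) = refl
ren-fire ρ θ true W (fL (lam s)) = ren-[0≔] ρ θ s W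
ren-fire ρ θ false W (fL (lam s)) = refl
ren-fire ρ θ b W (fL (var x)) = refl
ren-fire ρ θ b W (fL (app t e)) = refl
ren-fire ρ θ b W (fL (pair t u)) = refl
ren-fire ρ θ b W (fL (ω₁ t)) = refl
ren-fire ρ θ b W (fL (ω₂ t)) = refl
ren-fire ρ θ b W (fL (mu t)) = refl
ren-fire ρ θ b W (fL (nam a t)) = refl

push-[0≔] : ∀ {n m} (θ : Env n m) (s : Term (suc n) m) (U : Term n m) →
         push θ (s [0≔ U ]) ≡ (push (wkλEnv θ) s) [0≔ push θ U ]
push-[0≔] θ s U = trans (cong (push θ) ([0≔]≡sub-σ₀ s U))
  (trans (sym (sub-push {σ = σ₀ U} {σ' = σ₀ (push θ U)} (λ { zero → refl ; (suc x) → refl }) cancel s))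
         (sym ([0≔]≡sub-σ₀ (push (wkλEnv θ) s) (push θ U))))
  where
  cancel : SubEnv (σ₀ (push θ U)) (wkλEnv θ) θ
  cancel a = sym (map-subF-wkλF (push θ U) (θ a))

push-fire : ∀ {n m} (θ : Env n m) (b : Bool) (W : Term n m) (f : Frame n m) →
           push θ (fire b W f) ≡ fire b (push θ W) (pushF θ f)
push-fire θ b W (fArg U false) = refl
push-fire θ b (lam s) (fArg U true) = push-[0≔] θ s U
push-fire θ b (var x) (fArg U true) = refl
push-fire θ b (app t e) (fArg U true) = refl
push-fire θ b (pair t u) (fArg U true) = refl
push-fire θ b (ω₁ t) (fArg U true) = refl
push-fire θ b (ω₂ t) (fArg U true) = refl
push-fire θ b (mu t) (fArg U true) = refl
push-fire θ b (nam a t) (fArg U true) = refl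
push-fire θ true (pair t u) fπ₁ = refl
push-fire θ false (pair t u) fπ₁ = refl
push-fire θ b (var x) fπ₁ = refl
push-fire θ b (lam s) fπ₁ = refl
push-fire θ b (app t e) fπ₁ = refl
push-fire θ b (ω₁ t) fπ₁ = refl
push-fire θ b (ω₂ t) fπ₁ = refl
push-fire θ b (mu t) fπ₁ = refl
push-fire θ b (nam a t) fπ₁ = refl
push-fire θ true (pair t u) fπ₂ = refl
push-fire θ false (pair t u) fπ₂ = refl
push-fire θ b (var x) fπ₂ = refl
push-fire θ b (lam s) fπ₂ = refl
push-fire θ b (app t e) fπ₂ = refl
push-fire θ b (ω₁ t) fπ₂ = refl
push-fire θ b (ω₂ t) fπ₂ = refl
push-fire θ b (mu t) fπ₂ = refl
push-fire θ b (nam a t) fπ₂ = refl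
push-fire θ true (ω₁ t) (fCase c d) = push-[0≔] θ c t
push-fire θ true (ω₂ t) (fCase c d) = push-[0≔] θ d t
push-fire θ false (ω₁ t) (fCase c d) = refl
push-fire θ false (ω₂ t) (fCase c d) = refl
push-fire θ b (var x) (fCase c d) = refl
push-fire θ b (lam s) (fCase c d) = refl
push-fire θ b (app t e) (fCase c d) = refl
push-fire θ b (pair t u) (fCase c d) = refl
push-fire θ b (mu t) (fCase c d) = refl
push-fire θ b (nam a t) (fCase c d) = refl
push-fire θ true W (fL (lam s)) = push-[0≔] θ s W
push-fire θ false W (fL (lam s)) = refl
push-fire θ b W (fL (var x)) = refl
push-fire θ b W (fL (app t e)) = refl
push-fire θ b W (fL (pair t u)) = refl
push-fire θ b W (fL (ω₁ t)) = refl
push-fire θ b W (fL (ω₂ t)) = refl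
push-fire θ b W (fL (mu t)) = refl
push-fire θ b W (fL (nam a t)) = refl

WfFrame-subF : ∀ {n n' m} (σ : Fin n → Term n' m) → ValueSub σ → (f : Frame n m) → WfFrame f → WfFrame (subF σ f)
WfFrame-subF σ h (fArg U b) w = λ e → Value-sub σ h (w e)
WfFrame-subF σ h fπ₁ w = tt
WfFrame-subF σ h fπ₂ w = tt
WfFrame-subF σ h (fCase c d) w = tt
WfFrame-subF σ h (fL V) w = Value-sub σ h w

WfStack-subF : ∀ {n n' m} (σ : Fin n → Term n' m) → ValueSub σ → {k : List (Frame n m)} → WfStack k → WfStack (map (subF σ) k)
WfStack-subF σ h = gmap⁺ (WfFrame-subF σ h _)

sub-plug₁-▷*-fire : ∀ {n n' m} (σ : Fin n → Term n' m) → ValueSub σ → (b : Bool) (W : Term n m) (f : Frame n m) →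
               ValueIf b W → WfFrame f → sub σ (plug₁ W f) ▷* fire b (sub σ W) (subF σ f)
sub-plug₁-▷*-fire σ h b W f bv wf = subst (λ z → z ▷* fire b (sub σ W) (subF σ f)) (sym (sub-plug₁ σ W f))
  (plug₁-▷*-fire b (sub σ W) (subF σ f) (λ e → Value-sub σ h (bv e)) (WfFrame-subF σ h f wf))

sub-fire : ∀ {n n' m} (σ : Fin n → Term n' m) → ValueSub σ → (b : Bool) (W : Term n m) (f : Frame n m) →
           ValueIf b W → WfFrame f → sub σ (fire b W f) ▷* fire b (sub σ W) (subF σ f)
sub-fire σ h b W (fArg U false) bv wf = ε
sub-fire σ h b (lam s) (fArg U true) bv wf = ≡⇒▷* (sub-[0≔] σ s U)
sub-fire σ h b (var x) (fArg U true) bv wf = sub-plug₁-▷*-fire σ h b (var x) (fArg U true) bv wf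
sub-fire σ h b (app t e) (fArg U true) bv wf = ε
sub-fire σ h b (pair t u) (fArg U true) bv wf = ε
sub-fire σ h b (ω₁ t) (fArg U true) bv wf = ε
sub-fire σ h b (ω₂ t) (fArg U true) bv wf = ε
sub-fire σ h b (mu t) (fArg U true) bv wf = ε
sub-fire σ h b (nam a t) (fArg U true) bv wf = ε
sub-fire σ h true (pair t u) fπ₁ bv wf = ε
sub-fire σ h false (pair t u) fπ₁ bv wf = ε
sub-fire σ h b (var x) fπ₁ bv wf = sub-plug₁-▷*-fire σ h b (var x) fπ₁ bv wf
sub-fire σ h b (lam s) fπ₁ bv wf = ε
sub-fire σ h b (app t e) fπ₁ bv wf = ε
sub-fire σ h b (ω₁ t) fπ₁ bv wf = ε
sub-fire σ h b (ω₂ t) fπ₁ bv wf = ε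
sub-fire σ h b (mu t) fπ₁ bv wf = ε
sub-fire σ h b (nam a t) fπ₁ bv wf = ε
sub-fire σ h true (pair t u) fπ₂ bv wf = ε
sub-fire σ h false (pair t u) fπ₂ bv wf = ε
sub-fire σ h b (var x) fπ₂ bv wf = sub-plug₁-▷*-fire σ h b (var x) fπ₂ bv wf
sub-fire σ h b (lam s) fπ₂ bv wf = ε
sub-fire σ h b (app t e) fπ₂ bv wf = ε
sub-fire σ h b (ω₁ t) fπ₂ bv wf = ε
sub-fire σ h b (ω₂ t) fπ₂ bv wf = ε
sub-fire σ h b (mu t) fπ₂ bv wf = ε
sub-fire σ h b (nam a t) fπ₂ bv wf = ε
sub-fire σ h true (ω₁ t) (fCase c d) bv wf = ≡⇒▷* (sub-[0≔] σ c t)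
sub-fire σ h true (ω₂ t) (fCase c d) bv wf = ≡⇒▷* (sub-[0≔] σ d t)
sub-fire σ h false (ω₁ t) (fCase c d) bv wf = ε
sub-fire σ h false (ω₂ t) (fCase c d) bv wf = ε
sub-fire σ h b (var x) (fCase c d) bv wf = sub-plug₁-▷*-fire σ h b (var x) (fCase c d) bv wf
sub-fire σ h b (lam s) (fCase c d) bv wf = ε
sub-fire σ h b (app t e) (fCase c d) bv wf = ε
sub-fire σ h b (pair t u) (fCase c d) bv wf = ε
sub-fire σ h b (mu t) (fCase c d) bv wf = ε
sub-fire σ h b (nam a t) (fCase c d) bv wf = ε
sub-fire σ h true W (fL (lam s)) bv wf = ≡⇒▷* (sub-[0≔] σ s W)
sub-fire σ h false W (fL (lam s)) bv wf = ε
sub-fire σ h b W (fL (var x)) bv wf = sub-plug₁-▷*-fire σ h b W (fL (var x)) bv wf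
sub-fire σ h b W (fL (app t e)) bv wf = ε
sub-fire σ h b W (fL (pair t u)) bv wf = ε
sub-fire σ h b W (fL (ω₁ t)) bv wf = ε
sub-fire σ h b W (fL (ω₂ t)) bv wf = ε
sub-fire σ h b W (fL (mu t)) bv wf = ε
sub-fire σ h b W (fL (nam a t)) bv wf = ε

∧-split : ∀ {a b : Bool} → (a ∧ b) ≡ true → (a ≡ true) × (b ≡ true)
∧-split {true} {true} refl = refl , refl

ren-plugFire : ∀ {n n' m m'} (ρ : Fin n → Fin n') (θ : Fin m → Fin m') (b : Bool) (W : Term n m) (k : List (Frame n m)) →
            ren ρ θ (plugFire b W k) ≡ plugFire b (ren ρ θ W) (map (renF ρ θ) k)
ren-plugFire ρ θ b W [] = refl
ren-plugFire ρ θ b W (f ∷ k) = trans (plug-ren ρ θ (fire b W f) k) (cong (λ z → plug z (map (renF ρ θ) k)) (ren-fire ρ θ b W f))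

push-plugFire : ∀ {n m} (θ : Env n m) (b : Bool) (W : Term n m) (k : List (Frame n m)) →
            push θ (plugFire b W k) ≡ plugFire b (push θ W) (map (pushF θ) k)
push-plugFire θ b W [] = refl
push-plugFire θ b W (f ∷ k) = trans (push-plug θ (fire b W f) k) (cong (λ z → plug z (map (pushF θ) k)) (push-fire θ b W f))

WfFrame-renF : ∀ {n n' m m'} (ρ : Fin n → Fin n') (θ : Fin m → Fin m') (f : Frame n m) → WfFrame f → WfFrame (renF ρ θ f)
WfFrame-renF ρ θ (fArg U b) w = λ e → Value-ren ρ θ (w e)
WfFrame-renF ρ θ fπ₁ w = tt
WfFrame-renF ρ θ fπ₂ w = tt
WfFrame-renF ρ θ (fCase c d) w = tt
WfFrame-renF ρ θ (fL V) w = Value-ren ρ θ w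

WfStack-renF : ∀ {n n' m m'} (ρ : Fin n → Fin n') (θ : Fin m → Fin m') {k : List (Frame n m)} → WfStack k → WfStack (map (renF ρ θ) k)
WfStack-renF ρ θ = gmap⁺ (WfFrame-renF ρ θ _)

WfEnv-wkλEnv : ∀ {n m} {η : Env n m} → WfEnv η → WfEnv (wkλEnv η)
WfEnv-wkλEnv w a = WfStack-renF suc (λ a → a) (w a)

WfEnv-bindμ : ∀ {n m} {k : List (Frame n m)} {η : Env n m} → WfStack k → WfEnv η → WfEnv (bindμ k η)
WfEnv-bindμ wk w zero = WfStack-renF (λ x → x) suc wk
WfEnv-bindμ wk w (suc a) = WfStack-renF (λ x → x) suc (w a)

isValue-push : ∀ {n m} (θ : Env n m) (t : Term n m) → isValue (push θ t) ≡ isValue t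
isValue-push θ (var x) = refl
isValue-push θ (lam t) = refl
isValue-push θ (app t e) = refl
isValue-push θ (pair t u) = cong₂ _∧_ (isValue-push θ t) (isValue-push θ u)
isValue-push θ (ω₁ t) = isValue-push θ t
isValue-push θ (ω₂ t) = isValue-push θ t
isValue-push θ (mu t) = refl
isValue-push θ (nam a t) = refl

Value-push : ∀ {n m} (θ : Env n m) {t : Term n m} → Value t → Value (push θ t)
Value-push θ {t} v = isValue⇒Value (trans (isValue-push θ t) (Value⇒isValue v))

WfFrame-pushF : ∀ {n m} (θ : Env n m) (f : Frame n m) → WfFrame f → WfFrame (pushF θ f)
WfFrame-pushF θ (fArg U b) w = λ e → Value-push θ (w e)
WfFrame-pushF θ fπ₁ w = tt
WfFrame-pushF θ fπ₂ w = tt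
WfFrame-pushF θ (fCase c d) w = tt
WfFrame-pushF θ (fL V) w = Value-push θ w

WfStack-pushF : ∀ {n m} (θ : Env n m) {k : List (Frame n m)} → WfStack k → WfStack (map (pushF θ) k)
WfStack-pushF θ = gmap⁺ (WfFrame-pushF θ _)

Value-develop : ∀ {n m} (t : Term n m) (η : Env n m) → isValue t ≡ true → Value (develop t [] η)
Value-develop (var x) η e = v-var
Value-develop (lam t) η e = v-lam
Value-develop (pair t u) η e with ∧-split {isValue t} e
... | p , q = v-pair (Value-develop t η p) (Value-develop u η q)
Value-develop (ω₁ t) η e = v-ω₁ (Value-develop t η e)
Value-develop (ω₂ t) η e = v-ω₂ (Value-develop t η e)
Value-develop (nam a t) η e = v-nam

develop-value : ∀ {n m} (t : Term n m) (k : List (Frame n m)) (η : Env n m) → isValue t ≡ true →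
           develop t k η ≡ plugFire true (develop t [] η) k
develop-value (var x) k η e = refl
develop-value (lam t) k η e = refl
develop-value (pair t u) k η e rewrite e = refl
develop-value (ω₁ t) k η e rewrite e = refl
develop-value (ω₂ t) k η e rewrite e = refl
develop-value (nam a t) k η e = refl

WfFrame-devArg : ∀ {n m} (u : Term n m) (η : Env n m) → WfFrame (fArg (develop u [] η) (isValue u))
WfFrame-devArg u η e = Value-develop u η e

mutual
  ren-develop : ∀ {n n' m m'} (ρ : Fin n → Fin n') (θ : Fin m → Fin m') (t : Term n m) (k : List (Frame n m))
                {η : Env n m} {η' : Env n' m'} → RenEnv ρ θ η η' →
                ren ρ θ (develop t k η) ≡ develop (ren ρ θ t) (map (renF ρ θ) k) η'
  ren-develop ρ θ (var x) k h = ren-plugFire ρ θ true (var x) k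
  ren-develop ρ θ (lam t) k h = trans (ren-plugFire ρ θ true _ k)
    (cong (λ z → plugFire true (lam z) (map (renF ρ θ) k)) (ren-develop (ext ρ) θ t [] (RenEnv-wkλEnv h)))
  ren-develop ρ θ (pair t u) k h = trans (ren-plugFire ρ θ _ _ k)
    (cong₂ (λ b x → plugFire b x (map (renF ρ θ) k)) (sym (cong₂ _∧_ (isValue-ren ρ θ t) (isValue-ren ρ θ u)))
      (cong₂ pair (ren-develop ρ θ t [] h) (ren-develop ρ θ u [] h)))
  ren-develop ρ θ (ω₁ t) k h = trans (ren-plugFire ρ θ _ _ k)
    (cong₂ (λ b x → plugFire b (ω₁ x) (map (renF ρ θ) k)) (sym (isValue-ren ρ θ t)) (ren-develop ρ θ t [] h))
  ren-develop ρ θ (ω₂ t) k h = trans (ren-plugFire ρ θ _ _ k)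
    (cong₂ (λ b x → plugFire b (ω₂ x) (map (renF ρ θ) k)) (sym (isValue-ren ρ θ t)) (ren-develop ρ θ t [] h))
  ren-develop ρ θ (nam a t) k {η} {η'} h = trans (ren-plugFire ρ θ true _ k)
    (cong (λ z → plugFire true (nam (θ a) z) (map (renF ρ θ) k))
      (trans (ren-develop ρ θ t (η a) h) (cong (λ z → develop (ren ρ θ t) z η') (sym (renEnv-at h a)))))
  ren-develop ρ θ (mu t) k h = cong mu (ren-develop ρ (ext θ) t [] (RenEnv-bindμ k h))
  ren-develop ρ θ (app t (tm u)) k {η} {η'} h rewrite isValue-ren ρ θ t = go (isValue t)
    where go : ∀ b → ren ρ θ (developArg b t u k η) ≡ developArg b (ren ρ θ t) (ren ρ θ u) (map (renF ρ θ) k) η'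
          go true = trans (ren-develop ρ θ u (fL (develop t [] η) ∷ k) h)
            (cong (λ z → develop (ren ρ θ u) (fL z ∷ map (renF ρ θ) k) η') (ren-develop ρ θ t [] h))
          go false = trans (ren-develop ρ θ t (fArg (develop u [] η) (isValue u) ∷ k) h)
            (cong₂ (λ z b → develop (ren ρ θ t) (fArg z b ∷ map (renF ρ θ) k) η') (ren-develop ρ θ u [] h)
              (sym (isValue-ren ρ θ u)))
  ren-develop ρ θ (app t π₁) k h = ren-develop ρ θ t (fπ₁ ∷ k) h
  ren-develop ρ θ (app t π₂) k h = ren-develop ρ θ t (fπ₂ ∷ k) h
  ren-develop ρ θ (app t (case c d)) k {η' = η'} h = trans (ren-develop ρ θ t _ h)
    (cong₂ (λ x y → develop (ren ρ θ t) (fCase x y ∷ []) η') (ren-developBranch ρ θ c k h) (ren-developBranch ρ θ d k h))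

  ren-developBranch : ∀ {n n' m m'} (ρ : Fin n → Fin n') (θ : Fin m → Fin m') (c : Term (suc n) m) (k : List (Frame n m))
                      {η : Env n m} {η' : Env n' m'} → RenEnv ρ θ η η' →
                      ren (ext ρ) θ (develop c (map wkλF k) (wkλEnv η)) ≡
                      develop (ren (ext ρ) θ c) (map wkλF (map (renF ρ θ) k)) (wkλEnv η')
  ren-developBranch ρ θ c k {η' = η'} h = trans (ren-develop (ext ρ) θ c (map wkλF k) (RenEnv-wkλEnv h))
    (cong (λ z → develop (ren (ext ρ) θ c) z (wkλEnv η')) (sym (map-wkλF-renF ρ θ k)))

develop-wkλ : ∀ {n m} (t : Term n m) (η : Env n m) → wkλ (develop t [] η) ≡ develop (wkλ t) [] (wkλEnv η)
develop-wkλ t η = ren-develop suc (λ a → a) t [] (mkRenEnv λ _ → refl)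

plug-▷*-plugFire : ∀ {n m} (b : Bool) (W : Term n m) (k : List (Frame n m)) → ValueIf b W → WfStack k → plug W k ▷* plugFire b W k
plug-▷*-plugFire b W [] bv wk = ε
plug-▷*-plugFire b W (f ∷ k) bv (w ∷ wk) = plug-▷* k (plug₁-▷*-fire b W f bv w)

exts-▷* : ∀ {n n' m} {σ σ' : Fin n → Term n' m} → (∀ x → σ x ▷* σ' x) → ∀ x → exts σ x ▷* exts σ' x
exts-▷* h zero = ε
exts-▷* h (suc x) = ren-▷* suc (λ a → a) (h x)

mutual
  sub-▷*-pointwise : ∀ {n n' m} {σ σ' : Fin n → Term n' m} → (∀ x → σ x ▷* σ' x) → (t : Term n m) → sub σ t ▷* sub σ' t
  sub-▷*-pointwise h (var x) = h x
  sub-▷*-pointwise h (lam t) = ▷*-lam (sub-▷*-pointwise (exts-▷* h) t)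
  sub-▷*-pointwise h (app t e) = ▷*-app (sub-▷*-pointwise h t) (subE-▷*-pointwise h e)
  sub-▷*-pointwise h (pair t u) = ▷*-pair (sub-▷*-pointwise h t) (sub-▷*-pointwise h u)
  sub-▷*-pointwise h (ω₁ t) = ▷*-ω₁ (sub-▷*-pointwise h t)
  sub-▷*-pointwise h (ω₂ t) = ▷*-ω₂ (sub-▷*-pointwise h t)
  sub-▷*-pointwise h (mu t) = ▷*-mu (sub-▷*-pointwise (λ x → ren-▷* (λ x → x) suc (h x)) t)
  sub-▷*-pointwise h (nam a t) = ▷*-nam (sub-▷*-pointwise h t)

  subE-▷*-pointwise : ∀ {n n' m} {σ σ' : Fin n → Term n' m} → (∀ x → σ x ▷* σ' x) → (t : ETerm n m) → subE σ t ▷*E subE σ' t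
  subE-▷*-pointwise h (tm t) = ▷*-tm (sub-▷*-pointwise h t)
  subE-▷*-pointwise h π₁ = ε
  subE-▷*-pointwise h π₂ = ε
  subE-▷*-pointwise h (case c d) = ▷*-case (sub-▷*-pointwise (exts-▷* h) c) (sub-▷*-pointwise (exts-▷* h) d)

[0≔]-▷* : ∀ {n m} {s s' : Term (suc n) m} {U U' : Term n m} → Value U → s ▷* s' → U ▷* U' → (s [0≔ U ]) ▷* (s' [0≔ U' ])
[0≔]-▷* {s = s} {s'} {U} {U'} v p q =
  subst (λ z → z ▷* (s' [0≔ U' ])) (sym ([0≔]≡sub-σ₀ s U))
   (subst (λ z → sub (σ₀ U) s ▷* z) (sym ([0≔]≡sub-σ₀ s' U'))
     (sub-▷* (σ₀ U) (λ { zero → v ; (suc x) → v-var }) p ◅◅ sub-▷*-pointwise (λ { zero → q ; (suc x) → ε }) s'))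

-- Development is monotone in its stack

-- k ⊑ k': each frame of k reduces to the corresponding frame of k', except that a case frame of k'
-- may already have absorbed into its branches a prefix k1 of the rest of k, as develop does.
infix 4 _⊑_
data _⊑_ {n m : ℕ} : List (Frame n m) → List (Frame n m) → Set where
  ⊑[] : [] ⊑ []
  ⊑arg : ∀ {U U' b b' k k'} → U ▷* U' → (b ≡ true → b' ≡ true) → (b' ≡ true → Value U') → k ⊑ k' →
         fArg U b ∷ k ⊑ fArg U' b' ∷ k'
  ⊑π₁ : ∀ {k k'} → k ⊑ k' → fπ₁ ∷ k ⊑ fπ₁ ∷ k'
  ⊑π₂ : ∀ {k k'} → k ⊑ k' → fπ₂ ∷ k ⊑ fπ₂ ∷ k'
  ⊑L : ∀ {W W' k k'} → W ▷* W' → k ⊑ k' → fL W ∷ k ⊑ fL W' ∷ k'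
  ⊑case : ∀ {c d c' d' k k'} (k1 : List (Frame n m)) {k2} → k ≡ k1 ++ k2 →
          plug c (map wkλF k1) ▷* c' → plug d (map wkλF k1) ▷* d' → k2 ⊑ k' →
          fCase c d ∷ k ⊑ fCase c' d' ∷ k'

⊑-refl : ∀ {n m} {k : List (Frame n m)} → WfStack k → k ⊑ k
⊑-refl {k = []} [] = ⊑[]
⊑-refl {k = fArg U b ∷ k} (w ∷ ws) = ⊑arg ε (λ e → e) w (⊑-refl ws)
⊑-refl {k = fπ₁ ∷ k} (w ∷ ws) = ⊑π₁ (⊑-refl ws)
⊑-refl {k = fπ₂ ∷ k} (w ∷ ws) = ⊑π₂ (⊑-refl ws)
⊑-refl {k = fCase c d ∷ k} (w ∷ ws) = ⊑case [] refl ε ε (⊑-refl ws)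
⊑-refl {k = fL W ∷ k} (w ∷ ws) = ⊑L ε (⊑-refl ws)

plug-case-▷* : ∀ {n m} (X : Term n m) (c d : Term (suc n) m) (k : List (Frame n m)) → WfStack k →
     plug (app X (case c d)) k ▷* app X (case (plug c (map wkλF k)) (plug d (map wkλF k)))
plug-case-▷* X c d [] w = ε
plug-case-▷* X c d (fArg U b ∷ k) (_ ∷ w) = plug-▷* k (comR ◅ ε) ◅◅ plug-case-▷* X _ _ k w
plug-case-▷* X c d (fπ₁ ∷ k) (_ ∷ w) = plug-▷* k (comR ◅ ε) ◅◅ plug-case-▷* X _ _ k w
plug-case-▷* X c d (fπ₂ ∷ k) (_ ∷ w) = plug-▷* k (comR ◅ ε) ◅◅ plug-case-▷* X _ _ k w
plug-case-▷* X c d (fCase c' d' ∷ k) (_ ∷ w) = plug-▷* k (comR ◅ ε) ◅◅ plug-case-▷* X _ _ k w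
plug-case-▷* X c d (fL W ∷ k) (v ∷ w) = plug-▷* k (comL v ◅ ε) ◅◅ plug-case-▷* X _ _ k w

plug-⊑ : ∀ {n m} {X X' : Term n m} {k k' : List (Frame n m)} → X ▷* X' → k ⊑ k' → WfStack k → plug X k ▷* plug X' k'
plug-⊑ p ⊑[] w = p
plug-⊑ p (⊑arg q _ _ r) (_ ∷ w) = plug-⊑ (▷*-app-tm p q) r w
plug-⊑ p (⊑π₁ r) (_ ∷ w) = plug-⊑ (▷*-app p ε) r w
plug-⊑ p (⊑π₂ r) (_ ∷ w) = plug-⊑ (▷*-app p ε) r w
plug-⊑ p (⊑L q r) (_ ∷ w) = plug-⊑ (▷*-app-tm q p) r w
plug-⊑ {X = X} p (⊑case {c} {d} k1 {k2} refl pc pd r) (_ ∷ w) =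
  ≡⇒▷* (plug-++ (app X (case c d)) k1 k2) ◅◅
  plug-⊑ (plug-case-▷* X c d k1 (++⁻ˡ k1 w) ◅◅ ▷*-app-case p pc pd) r (++⁻ʳ k1 w)

▷*-fire : ∀ {n m} (b' : Bool) (W' : Term n m) (f' : Frame n m) {Y : Term n m} →
         Y ▷* plug₁ W' f' → ValueIf b' W' → WfFrame f' → Y ▷* fire b' W' f'
▷*-fire b' W' f' p bv w = p ◅◅ plug₁-▷*-fire b' W' f' bv w

fireArg-mono : ∀ {n m} (b b' : Bool) (W W' : Term n m) (U U' : Term n m) (bu bu' : Bool) →
   W ▷* W' → U ▷* U' → (bu ≡ true → bu' ≡ true) → (bu ≡ true → Value U) → (bu' ≡ true → Value U') → ValueIf b' W' →
   fire b W (fArg U bu) ▷* fire b' W' (fArg U' bu')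
fireArg-mono b b' W W' U U' false bu' p q fb vu vu' bv = ▷*-fire b' W' (fArg U' bu') (▷*-app-tm p q) bv vu'
fireArg-mono b b' (lam s) W' U U' true bu' p q fb vu vu' bv with fb refl | lam-▷*-inv p
... | refl | s' , refl , ps = [0≔]-▷* (vu refl) ps q
fireArg-mono b b' (var x) W' U U' true bu' p q fb vu vu' bv with fb refl
... | refl = ▷*-fire b' W' (fArg U' true) (▷*-app-tm p q) bv vu'
fireArg-mono b b' (app t e) W' U U' true bu' p q fb vu vu' bv with fb refl
... | refl = ▷*-fire b' W' (fArg U' true) (▷*-app-tm p q) bv vu'
fireArg-mono b b' (pair t u) W' U U' true bu' p q fb vu vu' bv with fb refl
... | refl = ▷*-fire b' W' (fArg U' true) (▷*-app-tm p q) bv vu'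
fireArg-mono b b' (ω₁ t) W' U U' true bu' p q fb vu vu' bv with fb refl
... | refl = ▷*-fire b' W' (fArg U' true) (▷*-app-tm p q) bv vu'
fireArg-mono b b' (ω₂ t) W' U U' true bu' p q fb vu vu' bv with fb refl
... | refl = ▷*-fire b' W' (fArg U' true) (▷*-app-tm p q) bv vu'
fireArg-mono b b' (mu t) W' U U' true bu' p q fb vu vu' bv with fb refl
... | refl = ▷*-fire b' W' (fArg U' true) (▷*-app-tm p q) bv vu'
fireArg-mono b b' (nam a t) W' U U' true bu' p q fb vu vu' bv with fb refl
... | refl = ▷*-fire b' W' (fArg U' true) (▷*-app-tm p q) bv vu'

fireπ₁-mono : ∀ {n m} (b b' : Bool) (W W' : Term n m) → W ▷* W' → (b ≡ true → b' ≡ true) → ValueIf b' W' →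
   fire b W fπ₁ ▷* fire b' W' fπ₁
fireπ₁-mono b b' (var x) W' p fb bv = ▷*-fire b' W' (fπ₁) (▷*-app p ε) bv tt
fireπ₁-mono b b' (lam s) W' p fb bv = ▷*-fire b' W' (fπ₁) (▷*-app p ε) bv tt
fireπ₁-mono b b' (app t e) W' p fb bv = ▷*-fire b' W' (fπ₁) (▷*-app p ε) bv tt
fireπ₁-mono b b' (ω₁ t) W' p fb bv = ▷*-fire b' W' (fπ₁) (▷*-app p ε) bv tt
fireπ₁-mono b b' (ω₂ t) W' p fb bv = ▷*-fire b' W' (fπ₁) (▷*-app p ε) bv tt
fireπ₁-mono b b' (mu t) W' p fb bv = ▷*-fire b' W' (fπ₁) (▷*-app p ε) bv tt
fireπ₁-mono b b' (nam a t) W' p fb bv = ▷*-fire b' W' (fπ₁) (▷*-app p ε) bv tt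
fireπ₁-mono false b' (pair t u) W' p fb bv = ▷*-fire b' W' (fπ₁) (▷*-app p ε) bv tt
fireπ₁-mono true b' (pair t u) W' p fb bv with fb refl | pair-▷*-inv p
... | refl | t' , u' , refl , p1 , p2 = p1

fireπ₂-mono : ∀ {n m} (b b' : Bool) (W W' : Term n m) → W ▷* W' → (b ≡ true → b' ≡ true) → ValueIf b' W' →
   fire b W fπ₂ ▷* fire b' W' fπ₂
fireπ₂-mono b b' (var x) W' p fb bv = ▷*-fire b' W' (fπ₂) (▷*-app p ε) bv tt
fireπ₂-mono b b' (lam s) W' p fb bv = ▷*-fire b' W' (fπ₂) (▷*-app p ε) bv tt
fireπ₂-mono b b' (app t e) W' p fb bv = ▷*-fire b' W' (fπ₂) (▷*-app p ε) bv tt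
fireπ₂-mono b b' (ω₁ t) W' p fb bv = ▷*-fire b' W' (fπ₂) (▷*-app p ε) bv tt
fireπ₂-mono b b' (ω₂ t) W' p fb bv = ▷*-fire b' W' (fπ₂) (▷*-app p ε) bv tt
fireπ₂-mono b b' (mu t) W' p fb bv = ▷*-fire b' W' (fπ₂) (▷*-app p ε) bv tt
fireπ₂-mono b b' (nam a t) W' p fb bv = ▷*-fire b' W' (fπ₂) (▷*-app p ε) bv tt
fireπ₂-mono false b' (pair t u) W' p fb bv = ▷*-fire b' W' (fπ₂) (▷*-app p ε) bv tt
fireπ₂-mono true b' (pair t u) W' p fb bv with fb refl | pair-▷*-inv p
... | refl | t' , u' , refl , p1 , p2 = p2

fireL-mono : ∀ {n m} (b b' : Bool) (W W' V V' : Term n m) → W ▷* W' → V ▷* V' → (b ≡ true → b' ≡ true) →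
   ValueIf b W → ValueIf b' W' → Value V' → fire b W (fL V) ▷* fire b' W' (fL V')
fireL-mono b b' W W' (var x) V' p q fb bv bv' v = ▷*-fire b' W' (fL V') (▷*-app-tm q p) bv' v
fireL-mono b b' W W' (app t e) V' p q fb bv bv' v = ▷*-fire b' W' (fL V') (▷*-app-tm q p) bv' v
fireL-mono b b' W W' (pair t u) V' p q fb bv bv' v = ▷*-fire b' W' (fL V') (▷*-app-tm q p) bv' v
fireL-mono b b' W W' (ω₁ t) V' p q fb bv bv' v = ▷*-fire b' W' (fL V') (▷*-app-tm q p) bv' v
fireL-mono b b' W W' (ω₂ t) V' p q fb bv bv' v = ▷*-fire b' W' (fL V') (▷*-app-tm q p) bv' v
fireL-mono b b' W W' (mu t) V' p q fb bv bv' v = ▷*-fire b' W' (fL V') (▷*-app-tm q p) bv' v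
fireL-mono b b' W W' (nam a t) V' p q fb bv bv' v = ▷*-fire b' W' (fL V') (▷*-app-tm q p) bv' v
fireL-mono false b' W W' (lam s) V' p q fb bv bv' v = ▷*-fire b' W' (fL V') (▷*-app-tm q p) bv' v
fireL-mono true b' W W' (lam s) V' p q fb bv bv' v with fb refl | lam-▷*-inv q
... | refl | s' , refl , ps = [0≔]-▷* (bv refl) ps p

plug-[0≔] : ∀ {n m} (c : Term (suc n) m) (Z : Term n m) (k : List (Frame n m)) →
            plug (c [0≔ Z ]) k ≡ (plug c (map wkλF k)) [0≔ Z ]
plug-[0≔] c Z k = trans (cong (λ z → plug z k) ([0≔]≡sub-σ₀ c Z))
  (trans (cong (plug (sub (σ₀ Z) c)) (sym (map-subF-wkλF Z k)))
  (trans (sym (plug-sub (σ₀ Z) c (map wkλF k))) (sym ([0≔]≡sub-σ₀ (plug c (map wkλF k)) Z))))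

plug-case-▷*-fire : ∀ {n m} (b' : Bool) (W W' : Term n m) {c d c' d' : Term (suc n) m} (k1 : List (Frame n m)) {k2 k'} →
   W ▷* W' → plug c (map wkλF k1) ▷* c' → plug d (map wkλF k1) ▷* d' → k2 ⊑ k' → WfStack (k1 ++ k2) → ValueIf b' W' →
   plug (app W (case c d)) (k1 ++ k2) ▷* plug (fire b' W' (fCase c' d')) k'
plug-case-▷*-fire b' W W' {c} {d} {c'} {d'} k1 {k2} {k'} p pc pd r w bv =
  ≡⇒▷* (plug-++ (app W (case c d)) k1 k2) ◅◅
  plug-⊑ (plug-case-▷* W c d k1 (++⁻ˡ k1 w) ◅◅ ▷*-app-case p pc pd ◅◅ plug₁-▷*-fire b' W' (fCase c' d') bv tt) r (++⁻ʳ k1 w)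

fireCase-mono : ∀ {n m} (b b' : Bool) (W W' : Term n m) {c d c' d' : Term (suc n) m} (k1 : List (Frame n m)) {k2 k'} →
   W ▷* W' → (b ≡ true → b' ≡ true) → ValueIf b W → ValueIf b' W' →
   plug c (map wkλF k1) ▷* c' → plug d (map wkλF k1) ▷* d' → k2 ⊑ k' → WfStack (k1 ++ k2) →
   plug (fire b W (fCase c d)) (k1 ++ k2) ▷* plug (fire b' W' (fCase c' d')) k'
fireCase-mono b b' (var x) W' k1 p fb bv bv' pc pd r w = plug-case-▷*-fire b' (var x) W' k1 p pc pd r w bv'
fireCase-mono b b' (lam s) W' k1 p fb bv bv' pc pd r w = plug-case-▷*-fire b' (lam s) W' k1 p pc pd r w bv'
fireCase-mono b b' (app t e) W' k1 p fb bv bv' pc pd r w = plug-case-▷*-fire b' (app t e) W' k1 p pc pd r w bv'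
fireCase-mono b b' (pair t u) W' k1 p fb bv bv' pc pd r w = plug-case-▷*-fire b' (pair t u) W' k1 p pc pd r w bv'
fireCase-mono b b' (mu t) W' k1 p fb bv bv' pc pd r w = plug-case-▷*-fire b' (mu t) W' k1 p pc pd r w bv'
fireCase-mono b b' (nam a t) W' k1 p fb bv bv' pc pd r w = plug-case-▷*-fire b' (nam a t) W' k1 p pc pd r w bv'
fireCase-mono false b' (ω₁ t) W' k1 p fb bv bv' pc pd r w = plug-case-▷*-fire b' (ω₁ t) W' k1 p pc pd r w bv'
fireCase-mono false b' (ω₂ t) W' k1 p fb bv bv' pc pd r w = plug-case-▷*-fire b' (ω₂ t) W' k1 p pc pd r w bv'
fireCase-mono true b' (ω₁ Z) W' {c} k1 {k2} p fb bv bv' pc pd r w with fb refl | ω₁-▷*-inv p | bv refl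
... | refl | Z' , refl , pz | v-ω₁ vz =
  ≡⇒▷* (trans (plug-++ (c [0≔ Z ]) k1 k2) (cong (λ z → plug z k2) (plug-[0≔] c Z k1))) ◅◅
  plug-⊑ ([0≔]-▷* vz pc pz) r (++⁻ʳ k1 w)
fireCase-mono true b' (ω₂ Z) W' {c} {d} k1 {k2} p fb bv bv' pc pd r w with fb refl | ω₂-▷*-inv p | bv refl
... | refl | Z' , refl , pz | v-ω₂ vz =
  ≡⇒▷* (trans (plug-++ (d [0≔ Z ]) k1 k2) (cong (λ z → plug z k2) (plug-[0≔] d Z k1))) ◅◅
  plug-⊑ ([0≔]-▷* vz pd pz) r (++⁻ʳ k1 w)

plugFire-mono : ∀ {n m} (b b' : Bool) (W W' : Term n m) {k k' : List (Frame n m)} →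
   W ▷* W' → (b ≡ true → b' ≡ true) → ValueIf b W → ValueIf b' W' → k ⊑ k' → WfStack k → WfStack k' →
   plugFire b W k ▷* plugFire b' W' k'
plugFire-mono b b' W W' p fb bv bv' ⊑[] w w' = p
plugFire-mono b b' W W' p fb bv bv' (⊑arg {U} {U'} {bu} {bu'} q fu vu' r) (wu ∷ w) (_ ∷ w') =
  plug-⊑ (fireArg-mono b b' W W' U U' bu bu' p q fu wu vu' bv') r w
plugFire-mono b b' W W' p fb bv bv' (⊑π₁ r) (_ ∷ w) (_ ∷ w') = plug-⊑ (fireπ₁-mono b b' W W' p fb bv') r w
plugFire-mono b b' W W' p fb bv bv' (⊑π₂ r) (_ ∷ w) (_ ∷ w') = plug-⊑ (fireπ₂-mono b b' W W' p fb bv') r w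
plugFire-mono b b' W W' p fb bv bv' (⊑L {V} {V'} q r) (_ ∷ w) (v' ∷ w') = plug-⊑ (fireL-mono b b' W W' V V' p q fb bv bv' v') r w
plugFire-mono b b' W W' p fb bv bv' (⊑case k1 refl pc pd r) (_ ∷ w) (_ ∷ w') = fireCase-mono b b' W W' k1 p fb bv bv' pc pd r w

plugFire-cong : ∀ {n m} (b b' : Bool) {W W' : Term n m} {k : List (Frame n m)} →
                W ▷* W' → (b ≡ true → b' ≡ true) → ValueIf b W → ValueIf b' W' → WfStack k →
                plugFire b W k ▷* plugFire b' W' k
plugFire-cong b b' {W} {W'} p fb bv bv' wk = plugFire-mono b b' W W' p fb bv bv' (⊑-refl wk) wk wk

plugFire-cong-value : ∀ {n m} {W W' : Term n m} {k : List (Frame n m)} → Value W → Value W' → W ▷* W' → WfStack k →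
                      plugFire true W k ▷* plugFire true W' k
plugFire-cong-value v v' p wk = plugFire-cong true true p (λ e → e) (λ _ → v) (λ _ → v') wk

⊑-ren : ∀ {n n' m m'} (ρ : Fin n → Fin n') (θ : Fin m → Fin m') {k k' : List (Frame n m)} →
        k ⊑ k' → map (renF ρ θ) k ⊑ map (renF ρ θ) k'
⊑-ren ρ θ ⊑[] = ⊑[]
⊑-ren ρ θ (⊑arg q f v r) = ⊑arg (ren-▷* ρ θ q) f (λ e → Value-ren ρ θ (v e)) (⊑-ren ρ θ r)
⊑-ren ρ θ (⊑π₁ r) = ⊑π₁ (⊑-ren ρ θ r)
⊑-ren ρ θ (⊑π₂ r) = ⊑π₂ (⊑-ren ρ θ r)
⊑-ren ρ θ (⊑L q r) = ⊑L (ren-▷* ρ θ q) (⊑-ren ρ θ r)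
⊑-ren ρ θ (⊑case {c} {d} k1 {k2} refl pc pd r) =
  ⊑case (map (renF ρ θ) k1) (map-++ (renF ρ θ) k1 k2) (h c pc) (h d pd) (⊑-ren ρ θ r)
  where h : ∀ c {c'} → plug c (map wkλF k1) ▷* c' → plug (ren (ext ρ) θ c) (map wkλF (map (renF ρ θ) k1)) ▷* ren (ext ρ) θ c'
        h c p = ≡⇒▷* (sym (trans (plug-ren (ext ρ) θ c (map wkλF k1))
                  (cong (plug (ren (ext ρ) θ c)) (trans (map-∘-≗ (renF-comp (λ _ → refl) (λ _ → refl)) k1)
                    (sym (map-∘-≗ (renF-comp (λ _ → refl) (λ _ → refl)) k1)))))) ◅◅ ren-▷* (ext ρ) θ p

_⊑ₑ_ : ∀ {n m} → Env n m → Env n m → Set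
_⊑ₑ_ η η' = ∀ a → η a ⊑ η' a

⊑ₑ-wkλEnv : ∀ {n m} {η η' : Env n m} → _⊑ₑ_ η η' → _⊑ₑ_ (wkλEnv η) (wkλEnv η')
⊑ₑ-wkλEnv h a = ⊑-ren suc (λ a → a) (h a)

⊑ₑ-bindμ : ∀ {n m} {k k' : List (Frame n m)} {η η' : Env n m} → k ⊑ k' → _⊑ₑ_ η η' → _⊑ₑ_ (bindμ k η) (bindμ k' η')
⊑ₑ-bindμ r h zero = ⊑-ren (λ x → x) suc r
⊑ₑ-bindμ r h (suc a) = ⊑-ren (λ x → x) suc (h a)

⊑ₑ-refl : ∀ {n m} {η : Env n m} → WfEnv η → _⊑ₑ_ η η
⊑ₑ-refl w a = ⊑-refl (w a)

develop-⊑ : ∀ {n m} (t : Term n m) {k k' : List (Frame n m)} {η η' : Env n m} →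
    k ⊑ k' → _⊑ₑ_ η η' → WfStack k → WfStack k' → WfEnv η → WfEnv η' → develop t k η ▷* develop t k' η'
develop-⊑ (var x) r h wk wk' wη wη' = plugFire-mono true true (var x) (var x) ε (λ e → e) (λ _ → v-var) (λ _ → v-var) r wk wk'
develop-⊑ (lam t) r h wk wk' wη wη' =
  plugFire-mono true true _ _ (▷*-lam (develop-⊑ t ⊑[] (⊑ₑ-wkλEnv h) [] [] (WfEnv-wkλEnv wη) (WfEnv-wkλEnv wη')))
    (λ e → e) (λ _ → v-lam) (λ _ → v-lam) r wk wk'
develop-⊑ (pair t u) {η = η} {η'} r h wk wk' wη wη' = plugFire-mono _ _ _ _
  (▷*-pair (develop-⊑ t ⊑[] h [] [] wη wη') (develop-⊑ u ⊑[] h [] [] wη wη')) (λ e → e)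
  (λ e → Value-develop (pair t u) η e) (λ e → Value-develop (pair t u) η' e) r wk wk'
develop-⊑ (ω₁ t) {η = η} {η'} r h wk wk' wη wη' = plugFire-mono _ _ _ _ (▷*-ω₁ (develop-⊑ t ⊑[] h [] [] wη wη')) (λ e → e)
  (λ e → Value-develop (ω₁ t) η e) (λ e → Value-develop (ω₁ t) η' e) r wk wk'
develop-⊑ (ω₂ t) {η = η} {η'} r h wk wk' wη wη' = plugFire-mono _ _ _ _ (▷*-ω₂ (develop-⊑ t ⊑[] h [] [] wη wη')) (λ e → e)
  (λ e → Value-develop (ω₂ t) η e) (λ e → Value-develop (ω₂ t) η' e) r wk wk'
develop-⊑ (nam a t) r h wk wk' wη wη' = plugFire-mono true true _ _ (▷*-nam (develop-⊑ t (h a) h (wη a) (wη' a) wη wη'))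
  (λ e → e) (λ _ → v-nam) (λ _ → v-nam) r wk wk'
develop-⊑ (mu t) r h wk wk' wη wη' = ▷*-mu (develop-⊑ t ⊑[] (⊑ₑ-bindμ r h) [] [] (WfEnv-bindμ wk wη) (WfEnv-bindμ wk' wη'))
develop-⊑ (app t (tm u)) {k} {k'} {η} {η'} r h wk wk' wη wη' = go (isValue t) refl
  where go : ∀ b → isValue t ≡ b → developArg b t u k η ▷* developArg b t u k' η'
        go true e = develop-⊑ u (⊑L (develop-⊑ t ⊑[] h [] [] wη wη') r) h (Value-develop t η e ∷ wk) (Value-develop t η' e ∷ wk') wη wη'
        go false e = develop-⊑ t (⊑arg (develop-⊑ u ⊑[] h [] [] wη wη') (λ x → x) (Value-develop u η') r) h
                       (WfFrame-devArg u η ∷ wk) (WfFrame-devArg u η' ∷ wk') wη wη'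
develop-⊑ (app t π₁) r h wk wk' wη wη' = develop-⊑ t (⊑π₁ r) h (tt ∷ wk) (tt ∷ wk') wη wη'
develop-⊑ (app t π₂) r h wk wk' wη wη' = develop-⊑ t (⊑π₂ r) h (tt ∷ wk) (tt ∷ wk') wη wη'
develop-⊑ (app t (case c d)) {k} {k'} {η} {η'} r h wk wk' wη wη' =
  develop-⊑ t (⊑case [] refl (branch c) (branch d) ⊑[]) h (tt ∷ []) (tt ∷ []) wη wη'
  where
  branch : ∀ c → develop c (map wkλF k) (wkλEnv η) ▷* develop c (map wkλF k') (wkλEnv η')
  branch c = develop-⊑ c (⊑-ren suc (λ a → a) r) (⊑ₑ-wkλEnv h) (WfStack-renF suc (λ a → a) wk) (WfStack-renF suc (λ a → a) wk')
               (WfEnv-wkλEnv wη) (WfEnv-wkλEnv wη')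

plug-mu-▷* : ∀ {n m} (Y : Term n (suc m)) (k : List (Frame n m)) → WfStack k → plug (mu Y) k ▷* mu (push (env₀ (map wkμF k)) Y)
plug-mu-▷* Y [] w = ≡⇒▷* (cong mu (sym (push-[] (λ { zero → refl ; (suc a) → refl }) Y)))
plug-mu-▷* Y (f ∷ k) (wf ∷ w) = plug-▷* k (μ-step f wf ◅ ε) ◅◅ plug-mu-▷* _ k w ◅◅
   ≡⇒▷* (cong mu (push-push (λ { zero → cong (_∷ map wkμF k) (sym (pushF-wkμF (λ _ → refl) f)) ; (suc a) → refl }) Y))
  where
  μ-step : ∀ f → WfFrame f → plug₁ (mu Y) f ▷ mu (push (env₀ (wkμF f ∷ [])) Y)
  μ-step (fArg U b) wf = ▷-≡ μR (cong mu (trans (substR≡push zero (wkμE (tm U)) Y)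
        (push-eraseFlags (λ { zero → refl ; (suc a) → refl }) Y)))
  μ-step fπ₁ wf = ▷-≡ μR (cong mu (trans (substR≡push zero π₁ Y) (push-cong (λ { zero → refl ; (suc a) → refl }) Y)))
  μ-step fπ₂ wf = ▷-≡ μR (cong mu (trans (substR≡push zero π₂ Y) (push-cong (λ { zero → refl ; (suc a) → refl }) Y)))
  μ-step (fCase c d) wf = ▷-≡ μR (cong mu (trans (substR≡push zero _ Y) (push-cong (λ { zero → refl ; (suc a) → refl }) Y)))
  μ-step (fL W) wf = ▷-≡ (μL wf) (cong mu (trans (substL≡push zero (wkμ W) Y) (push-cong (λ { zero → refl ; (suc a) → refl }) Y)))

plug-plugFire : ∀ {n m} (b : Bool) (W : Term n m) (k k2 : List (Frame n m)) → ValueIf b W → WfStack k2 →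
          plug (plugFire b W k) k2 ▷* plugFire b W (k ++ k2)
plug-plugFire b W [] k2 bv w = plug-▷*-plugFire b W k2 bv w
plug-plugFire b W (f ∷ k) k2 bv w = ≡⇒▷* (sym (plug-++ (fire b W f) k k2))

WfEnv-IsComposite : ∀ {n m} {η θ η'' : Env n m} → IsComposite η θ η'' → WfEnv η → WfEnv θ → WfEnv η''
WfEnv-IsComposite {θ = θ} h wη wθ a = subst WfStack (sym (h a)) (++⁺ (WfStack-pushF θ (wη a)) (wθ a))

-- Plugging further frames into a development and pushing stacks into it depend on each other: a μ-binder
-- turns plugged frames into pushed ones, and a named subterm turns pushed frames into plugged ones.
mutual
  plug-develop : ∀ {n m} (t : Term n m) (k k2 : List (Frame n m)) (η : Env n m) → WfStack k → WfStack k2 → WfEnv η →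
      plug (develop t k η) k2 ▷* develop t (k ++ k2) η
  plug-develop (var x) k k2 η wk wk2 wη = plug-plugFire true (var x) k k2 (λ _ → v-var) wk2
  plug-develop (lam t) k k2 η wk wk2 wη = plug-plugFire true _ k k2 (λ _ → v-lam) wk2
  plug-develop (pair t u) k k2 η wk wk2 wη = plug-plugFire _ _ k k2 (λ e → Value-develop (pair t u) η e) wk2
  plug-develop (ω₁ t) k k2 η wk wk2 wη = plug-plugFire _ _ k k2 (λ e → Value-develop (ω₁ t) η e) wk2
  plug-develop (ω₂ t) k k2 η wk wk2 wη = plug-plugFire _ _ k k2 (λ e → Value-develop (ω₂ t) η e) wk2
  plug-develop (nam a t) k k2 η wk wk2 wη = plug-plugFire true _ k k2 (λ _ → v-nam) wk2
  plug-develop (mu w) k k2 η wk wk2 wη = plug-mu-▷* (develop w [] (bindμ k η)) k2 wk2 ◅◅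
      ▷*-mu (push-develop w [] (bindμ k η) (env₀ (map wkμF k2)) (bindμ (k ++ k2) η) composite [] (WfEnv-bindμ wk wη) wf-env₀)
    where composite : IsComposite (bindμ k η) (env₀ (map wkμF k2)) (bindμ (k ++ k2) η)
          composite zero = trans (map-++ wkμF k k2) (cong (_++ map wkμF k2) (sym (map-pushF-wkμF (λ _ → refl) k)))
          composite (suc a) = sym (trans (++-identityʳ _) (map-pushF-wkμF (λ _ → refl) (η a)))
          wf-env₀ : WfEnv (env₀ (map wkμF k2))
          wf-env₀ zero = WfStack-renF (λ x → x) suc wk2
          wf-env₀ (suc a) = []
  plug-develop (app t (tm u)) k k2 η wk wk2 wη = go (isValue t) refl
    where go : ∀ b → isValue t ≡ b → plug (developArg b t u k η) k2 ▷* developArg b t u (k ++ k2) η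
          go true e = plug-develop u (fL (develop t [] η) ∷ k) k2 η (Value-develop t η e ∷ wk) wk2 wη
          go false e = plug-develop t (fArg (develop u [] η) (isValue u) ∷ k) k2 η (WfFrame-devArg u η ∷ wk) wk2 wη
  plug-develop (app t π₁) k k2 η wk wk2 wη = plug-develop t (fπ₁ ∷ k) k2 η (tt ∷ wk) wk2 wη
  plug-develop (app t π₂) k k2 η wk wk2 wη = plug-develop t (fπ₂ ∷ k) k2 η (tt ∷ wk) wk2 wη
  plug-develop (app t (case c d)) k k2 η wk wk2 wη =
      plug-develop t _ k2 η (tt ∷ []) wk2 wη ◅◅
      develop-⊑ t (⊑case k2 (sym (++-identityʳ k2)) (branch c) (branch d) ⊑[]) (⊑ₑ-refl wη) (tt ∷ wk2) (tt ∷ []) wη wη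
    where branch : ∀ c → plug (develop c (map wkλF k) (wkλEnv η)) (map wkλF k2) ▷* develop c (map wkλF (k ++ k2)) (wkλEnv η)
          branch c = plug-develop c (map wkλF k) (map wkλF k2) (wkλEnv η) (WfStack-renF suc (λ a → a) wk)
                       (WfStack-renF suc (λ a → a) wk2) (WfEnv-wkλEnv wη) ◅◅
                     ≡⇒▷* (cong (λ z → develop c z (wkλEnv η)) (sym (map-++ wkλF k k2)))

  push-develop : ∀ {n m} (t : Term n m) (k : List (Frame n m)) (η θ η'' : Env n m) → IsComposite η θ η'' →
                 WfStack k → WfEnv η → WfEnv θ → push θ (develop t k η) ▷* develop t (map (pushF θ) k) η''
  push-develop (var x) k η θ η'' h wk wη wθ = ≡⇒▷* (push-plugFire θ true (var x) k)
  push-develop (lam t) k η θ η'' h wk wη wθ = ≡⇒▷* (push-plugFire θ true _ k) ◅◅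
    plugFire-cong-value v-lam v-lam
      (▷*-lam (push-develop t [] (wkλEnv η) (wkλEnv θ) (wkλEnv η'') (IsComposite-wkλEnv {η = η} {θ} h) []
                 (WfEnv-wkλEnv wη) (WfEnv-wkλEnv wθ)))
      (WfStack-pushF θ wk)
  push-develop (pair t u) k η θ η'' h wk wη wθ = ≡⇒▷* (push-plugFire θ _ _ k) ◅◅
    plugFire-cong _ _ (▷*-pair (push-develop t [] η θ η'' h [] wη wθ) (push-develop u [] η θ η'' h [] wη wθ))
      (λ e → e) (λ e → Value-push θ (Value-develop (pair t u) η e)) (Value-develop (pair t u) η'') (WfStack-pushF θ wk)
  push-develop (ω₁ t) k η θ η'' h wk wη wθ = ≡⇒▷* (push-plugFire θ _ _ k) ◅◅
    plugFire-cong _ _ (▷*-ω₁ (push-develop t [] η θ η'' h [] wη wθ))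
      (λ e → e) (λ e → Value-push θ (Value-develop (ω₁ t) η e)) (Value-develop (ω₁ t) η'') (WfStack-pushF θ wk)
  push-develop (ω₂ t) k η θ η'' h wk wη wθ = ≡⇒▷* (push-plugFire θ _ _ k) ◅◅
    plugFire-cong _ _ (▷*-ω₂ (push-develop t [] η θ η'' h [] wη wθ))
      (λ e → e) (λ e → Value-push θ (Value-develop (ω₂ t) η e)) (Value-develop (ω₂ t) η'') (WfStack-pushF θ wk)
  push-develop (nam a t) k η θ η'' h wk wη wθ = ≡⇒▷* (push-plugFire θ true _ k) ◅◅
    plugFire-cong-value v-nam v-nam
      (▷*-nam (plug-▷* (θ a) (push-develop t (η a) η θ η'' h (wη a) wη wθ) ◅◅
               plug-develop t (map (pushF θ) (η a)) (θ a) η'' (WfStack-pushF θ (wη a)) (wθ a) (WfEnv-IsComposite h wη wθ) ◅◅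
               ≡⇒▷* (cong (λ z → develop t z η'') (sym (h a)))))
      (WfStack-pushF θ wk)
  push-develop (mu w) k η θ η'' h wk wη wθ =
    ▷*-mu (push-develop w [] (bindμ k η) (liftμEnv θ) (bindμ (map (pushF θ) k) η'') (IsComposite-bindμ k h) []
             (WfEnv-bindμ wk wη) (WfEnv-bindμ [] wθ))
  push-develop (app t (tm u)) k η θ η'' h wk wη wθ = go (isValue t) refl
    where
    wk' : WfStack (map (pushF θ) k)
    wk' = WfStack-pushF θ wk
    wη'' : WfEnv η''
    wη'' = WfEnv-IsComposite h wη wθ
    go : ∀ b → isValue t ≡ b → push θ (developArg b t u k η) ▷* developArg b t u (map (pushF θ) k) η''
    go true e = push-develop u (fL (develop t [] η) ∷ k) η θ η'' h (Value-develop t η e ∷ wk) wη wθ ◅◅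
      develop-⊑ u (⊑L (push-develop t [] η θ η'' h [] wη wθ) (⊑-refl wk')) (⊑ₑ-refl wη'')
        (Value-push θ (Value-develop t η e) ∷ wk') (Value-develop t η'' e ∷ wk') wη'' wη''
    go false e = push-develop t (fArg (develop u [] η) (isValue u) ∷ k) η θ η'' h (WfFrame-devArg u η ∷ wk) wη wθ ◅◅
      develop-⊑ t (⊑arg (push-develop u [] η θ η'' h [] wη wθ) (λ x → x) (Value-develop u η'') (⊑-refl wk'))
        (⊑ₑ-refl wη'') (WfFrame-pushF θ _ (WfFrame-devArg u η) ∷ wk') (WfFrame-devArg u η'' ∷ wk') wη'' wη''
  push-develop (app t π₁) k η θ η'' h wk wη wθ = push-develop t (fπ₁ ∷ k) η θ η'' h (tt ∷ wk) wη wθ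
  push-develop (app t π₂) k η θ η'' h wk wη wθ = push-develop t (fπ₂ ∷ k) η θ η'' h (tt ∷ wk) wη wθ
  push-develop (app t (case c d)) k η θ η'' h wk wη wθ =
    push-develop t _ η θ η'' h (tt ∷ []) wη wθ ◅◅
    develop-⊑ t (⊑case [] refl (branch c) (branch d) ⊑[]) (⊑ₑ-refl wη'') (tt ∷ []) (tt ∷ []) wη'' wη''
    where
    wη'' : WfEnv η''
    wη'' = WfEnv-IsComposite h wη wθ
    branch : ∀ c → push (wkλEnv θ) (develop c (map wkλF k) (wkλEnv η)) ▷* develop c (map wkλF (map (pushF θ) k)) (wkλEnv η'')
    branch c = push-develop c (map wkλF k) (wkλEnv η) (wkλEnv θ) (wkλEnv η'') (IsComposite-wkλEnv {η = η} {θ} h)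
                 (WfStack-renF suc (λ a → a) wk) (WfEnv-wkλEnv wη) (WfEnv-wkλEnv wθ) ◅◅
               ≡⇒▷* (cong (λ z → develop c z (wkλEnv η'')) (map-pushF-wkλF θ k))

sub-plugFire : ∀ {n n' m} (σ : Fin n → Term n' m) → ValueSub σ → (b : Bool) (W : Term n m) (k : List (Frame n m)) →
            ValueIf b W → WfStack k → sub σ (plugFire b W k) ▷* plugFire b (sub σ W) (map (subF σ) k)
sub-plugFire σ h b W [] bv wk = ε
sub-plugFire σ h b W (f ∷ k) bv (w ∷ wk) = ≡⇒▷* (plug-sub σ (fire b W f) k) ◅◅ plug-▷* (map (subF σ) k) (sub-fire σ h b W f bv w)

record DevSub {n n' m} (σ σ' : Fin n → Term n' m) (η : Env n m) (η' : Env n' m) : Set where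
  field
    value-σ  : ValueSub σ
    value-σ' : ValueSub σ'
    σ'-▷*    : ∀ x → σ' x ▷* develop (σ x) [] η'
    subEnv   : SubEnv σ' η η'
open DevSub

DevSub-exts : ∀ {n n' m} {σ σ' : Fin n → Term n' m} {η : Env n m} {η' : Env n' m} →
              DevSub σ σ' η η' → DevSub (exts σ) (exts σ') (wkλEnv η) (wkλEnv η')
DevSub-exts {σ = σ} {η' = η'} h = record
  { value-σ = ValueSub-exts (value-σ h)
  ; value-σ' = ValueSub-exts (value-σ' h)
  ; σ'-▷* = λ { zero → ε ; (suc x) → ren-▷* suc (λ a → a) (σ'-▷* h x) ◅◅ ≡⇒▷* (develop-wkλ (σ x) η') }
  ; subEnv = SubEnv-wkλEnv (subEnv h) }

DevSub-bindμ : ∀ {n n' m} {σ σ' : Fin n → Term n' m} {η : Env n m} {η' : Env n' m} (k : List (Frame n m)) →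
               DevSub σ σ' η η' → DevSub (λ i → wkμ (σ i)) (λ i → wkμ (σ' i)) (bindμ k η) (bindμ (map (subF σ') k) η')
DevSub-bindμ {σ = σ} k h = record
  { value-σ = ValueSub-wkμ (value-σ h)
  ; value-σ' = ValueSub-wkμ (value-σ' h)
  ; σ'-▷* = λ x → ren-▷* (λ x → x) suc (σ'-▷* h x) ◅◅ ≡⇒▷* (ren-develop (λ x → x) suc (σ x) [] (mkRenEnv λ _ → refl))
  ; subEnv = SubEnv-bindμ k (subEnv h) }

WfEnv-DevSub : ∀ {n n' m} {σ σ' : Fin n → Term n' m} {η : Env n m} {η' : Env n' m} → DevSub σ σ' η η' → WfEnv η → WfEnv η'
WfEnv-DevSub {σ' = σ'} h wη a = subst WfStack (sym (subEnv h a)) (WfStack-subF σ' (value-σ' h) (wη a))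

sub-develop : ∀ {n n' m} (t : Term n m) (k : List (Frame n m)) (η : Env n m) {σ σ' : Fin n → Term n' m} {η' : Env n' m} →
              DevSub σ σ' η η' → WfStack k → WfEnv η → sub σ' (develop t k η) ▷* develop (sub σ t) (map (subF σ') k) η'
sub-develop (var x) k η {σ} {σ'} {η'} h wk wη =
  sub-plugFire σ' (value-σ' h) true (var x) k (λ _ → v-var) wk ◅◅
  plugFire-cong-value (value-σ' h x) (Value-develop (σ x) η' (Value⇒isValue (value-σ h x))) (σ'-▷* h x)
    (WfStack-subF σ' (value-σ' h) wk) ◅◅
  ≡⇒▷* (sym (develop-value (σ x) _ η' (Value⇒isValue (value-σ h x))))
sub-develop (lam t) k η {σ' = σ'} h wk wη =
  sub-plugFire σ' (value-σ' h) true _ k (λ _ → v-lam) wk ◅◅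
  plugFire-cong-value v-lam v-lam (▷*-lam (sub-develop t [] (wkλEnv η) (DevSub-exts h) [] (WfEnv-wkλEnv wη)))
    (WfStack-subF σ' (value-σ' h) wk)
sub-develop (pair t u) k η {σ} {σ'} {η'} h wk wη =
  sub-plugFire σ' (value-σ' h) _ _ k (Value-develop (pair t u) η) wk ◅◅
  plugFire-cong _ _ (▷*-pair (sub-develop t [] η h [] wη) (sub-develop u [] η h [] wη))
    (λ e → trans (isValue-sub (value-σ h) (pair t u)) e) (λ e → Value-sub σ' (value-σ' h) (Value-develop (pair t u) η e))
    (Value-develop (pair (sub σ t) (sub σ u)) η') (WfStack-subF σ' (value-σ' h) wk)
sub-develop (ω₁ t) k η {σ} {σ'} {η'} h wk wη =
  sub-plugFire σ' (value-σ' h) _ _ k (Value-develop (ω₁ t) η) wk ◅◅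
  plugFire-cong _ _ (▷*-ω₁ (sub-develop t [] η h [] wη))
    (λ e → trans (isValue-sub (value-σ h) t) e) (λ e → Value-sub σ' (value-σ' h) (Value-develop (ω₁ t) η e))
    (Value-develop (ω₁ (sub σ t)) η') (WfStack-subF σ' (value-σ' h) wk)
sub-develop (ω₂ t) k η {σ} {σ'} {η'} h wk wη =
  sub-plugFire σ' (value-σ' h) _ _ k (Value-develop (ω₂ t) η) wk ◅◅
  plugFire-cong _ _ (▷*-ω₂ (sub-develop t [] η h [] wη))
    (λ e → trans (isValue-sub (value-σ h) t) e) (λ e → Value-sub σ' (value-σ' h) (Value-develop (ω₂ t) η e))
    (Value-develop (ω₂ (sub σ t)) η') (WfStack-subF σ' (value-σ' h) wk)
sub-develop (nam a t) k η {σ} {σ'} {η'} h wk wη =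
  sub-plugFire σ' (value-σ' h) true _ k (λ _ → v-nam) wk ◅◅
  plugFire-cong-value v-nam v-nam
    (▷*-nam (sub-develop t (η a) η h (wη a) wη ◅◅ ≡⇒▷* (cong (λ z → develop (sub σ t) z η') (sym (subEnv h a)))))
    (WfStack-subF σ' (value-σ' h) wk)
sub-develop (mu t) k η h wk wη = ▷*-mu (sub-develop t [] (bindμ k η) (DevSub-bindμ k h) [] (WfEnv-bindμ wk wη))
sub-develop (app t (tm u)) k η {σ} {σ'} {η'} h wk wη rewrite isValue-sub (value-σ h) t = go (isValue t) refl
  where
  wk' : WfStack (map (subF σ') k)
  wk' = WfStack-subF σ' (value-σ' h) wk
  wη' : WfEnv η'
  wη' = WfEnv-DevSub h wη
  go : ∀ b → isValue t ≡ b → sub σ' (developArg b t u k η) ▷* developArg b (sub σ t) (sub σ u) (map (subF σ') k) η'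
  go true e = sub-develop u (fL (develop t [] η) ∷ k) η h (Value-develop t η e ∷ wk) wη ◅◅
    develop-⊑ (sub σ u) (⊑L (sub-develop t [] η h [] wη) (⊑-refl wk')) (⊑ₑ-refl wη')
      (Value-sub σ' (value-σ' h) (Value-develop t η e) ∷ wk')
      (Value-develop (sub σ t) η' (trans (isValue-sub (value-σ h) t) e) ∷ wk') wη' wη'
  go false e = sub-develop t (fArg (develop u [] η) (isValue u) ∷ k) η h (WfFrame-devArg u η ∷ wk) wη ◅◅
    develop-⊑ (sub σ t) (⊑arg (sub-develop u [] η h [] wη) (trans (isValue-sub (value-σ h) u)) (Value-develop (sub σ u) η') (⊑-refl wk'))
      (⊑ₑ-refl wη') (WfFrame-subF σ' (value-σ' h) _ (WfFrame-devArg u η) ∷ wk') (WfFrame-devArg (sub σ u) η' ∷ wk') wη' wη'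
sub-develop (app t π₁) k η h wk wη = sub-develop t (fπ₁ ∷ k) η h (tt ∷ wk) wη
sub-develop (app t π₂) k η h wk wη = sub-develop t (fπ₂ ∷ k) η h (tt ∷ wk) wη
sub-develop (app t (case c d)) k η {σ} {σ'} {η'} h wk wη =
  sub-develop t _ η h (tt ∷ []) wη ◅◅
  develop-⊑ (sub σ t) (⊑case [] refl (branch c) (branch d) ⊑[]) (⊑ₑ-refl wη') (tt ∷ []) (tt ∷ []) wη' wη'
  where
  wη' : WfEnv η'
  wη' = WfEnv-DevSub h wη
  branch : ∀ c → sub (exts σ') (develop c (map wkλF k) (wkλEnv η)) ▷* develop (sub (exts σ) c) (map wkλF (map (subF σ') k)) (wkλEnv η')
  branch c = sub-develop c (map wkλF k) (wkλEnv η) (DevSub-exts h) (WfStack-renF suc (λ a → a) wk) (WfEnv-wkλEnv wη) ◅◅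
    ≡⇒▷* (cong (λ z → develop (sub (exts σ) c) z (wkλEnv η')) (sym (map-wkλF-subF σ' k)))

ValueSub-σ₀ : ∀ {n m} {V : Term n m} → Value V → ValueSub (σ₀ V)
ValueSub-σ₀ v zero = v
ValueSub-σ₀ v (suc x) = v-var

DevSub-σ₀ : ∀ {n m} {V : Term n m} (η : Env n m) → Value V → DevSub (σ₀ V) (σ₀ (develop V [] η)) (wkλEnv η) η
DevSub-σ₀ {V = V} η v = record
  { value-σ = ValueSub-σ₀ v
  ; value-σ' = ValueSub-σ₀ (Value-develop V η (Value⇒isValue v))
  ; σ'-▷* = λ { zero → ε ; (suc x) → ε }
  ; subEnv = λ a → sym (map-subF-wkλF (develop V [] η) (η a)) }

[0≔]-develop : ∀ {n m} (s : Term (suc n) m) (K : List (Frame n m)) (η : Env n m) (V : Term n m) → Value V → WfStack K → WfEnv η →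
       ((develop s (map wkλF K) (wkλEnv η)) [0≔ develop V [] η ]) ▷* develop (s [0≔ V ]) K η
[0≔]-develop s K η V v wK wη =
  ≡⇒▷* ([0≔]≡sub-σ₀ (develop s (map wkλF K) (wkλEnv η)) (develop V [] η)) ◅◅
  sub-develop s (map wkλF K) (wkλEnv η) (DevSub-σ₀ η v) (WfStack-renF suc (λ a → a) wK) (WfEnv-wkλEnv wη) ◅◅
  ≡⇒▷* (cong₂ (λ z w → develop z w η) (sym ([0≔]≡sub-σ₀ s V)) (map-subF-wkλF (develop V [] η) K))

fireβ≡fireL : ∀ {n m} (W U : Term n m) → fireβ W U ≡ fireL true U W
fireβ≡fireL (var x) U = refl
fireβ≡fireL (lam s) U = refl
fireβ≡fireL (app t e) U = refl
fireβ≡fireL (pair t u) U = refl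
fireβ≡fireL (ω₁ t) U = refl
fireβ≡fireL (ω₂ t) U = refl
fireβ≡fireL (mu t) U = refl
fireβ≡fireL (nam a t) U = refl

plugFire-arg-develop : ∀ {n m} (W u : Term n m) (k : List (Frame n m)) (η : Env n m) → Value W → WfStack k → WfEnv η →
     plugFire true W (fArg (develop u [] η) (isValue u) ∷ k) ▷* develop u (fL W ∷ k) η
plugFire-arg-develop W u k η v wk wη with isValue u in e
... | true = ≡⇒▷* (trans (cong (λ z → plug z k) (fireβ≡fireL W (develop u [] η))) (sym (develop-value u (fL W ∷ k) η e)))
... | false = plug-develop u [] (fL W ∷ k) η [] (v ∷ wk) wη

-- The stack on which develop continues with the function part of an application that is not a value
-- (develop-app-nonValue).
devFrame : ∀ {n m} → Frame n m → Env n m → List (Frame n m) → List (Frame n m)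
devFrame (fArg u b) η K = fArg (develop u [] η) (isValue u) ∷ K
devFrame fπ₁ η K = fπ₁ ∷ K
devFrame fπ₂ η K = fπ₂ ∷ K
devFrame (fCase c d) η K = fCase (develop c (map wkλF K) (wkλEnv η)) (develop d (map wkλF K) (wkλEnv η)) ∷ []
devFrame (fL V) η K = fL (develop V [] η) ∷ K

WfStack-devFrame : ∀ {n m} (g : Frame n m) (η : Env n m) (K : List (Frame n m)) → WfFrame g → WfStack K → WfStack (devFrame g η K)
WfStack-devFrame (fArg u b) η K w wk = WfFrame-devArg u η ∷ wk
WfStack-devFrame fπ₁ η K w wk = tt ∷ wk
WfStack-devFrame fπ₂ η K w wk = tt ∷ wk
WfStack-devFrame (fCase c d) η K w wk = tt ∷ []
WfStack-devFrame (fL V) η K w wk = Value-develop V η (Value⇒isValue w) ∷ wk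

develop-devFrame : ∀ {n m} (v : Term n m) (g : Frame n m) (K : List (Frame n m)) (η : Env n m) → WfFrame g → WfStack K → WfEnv η →
      develop v (devFrame g η K) η ▷* develop (plug₁ v g) K η
develop-devFrame v (fArg u b) K η w wk wη with isValue v in e
... | true = ≡⇒▷* (develop-value v _ η e) ◅◅ plugFire-arg-develop (develop v [] η) u K η (Value-develop v η e) wk wη
... | false = ε
develop-devFrame v fπ₁ K η w wk wη = ε
develop-devFrame v fπ₂ K η w wk wη = ε
develop-devFrame v (fCase c d) K η w wk wη = ε
develop-devFrame v (fL V) K η w wk wη rewrite Value⇒isValue w = ε

ren-devFrame : ∀ {n n' m m'} (ρ : Fin n → Fin n') (θ : Fin m → Fin m') (g : Frame n m) {η : Env n m} {η' : Env n' m'}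
               (K : List (Frame n m)) → RenEnv ρ θ η η' →
               map (renF ρ θ) (devFrame g η K) ≡ devFrame (renF ρ θ g) η' (map (renF ρ θ) K)
ren-devFrame ρ θ (fArg u b) K h = cong₂ (λ x y → fArg x y ∷ map (renF ρ θ) K) (ren-develop ρ θ u [] h) (sym (isValue-ren ρ θ u))
ren-devFrame ρ θ fπ₁ K h = refl
ren-devFrame ρ θ fπ₂ K h = refl
ren-devFrame ρ θ (fCase c d) K h = cong₂ (λ x y → fCase x y ∷ []) (ren-developBranch ρ θ c K h) (ren-developBranch ρ θ d K h)
ren-devFrame ρ θ (fL V) K h = cong (λ x → fL x ∷ map (renF ρ θ) K) (ren-develop ρ θ V [] h)

if-true : ∀ {A : Set} {c : Bool} {x y : A} → c ≡ true → (if c then x else y) ≡ x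
if-true refl = refl

if-false : ∀ {A : Set} {c : Bool} {x y : A} → c ≡ false → (if c then x else y) ≡ y
if-false refl = refl

updateEnv : ∀ {n m} → Fin m → List (Frame n m) → Env n m → Env n m
updateEnv a K η b = if does (b ≟ a) then K else η b

record DevUpdate {n m} (a : Fin m) (g : Frame n m) (ηs η η' : Env n m) : Set where
  field
    pushed  : ∀ b → ηs b ≡ singleEnv a (g ∷ []) b
    updated : ∀ b → η' b ≡ updateEnv a (devFrame g η (η a)) η b
    wf-g    : WfFrame g
open DevUpdate

DevUpdate-wkλ : ∀ {n m} {a : Fin m} {g : Frame n m} {ηs η η' : Env n m} →
                DevUpdate a g ηs η η' → DevUpdate a (wkλF g) (wkλEnv ηs) (wkλEnv η) (wkλEnv η')
DevUpdate-wkλ {a = a} {g} {η = η} h = record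
  { pushed = λ b → trans (cong (map wkλF) (pushed h b)) (sym (singleEnv-wkλF a g b))
  ; updated = λ b → trans (cong (map wkλF) (updated h b)) (trans (if-float (map wkλF) (does (b ≟ a)))
      (cong (λ z → if does (b ≟ a) then z else map wkλF (η b)) (ren-devFrame suc (λ a → a) g (η a) (mkRenEnv λ _ → refl))))
  ; wf-g = WfFrame-renF suc (λ a → a) g (wf-g h) }

DevUpdate-bindμ : ∀ {n m} {a : Fin m} {g : Frame n m} {ηs η η' : Env n m} (k : List (Frame n m)) →
                  DevUpdate a g ηs η η' → DevUpdate (suc a) (wkμF g) (liftμEnv ηs) (bindμ k η) (bindμ k η')
DevUpdate-bindμ {a = a} {g} {η = η} k h = record
  { pushed = λ { zero → refl ; (suc b) → trans (cong (map wkμF) (pushed h b)) (sym (singleEnv-wkμF a g (suc b))) }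
  ; updated = λ { zero → refl ; (suc b) → trans (cong (map wkμF) (updated h b)) (trans (if-float (map wkμF) (does (b ≟ a)))
      (cong (λ z → if does (b ≟ a) then z else map wkμF (η b))
            (ren-devFrame (λ x → x) suc g {η' = bindμ k η} (η a) (mkRenEnv λ _ → refl)))) }
  ; wf-g = WfFrame-renF (λ x → x) suc g (wf-g h) }

develop-updateEnv : ∀ {n m} (X : Term n m) (k : List (Frame n m)) {a : Fin m} {g : Frame n m} {ηs η η' : Env n m} →
                    DevUpdate a g ηs η η' → WfStack k → WfEnv η → WfEnv η' → develop X k η' ▷* develop (push ηs X) k η
develop-updateEnv (var x) k h wk wη wη' = ε
develop-updateEnv (lam t) k h wk wη wη' =
  plugFire-cong-value v-lam v-lam (▷*-lam (develop-updateEnv t [] (DevUpdate-wkλ h) [] (WfEnv-wkλEnv wη) (WfEnv-wkλEnv wη'))) wk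
develop-updateEnv (pair t u) k {ηs = ηs} {η} {η'} h wk wη wη' =
  plugFire-cong _ _ (▷*-pair (develop-updateEnv t [] h [] wη wη') (develop-updateEnv u [] h [] wη wη'))
    (trans (isValue-push ηs (pair t u))) (Value-develop (pair t u) η') (Value-develop (pair (push ηs t) (push ηs u)) η) wk
develop-updateEnv (ω₁ t) k {ηs = ηs} {η} {η'} h wk wη wη' =
  plugFire-cong _ _ (▷*-ω₁ (develop-updateEnv t [] h [] wη wη'))
    (trans (isValue-push ηs t)) (Value-develop (ω₁ t) η') (Value-develop (ω₁ (push ηs t)) η) wk
develop-updateEnv (ω₂ t) k {ηs = ηs} {η} {η'} h wk wη wη' =
  plugFire-cong _ _ (▷*-ω₂ (develop-updateEnv t [] h [] wη wη'))
    (trans (isValue-push ηs t)) (Value-develop (ω₂ t) η') (Value-develop (ω₂ (push ηs t)) η) wk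
develop-updateEnv (nam b v) k {a} {g} {ηs} {η} {η'} h wk wη wη' = plugFire-cong-value v-nam v-nam (▷*-nam named) wk
  where
  named : develop v (η' b) η' ▷* develop (plug (push ηs v) (ηs b)) (η b) η
  named with b ≟ a
  ... | yes refl =
    ≡⇒▷* (cong (λ z → develop v z η') (trans (updated h b) (if-true (dec-true (b ≟ b) refl)))) ◅◅
    develop-updateEnv v (devFrame g η (η b)) h (WfStack-devFrame g η (η b) (wf-g h) (wη b)) wη wη' ◅◅
    develop-devFrame (push ηs v) g (η b) η (wf-g h) (wη b) wη ◅◅
    ≡⇒▷* (cong (λ z → develop (plug (push ηs v) z) (η b) η) (sym (trans (pushed h b) (if-true (dec-true (b ≟ b) refl)))))
  ... | no b≢a =
    ≡⇒▷* (cong (λ z → develop v z η') (trans (updated h b) (if-false (dec-false (b ≟ a) b≢a)))) ◅◅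
    develop-updateEnv v (η b) h (wη b) wη wη' ◅◅
    ≡⇒▷* (cong (λ z → develop (plug (push ηs v) z) (η b) η) (sym (trans (pushed h b) (if-false (dec-false (b ≟ a) b≢a)))))
develop-updateEnv (mu t) k h wk wη wη' =
  ▷*-mu (develop-updateEnv t [] (DevUpdate-bindμ k h) [] (WfEnv-bindμ wk wη) (WfEnv-bindμ wk wη'))
develop-updateEnv (app t (tm u)) k {ηs = ηs} {η} {η'} h wk wη wη' rewrite isValue-push ηs t = go (isValue t) refl
  where
  go : ∀ b → isValue t ≡ b → developArg b t u k η' ▷* developArg b (push ηs t) (push ηs u) k η
  go true e = develop-updateEnv u (fL (develop t [] η') ∷ k) h (Value-develop t η' e ∷ wk) wη wη' ◅◅
    develop-⊑ (push ηs u) (⊑L (develop-updateEnv t [] h [] wη wη') (⊑-refl wk)) (⊑ₑ-refl wη) (Value-develop t η' e ∷ wk)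
      (Value-develop (push ηs t) η (trans (isValue-push ηs t) e) ∷ wk) wη wη
  go false e = develop-updateEnv t (fArg (develop u [] η') (isValue u) ∷ k) h (WfFrame-devArg u η' ∷ wk) wη wη' ◅◅
    develop-⊑ (push ηs t) (⊑arg (develop-updateEnv u [] h [] wη wη') (trans (isValue-push ηs u)) (Value-develop (push ηs u) η) (⊑-refl wk))
      (⊑ₑ-refl wη) (WfFrame-devArg u η' ∷ wk) (WfFrame-devArg (push ηs u) η ∷ wk) wη wη
develop-updateEnv (app t π₁) k h wk wη wη' = develop-updateEnv t (fπ₁ ∷ k) h (tt ∷ wk) wη wη'
develop-updateEnv (app t π₂) k h wk wη wη' = develop-updateEnv t (fπ₂ ∷ k) h (tt ∷ wk) wη wη'
develop-updateEnv (app t (case c d)) k {ηs = ηs} {η} {η'} h wk wη wη' =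
  develop-updateEnv t _ h (tt ∷ []) wη wη' ◅◅
  develop-⊑ (push ηs t) (⊑case [] refl (branch c) (branch d) ⊑[]) (⊑ₑ-refl wη) (tt ∷ []) (tt ∷ []) wη wη
  where
  branch : ∀ c → develop c (map wkλF k) (wkλEnv η') ▷* develop (push (wkλEnv ηs) c) (map wkλF k) (wkλEnv η)
  branch c = develop-updateEnv c (map wkλF k) (DevUpdate-wkλ h) (WfStack-renF suc (λ a → a) wk) (WfEnv-wkλEnv wη) (WfEnv-wkλEnv wη')

-- Every one-step reduct reduces to the development

develop-app-nonValue : ∀ {n m} (t : Term n m) (e : ETerm n m) (k : List (Frame n m)) (η : Env n m) → isValue t ≡ false →
          develop (app t e) k η ≡ develop t (devFrame (frameOf e) η k) η
develop-app-nonValue t (tm u) k η h rewrite h = refl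
develop-app-nonValue t π₁ k η h = refl
develop-app-nonValue t π₂ k η h = refl
develop-app-nonValue t (case c d) k η h = refl

WfFrame-frameOf : ∀ {n m} (e : ETerm n m) → WfFrame (frameOf e)
WfFrame-frameOf (tm u) = λ ()
WfFrame-frameOf π₁ = tt
WfFrame-frameOf π₂ = tt
WfFrame-frameOf (case c d) = tt

plug-mu-push-▷* : ∀ {n m} (Y : Term n (suc m)) (k : List (Frame n m)) (η : Env n m) → WfStack k →
                  plug (mu (push (liftμEnv η) Y)) k ▷* mu (push (bindμ k η) Y)
plug-mu-push-▷* Y k η wk = plug-mu-▷* (push (liftμEnv η) Y) k wk ◅◅ ≡⇒▷* (cong mu (push-push composite Y))
  where
  composite : IsComposite (liftμEnv η) (env₀ (map wkμF k)) (bindμ k η)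
  composite zero = refl
  composite (suc a) = sym (trans (++-identityʳ _) (map-pushF-wkμF (λ _ → refl) (η a)))

▷*-develop : ∀ {n m} (t : Term n m) (k : List (Frame n m)) (η : Env n m) → WfStack k → WfEnv η → plug (push η t) k ▷* develop t k η
▷*-develop (var x) k η wk wη = plug-▷*-plugFire true (var x) k (λ _ → v-var) wk
▷*-develop (lam t) k η wk wη =
  plug-▷* k (▷*-lam (▷*-develop t [] (wkλEnv η) [] (WfEnv-wkλEnv wη))) ◅◅ plug-▷*-plugFire true _ k (λ _ → v-lam) wk
▷*-develop (pair t u) k η wk wη =
  plug-▷* k (▷*-pair (▷*-develop t [] η [] wη) (▷*-develop u [] η [] wη)) ◅◅ plug-▷*-plugFire _ _ k (Value-develop (pair t u) η) wk
▷*-develop (ω₁ t) k η wk wη = plug-▷* k (▷*-ω₁ (▷*-develop t [] η [] wη)) ◅◅ plug-▷*-plugFire _ _ k (Value-develop (ω₁ t) η) wk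
▷*-develop (ω₂ t) k η wk wη = plug-▷* k (▷*-ω₂ (▷*-develop t [] η [] wη)) ◅◅ plug-▷*-plugFire _ _ k (Value-develop (ω₂ t) η) wk
▷*-develop (nam a t) k η wk wη =
  plug-▷* k (▷*-nam (▷*-develop t (η a) η (wη a) wη)) ◅◅ plug-▷*-plugFire true _ k (λ _ → v-nam) wk
▷*-develop (mu t) k η wk wη = plug-mu-push-▷* t k η wk ◅◅ ▷*-mu (▷*-develop t [] (bindμ k η) [] (WfEnv-bindμ wk wη))
▷*-develop (app t (tm u)) k η wk wη = go (isValue t) refl
  where
  go : ∀ b → isValue t ≡ b → plug (app (push η t) (tm (push η u))) k ▷* developArg b t u k η
  go true e = ▷*-develop u (fL (push η t) ∷ k) η (value-t ∷ wk) wη ◅◅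
    develop-⊑ u (⊑L (▷*-develop t [] η [] wη) (⊑-refl wk)) (⊑ₑ-refl wη) (value-t ∷ wk) (Value-develop t η e ∷ wk) wη wη
    where
      value-t : Value (push η t)
      value-t = isValue⇒Value (trans (isValue-push η t) e)
  go false e = ▷*-develop t (fArg (push η u) false ∷ k) η ((λ ()) ∷ wk) wη ◅◅
    develop-⊑ t (⊑arg (▷*-develop u [] η [] wη) (λ ()) (Value-develop u η) (⊑-refl wk)) (⊑ₑ-refl wη) ((λ ()) ∷ wk)
      (WfFrame-devArg u η ∷ wk) wη wη
▷*-develop (app t π₁) k η wk wη = ▷*-develop t (fπ₁ ∷ k) η (tt ∷ wk) wη
▷*-develop (app t π₂) k η wk wη = ▷*-develop t (fπ₂ ∷ k) η (tt ∷ wk) wη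
▷*-develop (app t (case c d)) k η wk wη =
  ▷*-develop t (fCase (push (wkλEnv η) c) (push (wkλEnv η) d) ∷ k) η (tt ∷ wk) wη ◅◅
  develop-⊑ t (⊑case k (sym (++-identityʳ k)) (▷*-develop c _ (wkλEnv η) wk' (WfEnv-wkλEnv wη))
                                              (▷*-develop d _ (wkλEnv η) wk' (WfEnv-wkλEnv wη)) ⊑[])
    (⊑ₑ-refl wη) (tt ∷ wk) (tt ∷ []) wη wη
  where
    wk' : WfStack (map wkλF k)
    wk' = WfStack-renF suc (λ a → a) wk

frameOf-⊑-devFrame : ∀ {n m} (e : ETerm n m) (η : Env n m) (k : List (Frame n m)) → WfStack k → WfEnv η →
      frameOf (pushE η e) ∷ k ⊑ devFrame (frameOf e) η k
frameOf-⊑-devFrame (tm u) η k wk wη = ⊑arg (▷*-develop u [] η [] wη) (λ ()) (Value-develop u η) (⊑-refl wk)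
frameOf-⊑-devFrame π₁ η k wk wη = ⊑π₁ (⊑-refl wk)
frameOf-⊑-devFrame π₂ η k wk wη = ⊑π₂ (⊑-refl wk)
frameOf-⊑-devFrame (case c d) η k wk wη = ⊑case k (sym (++-identityʳ k))
  (▷*-develop c (map wkλF k) (wkλEnv η) (WfStack-renF suc (λ a → a) wk) (WfEnv-wkλEnv wη))
  (▷*-develop d (map wkλF k) (wkλEnv η) (WfStack-renF suc (λ a → a) wk) (WfEnv-wkλEnv wη)) ⊑[]

wkλ-devFrame : ∀ {n m} (e : ETerm n m) (η : Env n m) (k : List (Frame n m)) →
          map wkλF (devFrame (frameOf e) η k) ≡ devFrame (frameOf (wkλE e)) (wkλEnv η) (map wkλF k)
wkλ-devFrame e η k = trans (ren-devFrame suc (λ a → a) (frameOf e) k (mkRenEnv λ _ → refl))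
  (cong (λ z → devFrame z (wkλEnv η) (map wkλF k)) (renF-frameOf suc (λ a → a) e))

wkμ-devFrame : ∀ {n m} (e : ETerm n m) (η : Env n m) (k : List (Frame n m)) →
          map wkμF (devFrame (frameOf e) η k) ≡ devFrame (frameOf (wkμE e)) (bindμ k η) (map wkμF k)
wkμ-devFrame e η k = trans (ren-devFrame (λ x → x) suc (frameOf e) {η' = bindμ k η} k (mkRenEnv λ _ → refl))
  (cong (λ z → devFrame z (bindμ k η) (map wkμF k)) (renF-frameOf (λ x → x) suc e))

pushF-frameOf : ∀ {n m} (η : Env n m) (e : ETerm n m) → pushF η (frameOf e) ≡ frameOf (pushE η e)
pushF-frameOf η (tm u) = refl
pushF-frameOf η π₁ = refl
pushF-frameOf η π₂ = refl
pushF-frameOf η (case c d) = refl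

push-[0≔]-▷*-develop : ∀ {n m} {V : Term n m} (c : Term (suc n) m) (k : List (Frame n m)) (η : Env n m) →
                       Value V → WfStack k → WfEnv η →
                       plug (push η (c [0≔ V ])) k ▷* ((develop c (map wkλF k) (wkλEnv η)) [0≔ develop V [] η ])
push-[0≔]-▷*-develop {V = V} c k η v wk wη =
  ≡⇒▷* (trans (cong (λ z → plug z k) (push-[0≔] η c V)) (plug-[0≔] (push (wkλEnv η) c) (push η V) k)) ◅◅
  [0≔]-▷* (Value-push η v) (▷*-develop c (map wkλF k) (wkλEnv η) (WfStack-renF suc (λ a → a) wk) (WfEnv-wkλEnv wη))
    (▷*-develop V [] η [] wη)

reduct-comR : ∀ {n m} (r : Term n m) (c d : Term (suc n) m) (e : ETerm n m) (k : List (Frame n m)) (η : Env n m) →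
              WfStack k → WfEnv η →
              plug (push η (app r (case (app c (wkλE e)) (app d (wkλE e))))) k ▷* develop (app (app r (case c d)) e) k η
reduct-comR r c d e k η wk wη =
  plug-case-▷* (push η r) _ _ k wk ◅◅
  ▷*-develop r (fCase _ _ ∷ []) η (tt ∷ []) wη ◅◅
  develop-⊑ r (⊑case [] refl (branch c) (branch d) ⊑[]) (⊑ₑ-refl wη) (tt ∷ []) (tt ∷ []) wη wη ◅◅
  ≡⇒▷* (sym (develop-app-nonValue (app r (case c d)) e k η refl))
  where
  wk' : WfStack (map wkλF k)
  wk' = WfStack-renF suc (λ a → a) wk
  wη' : WfEnv (wkλEnv η)
  wη' = WfEnv-wkλEnv wη
  branch : ∀ c → plug (app (push (wkλEnv η) c) (pushE (wkλEnv η) (wkλE e))) (map wkλF k) ▷*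
                 develop c (map wkλF (devFrame (frameOf e) η k)) (wkλEnv η)
  branch c =
    ≡⇒▷* (cong (λ z → plug z (map wkλF k)) (sym (plug₁-frameOf (push (wkλEnv η) c) (pushE (wkλEnv η) (wkλE e))))) ◅◅
    ▷*-develop c (frameOf (pushE (wkλEnv η) (wkλE e)) ∷ map wkλF k) (wkλEnv η) (WfFrame-frameOf _ ∷ wk') wη' ◅◅
    develop-⊑ c (frameOf-⊑-devFrame (wkλE e) (wkλEnv η) (map wkλF k) wk' wη') (⊑ₑ-refl wη')
      (WfFrame-frameOf _ ∷ wk') (WfStack-devFrame _ (wkλEnv η) _ (WfFrame-frameOf _) wk') wη' wη' ◅◅
    ≡⇒▷* (cong (λ z → develop c z (wkλEnv η)) (sym (wkλ-devFrame e η k)))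

reduct-comL : ∀ {n m} {V : Term n m} (r : Term n m) (c d : Term (suc n) m) (k : List (Frame n m)) (η : Env n m) →
              Value V → WfStack k → WfEnv η →
              plug (push η (app r (case (app (wkλ V) (tm c)) (app (wkλ V) (tm d))))) k ▷* develop (app V (tm (app r (case c d)))) k η
reduct-comL {V = V} r c d k η v wk wη rewrite Value⇒isValue v =
  plug-case-▷* (push η r) _ _ k wk ◅◅
  ▷*-develop r (fCase _ _ ∷ []) η (tt ∷ []) wη ◅◅
  develop-⊑ r (⊑case [] refl (branch c) (branch d) ⊑[]) (⊑ₑ-refl wη) (tt ∷ []) (tt ∷ []) wη wη
  where
  wk' : WfStack (map wkλF k)
  wk' = WfStack-renF suc (λ a → a) wk
  wη' : WfEnv (wkλEnv η)
  wη' = WfEnv-wkλEnv wη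
  value-V : Value (push (wkλEnv η) (wkλ V))
  value-V = Value-push (wkλEnv η) (Value-ren suc (λ a → a) v)
  V▷* : push (wkλEnv η) (wkλ V) ▷* wkλ (develop V [] η)
  V▷* = ≡⇒▷* (sym (ren-push suc (λ a → a) (mkRenEnv λ _ → refl) V)) ◅◅ ren-▷* suc (λ a → a) (▷*-develop V [] η [] wη)
  branch : ∀ c → plug (app (push (wkλEnv η) (wkλ V)) (tm (push (wkλEnv η) c))) (map wkλF k) ▷*
                 develop c (map wkλF (fL (develop V [] η) ∷ k)) (wkλEnv η)
  branch c =
    ▷*-develop c (fL (push (wkλEnv η) (wkλ V)) ∷ map wkλF k) (wkλEnv η) (value-V ∷ wk') wη' ◅◅
    develop-⊑ c (⊑L V▷* (⊑-refl wk')) (⊑ₑ-refl wη') (value-V ∷ wk')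
      (Value-ren suc (λ a → a) (Value-develop V η (Value⇒isValue v)) ∷ wk') wη' wη'

reduct-μR : ∀ {n m} (w : Term n (suc m)) (e : ETerm n m) (k : List (Frame n m)) (η : Env n m) → WfStack k → WfEnv η →
            plug (push η (mu (substR zero (wkμE e) w))) k ▷* develop (app (mu w) e) k η
reduct-μR w e k η wk wη =
  plug-mu-push-▷* (substR zero (wkμE e) w) k η wk ◅◅
  ≡⇒▷* (cong (λ z → mu (push (bindμ k η) z)) (substR≡push zero (wkμE e) w)) ◅◅
  ≡⇒▷* (cong mu (push-push composite w)) ◅◅
  ▷*-mu (▷*-develop w [] (bindμ (frameOf (pushE η e) ∷ k) η) [] (WfEnv-bindμ (WfFrame-frameOf _ ∷ wk) wη) ◅◅
         develop-⊑ w ⊑[] (⊑ₑ-bindμ (frameOf-⊑-devFrame e η k wk wη) (⊑ₑ-refl wη)) [] []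
           (WfEnv-bindμ (WfFrame-frameOf _ ∷ wk) wη) (WfEnv-bindμ (WfStack-devFrame _ η k (WfFrame-frameOf e) wk) wη)) ◅◅
  ≡⇒▷* (sym (develop-app-nonValue (mu w) e k η refl))
  where
  composite : IsComposite (singleEnv zero (frameOf (wkμE e) ∷ [])) (bindμ k η) (bindμ (frameOf (pushE η e) ∷ k) η)
  composite zero = cong (_∷ map wkμF k) (sym (begin
    pushF (bindμ k η) (frameOf (wkμE e))  ≡⟨ cong (pushF (bindμ k η)) (renF-frameOf (λ x → x) suc e) ⟨
    pushF (bindμ k η) (wkμF (frameOf e))  ≡⟨ renF-pushF (λ x → x) suc {η = η} (mkRenEnv λ _ → refl) (frameOf e) ⟨
    wkμF (pushF η (frameOf e))            ≡⟨ cong wkμF (pushF-frameOf η e) ⟩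
    wkμF (frameOf (pushE η e))            ∎))
    where open ≡-Reasoning
  composite (suc a) = refl

reduct-μL : ∀ {n m} {V : Term n m} (w : Term n (suc m)) (k : List (Frame n m)) (η : Env n m) → Value V → WfStack k → WfEnv η →
            plug (push η (mu (substL zero (wkμ V) w))) k ▷* develop (app V (tm (mu w))) k η
reduct-μL {V = V} w k η v wk wη rewrite Value⇒isValue v =
  plug-mu-push-▷* (substL zero (wkμ V) w) k η wk ◅◅
  ≡⇒▷* (cong (λ z → mu (push (bindμ k η) z)) (substL≡push zero (wkμ V) w)) ◅◅
  ≡⇒▷* (cong mu (push-push composite w)) ◅◅
  ▷*-mu (▷*-develop w [] (bindμ (fL (push η V) ∷ k) η) [] (WfEnv-bindμ (Value-push η v ∷ wk) wη) ◅◅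
         develop-⊑ w ⊑[] (⊑ₑ-bindμ (⊑L (▷*-develop V [] η [] wη) (⊑-refl wk)) (⊑ₑ-refl wη)) [] []
           (WfEnv-bindμ (Value-push η v ∷ wk) wη) (WfEnv-bindμ (Value-develop V η (Value⇒isValue v) ∷ wk) wη))
  where
  composite : IsComposite (singleEnv zero (fL (wkμ V) ∷ [])) (bindμ k η) (bindμ (fL (push η V) ∷ k) η)
  composite zero = cong (λ z → fL z ∷ map wkμF k) (ren-push (λ x → x) suc {η = η} (mkRenEnv λ _ → refl) V)
  composite (suc a) = refl

reduct-▷*-develop : ∀ {n m} {t s : Term n m} → t ▷ s → (k : List (Frame n m)) (η : Env n m) → WfStack k → WfEnv η →
                    plug (push η s) k ▷* develop t k η
reduct-▷*-develop (β {s} {V} v) k η wk wη =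
  ≡⇒▷* (cong (λ z → plug z k) (push-[0≔] η s V)) ◅◅
  plug-▷* k ([0≔]-▷* (Value-push η v) (▷*-develop s [] (wkλEnv η) [] (WfEnv-wkλEnv wη)) (▷*-develop V [] η [] wη)) ◅◅
  ≡⇒▷* (sym (develop-value V _ η (Value⇒isValue v)))
reduct-▷*-develop (proj₁ {V₁} v w) k η wk wη rewrite Value⇒isValue v | Value⇒isValue w = plug-▷* k (▷*-develop V₁ [] η [] wη)
reduct-▷*-develop (proj₂ {V₂ = V₂} v w) k η wk wη rewrite Value⇒isValue v | Value⇒isValue w = plug-▷* k (▷*-develop V₂ [] η [] wη)
reduct-▷*-develop (cas₁ {t₁ = c} v) k η wk wη rewrite Value⇒isValue v = push-[0≔]-▷*-develop c k η v wk wη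
reduct-▷*-develop (cas₂ {t₂ = d} v) k η wk wη rewrite Value⇒isValue v = push-[0≔]-▷*-develop d k η v wk wη
reduct-▷*-develop (comR {r} {c} {d} {e}) k η wk wη = reduct-comR r c d e k η wk wη
reduct-▷*-develop (comL {t = r} {c} {d} v) k η wk wη = reduct-comL r c d k η v wk wη
reduct-▷*-develop (μR {w} {e}) k η wk wη = reduct-μR w e k η wk wη
reduct-▷*-develop (μL {t = w} v) k η wk wη = reduct-μL w k η v wk wη
reduct-▷*-develop (ξ-lam r) k η wk wη =
  plug-▷* k (▷*-lam (reduct-▷*-develop r [] (wkλEnv η) [] (WfEnv-wkλEnv wη))) ◅◅ plug-▷*-plugFire true _ k (λ _ → v-lam) wk
reduct-▷*-develop (ξ-pairˡ {t} {u = u} r) k η wk wη =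
  plug-▷* k (▷*-pair (reduct-▷*-develop r [] η [] wη) (▷*-develop u [] η [] wη)) ◅◅
  plug-▷*-plugFire _ _ k (Value-develop (pair t u) η) wk
reduct-▷*-develop (ξ-pairʳ {t} {u} r) k η wk wη =
  plug-▷* k (▷*-pair (▷*-develop t [] η [] wη) (reduct-▷*-develop r [] η [] wη)) ◅◅
  plug-▷*-plugFire _ _ k (Value-develop (pair t u) η) wk
reduct-▷*-develop (ξ-ω₁ {t} r) k η wk wη =
  plug-▷* k (▷*-ω₁ (reduct-▷*-develop r [] η [] wη)) ◅◅ plug-▷*-plugFire _ _ k (Value-develop (ω₁ t) η) wk
reduct-▷*-develop (ξ-ω₂ {t} r) k η wk wη =
  plug-▷* k (▷*-ω₂ (reduct-▷*-develop r [] η [] wη)) ◅◅ plug-▷*-plugFire _ _ k (Value-develop (ω₂ t) η) wk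
reduct-▷*-develop (ξ-nam {a} r) k η wk wη =
  plug-▷* k (▷*-nam (reduct-▷*-develop r (η a) η (wη a) wη)) ◅◅ plug-▷*-plugFire true _ k (λ _ → v-nam) wk
reduct-▷*-develop (ξ-mu {t' = t'} r) k η wk wη =
  plug-mu-push-▷* t' k η wk ◅◅ ▷*-mu (reduct-▷*-develop r [] (bindμ k η) [] (WfEnv-bindμ wk wη))
reduct-▷*-develop (ξ-appˡ {t} {t'} {tm u} r) k η wk wη = go (isValue t) refl
  where
  go : ∀ b → isValue t ≡ b → plug (app (push η t') (tm (push η u))) k ▷* developArg b t u k η
  go true e = ▷*-develop u (fL (push η t') ∷ k) η (value-t' ∷ wk) wη ◅◅
    develop-⊑ u (⊑L (reduct-▷*-develop r [] η [] wη) (⊑-refl wk)) (⊑ₑ-refl wη) (value-t' ∷ wk) (Value-develop t η e ∷ wk) wη wη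
    where
      value-t' : Value (push η t')
      value-t' = Value-push η (Value-▷ (isValue⇒Value e) r)
  go false e = reduct-▷*-develop r (fArg (push η u) false ∷ k) η ((λ ()) ∷ wk) wη ◅◅
    develop-⊑ t (⊑arg (▷*-develop u [] η [] wη) (λ ()) (Value-develop u η) (⊑-refl wk)) (⊑ₑ-refl wη)
      ((λ ()) ∷ wk) (WfFrame-devArg u η ∷ wk) wη wη
reduct-▷*-develop (ξ-appˡ {e = π₁} r) k η wk wη = reduct-▷*-develop r (fπ₁ ∷ k) η (tt ∷ wk) wη
reduct-▷*-develop (ξ-appˡ {e = π₂} r) k η wk wη = reduct-▷*-develop r (fπ₂ ∷ k) η (tt ∷ wk) wη
reduct-▷*-develop (ξ-appˡ {t} {e = case c d} r) k η wk wη = reduct-▷*-develop r (fCase _ _ ∷ k) η (tt ∷ wk) wη ◅◅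
  develop-⊑ t (frameOf-⊑-devFrame (case c d) η k wk wη) (⊑ₑ-refl wη) (tt ∷ wk) (tt ∷ []) wη wη
reduct-▷*-develop (ξ-appʳ {t} (ξ-tm {u} {u'} r)) k η wk wη = go (isValue t) refl
  where
  go : ∀ b → isValue t ≡ b → plug (app (push η t) (tm (push η u'))) k ▷* developArg b t u k η
  go true e = reduct-▷*-develop r (fL (push η t) ∷ k) η (value-t ∷ wk) wη ◅◅
    develop-⊑ u (⊑L (▷*-develop t [] η [] wη) (⊑-refl wk)) (⊑ₑ-refl wη) (value-t ∷ wk) (Value-develop t η e ∷ wk) wη wη
    where
      value-t : Value (push η t)
      value-t = Value-push η (isValue⇒Value e)
  go false e = ▷*-develop t (fArg (push η u') false ∷ k) η ((λ ()) ∷ wk) wη ◅◅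
    develop-⊑ t (⊑arg (reduct-▷*-develop r [] η [] wη) (λ ()) (Value-develop u η) (⊑-refl wk)) (⊑ₑ-refl wη)
      ((λ ()) ∷ wk) (WfFrame-devArg u η ∷ wk) wη wη
reduct-▷*-develop (ξ-appʳ {t} (ξ-caseˡ {t₂ = d} r)) k η wk wη = ▷*-develop t (fCase _ _ ∷ k) η (tt ∷ wk) wη ◅◅
  develop-⊑ t (⊑case k (sym (++-identityʳ k)) (reduct-▷*-develop r (map wkλF k) (wkλEnv η) (WfStack-renF suc (λ a → a) wk) (WfEnv-wkλEnv wη))
                 (▷*-develop d (map wkλF k) (wkλEnv η) (WfStack-renF suc (λ a → a) wk) (WfEnv-wkλEnv wη)) ⊑[])
    (⊑ₑ-refl wη) (tt ∷ wk) (tt ∷ []) wη wη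
reduct-▷*-develop (ξ-appʳ {t} (ξ-caseʳ {c} r)) k η wk wη = ▷*-develop t (fCase _ _ ∷ k) η (tt ∷ wk) wη ◅◅
  develop-⊑ t (⊑case k (sym (++-identityʳ k)) (▷*-develop c (map wkλF k) (wkλEnv η) (WfStack-renF suc (λ a → a) wk) (WfEnv-wkλEnv wη))
                 (reduct-▷*-develop r (map wkλF k) (wkλEnv η) (WfStack-renF suc (λ a → a) wk) (WfEnv-wkλEnv wη)) ⊑[])
    (⊑ₑ-refl wη) (tt ∷ wk) (tt ∷ []) wη wη

-- Development is monotone under reduction

fire-pair-arg : ∀ {n m} (b : Bool) (x y U : Term n m) (bu : Bool) → fire b (pair x y) (fArg U bu) ≡ app (pair x y) (tm U)
fire-pair-arg b x y U true = refl
fire-pair-arg b x y U false = refl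

fire-ω₁-arg : ∀ {n m} (b : Bool) (x U : Term n m) (bu : Bool) → fire b (ω₁ x) (fArg U bu) ≡ app (ω₁ x) (tm U)
fire-ω₁-arg b x U true = refl
fire-ω₁-arg b x U false = refl

fire-ω₂-arg : ∀ {n m} (b : Bool) (x U : Term n m) (bu : Bool) → fire b (ω₂ x) (fArg U bu) ≡ app (ω₂ x) (tm U)
fire-ω₂-arg b x U true = refl
fire-ω₂-arg b x U false = refl

isValue-[0≔] : ∀ {n m} (c : Term (suc n) m) (Z : Term n m) → Value Z → isValue (c [0≔ Z ]) ≡ isValue c
isValue-[0≔] c Z v = trans (cong isValue ([0≔]≡sub-σ₀ c Z)) (isValue-sub (ValueSub-σ₀ v) c)

plug-app-develop : ∀ {n m} {X W' : Term n m} (u : Term n m) (k : List (Frame n m)) (η : Env n m) → X ▷* W' → Value W' → WfStack k → WfEnv η →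
      plug (app X (tm (develop u [] η))) k ▷* develop u (fL W' ∷ k) η
plug-app-develop u k η p v wk wη = plug-▷* k (▷*-app-tm p ε) ◅◅ plug-develop u [] (fL _ ∷ k) η [] (v ∷ wk) wη

develop-case-toValue : ∀ {n m} (Z : Term n m) (c : Term (suc n) m) (u : Term n m) (k : List (Frame n m)) (η : Env n m) →
                       Value Z → isValue c ≡ true → WfStack k → WfEnv η →
                       ((develop c (map wkλF (fArg (develop u [] η) (isValue u) ∷ k)) (wkλEnv η)) [0≔ develop Z [] η ]) ▷*
                       develop u (fL (develop (c [0≔ Z ]) [] η) ∷ k) η
develop-case-toValue {n} {m} Z c u k η vz ec wk wη =
  ≡⇒▷* (trans ([0≔]≡sub-σ₀ (develop c (map wkλF (fArg (develop u [] η) (isValue u) ∷ k)) (wkλEnv η)) Z•)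
               (cong (sub (σ₀ Z•)) as-plugFire)) ◅◅
  sub-▷* (σ₀ Z•) (value-σ' h) (plugFire-arg-develop C (wkλ u) (map wkλF k) (wkλEnv η) value-C wk' (WfEnv-wkλEnv wη)) ◅◅
  sub-develop (wkλ u) (fL C ∷ map wkλF k) (wkλEnv η) h (value-C ∷ wk') (WfEnv-wkλEnv wη) ◅◅
  ≡⇒▷* (cong₂ (λ z w → develop z (fL (sub (σ₀ Z•) C) ∷ w) η) (σ₀-wkλ u) (map-subF-wkλF Z• k)) ◅◅
  develop-⊑ u (⊑L (≡⇒▷* (sym ([0≔]≡sub-σ₀ C Z•)) ◅◅ [0≔]-develop c [] η Z vz [] wη) (⊑-refl wk)) (⊑ₑ-refl wη)
    (Value-sub (σ₀ Z•) (value-σ' h) value-C ∷ wk) (Value-develop (c [0≔ Z ]) η (trans (isValue-[0≔] c Z vz) ec) ∷ wk) wη wη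
  where
  Z• : Term n m
  Z• = develop Z [] η
  C : Term (suc n) m
  C = develop c [] (wkλEnv η)
  h : DevSub (σ₀ Z) (σ₀ Z•) (wkλEnv η) η
  h = DevSub-σ₀ η vz
  wk' : WfStack (map wkλF k)
  wk' = WfStack-renF suc (λ a → a) wk
  value-C : Value C
  value-C = Value-develop c (wkλEnv η) ec
  σ₀-wkλ : ∀ u → sub (σ₀ Z) (wkλ u) ≡ u
  σ₀-wkλ u = trans (sub-ren (σ₀ Z) suc (λ _ → refl) u) (sub-id (λ _ → refl) u)
  as-plugFire : develop c (map wkλF (fArg (develop u [] η) (isValue u) ∷ k)) (wkλEnv η) ≡
                plugFire true C (fArg (develop (wkλ u) [] (wkλEnv η)) (isValue (wkλ u)) ∷ map wkλF k)
  as-plugFire = trans (develop-value c _ (wkλEnv η) ec)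
    (cong₂ (λ x y → plugFire true C (fArg x y ∷ map wkλF k)) (develop-wkλ u η) (sym (isValue-ren suc (λ a → a) u)))

isValue-▷ : ∀ {n m} {t t' : Term n m} → t ▷ t' → isValue t ≡ true → isValue t' ≡ true
isValue-▷ r e = Value⇒isValue (Value-▷ (isValue⇒Value e) r)

develop-comR : ∀ {n m} (r : Term n m) (c d : Term (suc n) m) (e : ETerm n m) (k : List (Frame n m)) (η : Env n m) →
               WfStack k → WfEnv η →
               develop (app (app r (case c d)) e) k η ▷* develop (app r (case (app c (wkλE e)) (app d (wkλE e)))) k η
develop-comR r c d e k η wk wη =
  ≡⇒▷* (develop-app-nonValue (app r (case c d)) e k η refl) ◅◅
  develop-⊑ r (⊑case [] refl (branch c) (branch d) ⊑[]) (⊑ₑ-refl wη) (tt ∷ []) (tt ∷ []) wη wη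
  where
  branch : ∀ c → develop c (map wkλF (devFrame (frameOf e) η k)) (wkλEnv η) ▷* develop (app c (wkλE e)) (map wkλF k) (wkλEnv η)
  branch c = ≡⇒▷* (cong (λ z → develop c z (wkλEnv η)) (wkλ-devFrame e η k)) ◅◅
    develop-devFrame c (frameOf (wkλE e)) (map wkλF k) (wkλEnv η) (WfFrame-frameOf _) (WfStack-renF suc (λ a → a) wk)
      (WfEnv-wkλEnv wη) ◅◅
    ≡⇒▷* (cong (λ z → develop z (map wkλF k) (wkλEnv η)) (plug₁-frameOf c (wkλE e)))

develop-comL : ∀ {n m} {V r : Term n m} (c d : Term (suc n) m) (k : List (Frame n m)) (η : Env n m) → Value V → WfEnv η →
               develop (app V (tm (app r (case c d)))) k η ▷* develop (app r (case (app (wkλ V) (tm c)) (app (wkλ V) (tm d)))) k η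
develop-comL {V = V} {r} c d k η v wη rewrite Value⇒isValue v =
  develop-⊑ r (⊑case [] refl (branch c) (branch d) ⊑[]) (⊑ₑ-refl wη) (tt ∷ []) (tt ∷ []) wη wη
  where
  branch : ∀ c → develop c (map wkλF (fL (develop V [] η) ∷ k)) (wkλEnv η) ▷* develop (app (wkλ V) (tm c)) (map wkλF k) (wkλEnv η)
  branch c rewrite isValue-ren suc (λ a → a) V | Value⇒isValue v =
    ≡⇒▷* (cong (λ z → develop c (fL z ∷ map wkλF k) (wkλEnv η)) (develop-wkλ V η))

develop-μR : ∀ {n m} (w : Term n (suc m)) (e : ETerm n m) (k : List (Frame n m)) (η : Env n m) → WfStack k → WfEnv η →
             develop (app (mu w) e) k η ▷* develop (mu (substR zero (wkμE e) w)) k η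
develop-μR w e k η wk wη =
  ≡⇒▷* (develop-app-nonValue (mu w) e k η refl) ◅◅
  ▷*-mu (develop-updateEnv w [] update [] (WfEnv-bindμ wk wη) (WfEnv-bindμ (WfStack-devFrame _ η k (WfFrame-frameOf e) wk) wη)) ◅◅
  ≡⇒▷* (cong (λ z → mu (develop z [] (bindμ k η))) (sym (substR≡push zero (wkμE e) w)))
  where
  update : DevUpdate zero (frameOf (wkμE e)) (singleEnv zero (frameOf (wkμE e) ∷ [])) (bindμ k η) (bindμ (devFrame (frameOf e) η k) η)
  update = record { pushed = λ _ → refl ; updated = λ { zero → wkμ-devFrame e η k ; (suc b) → refl } ; wf-g = WfFrame-frameOf _ }

develop-μL : ∀ {n m} {V : Term n m} (w : Term n (suc m)) (k : List (Frame n m)) (η : Env n m) → Value V → WfStack k → WfEnv η →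
             develop (app V (tm (mu w))) k η ▷* develop (mu (substL zero (wkμ V) w)) k η
develop-μL {V = V} w k η v wk wη rewrite Value⇒isValue v =
  ▷*-mu (develop-updateEnv w [] update [] (WfEnv-bindμ wk wη) (WfEnv-bindμ (Value-develop V η (Value⇒isValue v) ∷ wk) wη)) ◅◅
  ≡⇒▷* (cong (λ z → mu (develop z [] (bindμ k η))) (sym (substL≡push zero (wkμ V) w)))
  where
  update : DevUpdate zero (fL (wkμ V)) (singleEnv zero (fL (wkμ V) ∷ [])) (bindμ k η) (bindμ (fL (develop V [] η) ∷ k) η)
  update = record
    { pushed = λ _ → refl
    ; updated = λ { zero → cong (λ z → fL z ∷ map wkμF k) (ren-develop (λ x → x) suc V [] {η} {bindμ k η} (mkRenEnv λ _ → refl))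
                  ; (suc b) → refl }
    ; wf-g = Value-ren (λ x → x) suc v }

mutual
  ▷⇒develop-▷* : ∀ {n m} {t s : Term n m} → t ▷ s → (k : List (Frame n m)) (η : Env n m) → WfStack k → WfEnv η →
                 develop t k η ▷* develop s k η
  ▷⇒develop-▷* (β {s} {V} v) k η wk wη =
    ≡⇒▷* (develop-value V _ η (Value⇒isValue v)) ◅◅
    plug-▷* k ([0≔]-develop s [] η V v [] wη) ◅◅ plug-develop (s [0≔ V ]) [] k η [] wk wη
  ▷⇒develop-▷* (proj₁ {V₁} v w) k η wk wη rewrite Value⇒isValue v | Value⇒isValue w = plug-develop V₁ [] k η [] wk wη
  ▷⇒develop-▷* (proj₂ {V₂ = V₂} v w) k η wk wη rewrite Value⇒isValue v | Value⇒isValue w = plug-develop V₂ [] k η [] wk wη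
  ▷⇒develop-▷* (cas₁ {V} {c} v) k η wk wη rewrite Value⇒isValue v = [0≔]-develop c k η V v wk wη
  ▷⇒develop-▷* (cas₂ {V} {t₂ = d} v) k η wk wη rewrite Value⇒isValue v = [0≔]-develop d k η V v wk wη
  ▷⇒develop-▷* (comR {r} {c} {d} {e}) k η wk wη = develop-comR r c d e k η wk wη
  ▷⇒develop-▷* (comL {t₁ = c} {d} v) k η wk wη = develop-comL c d k η v wη
  ▷⇒develop-▷* (μR {w} {e}) k η wk wη = develop-μR w e k η wk wη
  ▷⇒develop-▷* (μL {t = w} v) k η wk wη = develop-μL w k η v wk wη
  ▷⇒develop-▷* (ξ-lam r) k η wk wη = plugFire-cong-value v-lam v-lam (▷*-lam (▷⇒develop-▷* r [] (wkλEnv η) [] (WfEnv-wkλEnv wη))) wk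
  ▷⇒develop-▷* (ξ-pairˡ {t} {t'} {u} r) k η wk wη =
    plugFire-cong _ _ (▷*-pair (▷⇒develop-▷* r [] η [] wη) ε) (isValue-▷ (ξ-pairˡ {u = u} r))
      (Value-develop (pair t u) η) (Value-develop (pair t' u) η) wk
  ▷⇒develop-▷* (ξ-pairʳ {t} {u} {u'} r) k η wk wη =
    plugFire-cong _ _ (▷*-pair ε (▷⇒develop-▷* r [] η [] wη)) (isValue-▷ (ξ-pairʳ {t = t} r))
      (Value-develop (pair t u) η) (Value-develop (pair t u') η) wk
  ▷⇒develop-▷* (ξ-ω₁ {t} {t'} r) k η wk wη =
    plugFire-cong _ _ (▷*-ω₁ (▷⇒develop-▷* r [] η [] wη)) (isValue-▷ (ξ-ω₁ r)) (Value-develop (ω₁ t) η) (Value-develop (ω₁ t') η) wk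
  ▷⇒develop-▷* (ξ-ω₂ {t} {t'} r) k η wk wη =
    plugFire-cong _ _ (▷*-ω₂ (▷⇒develop-▷* r [] η [] wη)) (isValue-▷ (ξ-ω₂ r)) (Value-develop (ω₂ t) η) (Value-develop (ω₂ t') η) wk
  ▷⇒develop-▷* (ξ-nam {a} r) k η wk wη = plugFire-cong-value v-nam v-nam (▷*-nam (▷⇒develop-▷* r (η a) η (wη a) wη)) wk
  ▷⇒develop-▷* (ξ-mu r) k η wk wη = ▷*-mu (▷⇒develop-▷* r [] (bindμ k η) [] (WfEnv-bindμ wk wη))
  ▷⇒develop-▷* (ξ-appˡ {t} {t'} {tm u} r) k η wk wη = go (isValue t) (isValue t') refl refl
    where
    go : ∀ b b' → isValue t ≡ b → isValue t' ≡ b' → developArg b t u k η ▷* developArg b' t' u k η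
    go true true e e' = develop-⊑ u (⊑L (▷⇒develop-▷* r [] η [] wη) (⊑-refl wk)) (⊑ₑ-refl wη)
      (Value-develop t η e ∷ wk) (Value-develop t' η e' ∷ wk) wη wη
    go true false e e' with trans (sym (isValue-▷ r e)) e'
    ... | ()
    go false false e e' = ▷⇒develop-▷* r (fArg (develop u [] η) (isValue u) ∷ k) η (WfFrame-devArg u η ∷ wk) wη
    go false true e e' = develop-▷-toValue r e e' u k η wk wη
  ▷⇒develop-▷* (ξ-appˡ {e = π₁} r) k η wk wη = ▷⇒develop-▷* r (fπ₁ ∷ k) η (tt ∷ wk) wη
  ▷⇒develop-▷* (ξ-appˡ {e = π₂} r) k η wk wη = ▷⇒develop-▷* r (fπ₂ ∷ k) η (tt ∷ wk) wη
  ▷⇒develop-▷* (ξ-appˡ {e = case c d} r) k η wk wη = ▷⇒develop-▷* r (fCase _ _ ∷ []) η (tt ∷ []) wη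
  ▷⇒develop-▷* (ξ-appʳ {t} (ξ-tm {u} {u'} r)) k η wk wη = go (isValue t) refl
    where
    go : ∀ b → isValue t ≡ b → developArg b t u k η ▷* developArg b t u' k η
    go true e = ▷⇒develop-▷* r (fL (develop t [] η) ∷ k) η (Value-develop t η e ∷ wk) wη
    go false e = develop-⊑ t (⊑arg (▷⇒develop-▷* r [] η [] wη) (isValue-▷ r) (Value-develop u' η) (⊑-refl wk))
      (⊑ₑ-refl wη) (WfFrame-devArg u η ∷ wk) (WfFrame-devArg u' η ∷ wk) wη wη
  ▷⇒develop-▷* (ξ-appʳ {t} (ξ-caseˡ r)) k η wk wη =
    develop-⊑ t (⊑case [] refl (▷⇒develop-▷* r (map wkλF k) (wkλEnv η) (WfStack-renF suc (λ a → a) wk) (WfEnv-wkλEnv wη)) ε ⊑[])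
      (⊑ₑ-refl wη) (tt ∷ []) (tt ∷ []) wη wη
  ▷⇒develop-▷* (ξ-appʳ {t} (ξ-caseʳ r)) k η wk wη =
    develop-⊑ t (⊑case [] refl ε (▷⇒develop-▷* r (map wkλF k) (wkλEnv η) (WfStack-renF suc (λ a → a) wk) (WfEnv-wkλEnv wη)) ⊑[])
      (⊑ₑ-refl wη) (tt ∷ []) (tt ∷ []) wη wη

  -- Once the function part of an application becomes a value, develop switches from developing the
  -- function first to developing the argument first.
  develop-▷-toValue : ∀ {n m} {t t' : Term n m} → t ▷ t' → isValue t ≡ false → isValue t' ≡ true →
                      (u : Term n m) (k : List (Frame n m)) (η : Env n m) → WfStack k → WfEnv η →
                      develop t (fArg (develop u [] η) (isValue u) ∷ k) η ▷* develop u (fL (develop t' [] η) ∷ k) η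
  develop-▷-toValue (β {s} {V} v) e e' u k η wk wη =
    ≡⇒▷* (develop-value V _ η (Value⇒isValue v)) ◅◅
    plug-app-develop u k η ([0≔]-develop s [] η V v [] wη) (Value-develop (s [0≔ V ]) η e') wk wη
  develop-▷-toValue (proj₁ {V₁} v w) e e' u k η wk wη rewrite Value⇒isValue v | Value⇒isValue w =
    plug-app-develop u k η ε (Value-develop V₁ η (Value⇒isValue v)) wk wη
  develop-▷-toValue (proj₂ {V₂ = V₂} v w) e e' u k η wk wη rewrite Value⇒isValue v | Value⇒isValue w =
    plug-app-develop u k η ε (Value-develop V₂ η (Value⇒isValue w)) wk wη
  develop-▷-toValue (cas₁ {Z} {c} vz) e e' u k η wk wη rewrite Value⇒isValue vz =
    develop-case-toValue Z c u k η vz (trans (sym (isValue-[0≔] c Z vz)) e') wk wη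
  develop-▷-toValue (cas₂ {Z} {t₂ = d} vz) e e' u k η wk wη rewrite Value⇒isValue vz =
    develop-case-toValue Z d u k η vz (trans (sym (isValue-[0≔] d Z vz)) e') wk wη
  develop-▷-toValue (ξ-pairˡ {t' = a'} {b} r) e e' u k η wk wη rewrite e =
    ≡⇒▷* (cong (λ z → plug z k) (fire-pair-arg false _ _ (develop u [] η) (isValue u))) ◅◅
    plug-app-develop u k η (▷*-pair (▷⇒develop-▷* r [] η [] wη) ε) (Value-develop (pair a' b) η e') wk wη
  develop-▷-toValue (ξ-pairʳ {a} {u' = b'} r) e e' u k η wk wη rewrite e =
    ≡⇒▷* (cong (λ z → plug z k) (fire-pair-arg false _ _ (develop u [] η) (isValue u))) ◅◅
    plug-app-develop u k η (▷*-pair ε (▷⇒develop-▷* r [] η [] wη)) (Value-develop (pair a b') η e') wk wη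
  develop-▷-toValue (ξ-ω₁ {t' = a'} r) e e' u k η wk wη rewrite e =
    ≡⇒▷* (cong (λ z → plug z k) (fire-ω₁-arg false _ (develop u [] η) (isValue u))) ◅◅
    plug-app-develop u k η (▷*-ω₁ (▷⇒develop-▷* r [] η [] wη)) (Value-develop (ω₁ a') η e') wk wη
  develop-▷-toValue (ξ-ω₂ {t' = a'} r) e e' u k η wk wη rewrite e =
    ≡⇒▷* (cong (λ z → plug z k) (fire-ω₂-arg false _ (develop u [] η) (isValue u))) ◅◅
    plug-app-develop u k η (▷*-ω₂ (▷⇒develop-▷* r [] η [] wη)) (Value-develop (ω₂ a') η e') wk wη
  develop-▷-toValue comR e () u k η wk wη
  develop-▷-toValue (comL v) e () u k η wk wη
  develop-▷-toValue μR e () u k η wk wη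
  develop-▷-toValue (μL v) e () u k η wk wη
  develop-▷-toValue (ξ-lam r) () e' u k η wk wη
  develop-▷-toValue (ξ-appˡ r) e () u k η wk wη
  develop-▷-toValue (ξ-appʳ r) e () u k η wk wη
  develop-▷-toValue (ξ-mu r) e () u k η wk wη
  develop-▷-toValue (ξ-nam r) () e' u k η wk wη

-- Confluence

WfEnv-emptyEnv : ∀ {n m} → WfEnv (emptyEnv {n} {m})
WfEnv-emptyEnv a = []

▷*-dev : ∀ {n m} (t : Term n m) → t ▷* dev t
▷*-dev t = ≡⇒▷* (sym (push-[] (λ _ → refl) t)) ◅◅ ▷*-develop t [] emptyEnv [] WfEnv-emptyEnv

reduct-▷*-dev : ∀ {n m} {t s : Term n m} → t ▷ s → s ▷* dev t
reduct-▷*-dev {s = s} r = ≡⇒▷* (sym (push-[] (λ _ → refl) s)) ◅◅ reduct-▷*-develop r [] emptyEnv [] WfEnv-emptyEnv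

dev-▷ : ∀ {n m} {t s : Term n m} → t ▷ s → dev t ▷* dev s
dev-▷ r = ▷⇒develop-▷* r [] emptyEnv [] WfEnv-emptyEnv

▷-confluent : ∀ {n m} → Confluent (_▷_ {n} {m})
▷-confluent = ZProperty.confluent dev ▷*-dev reduct-▷*-dev dev-▷

mainTheorem1 : ∀ {n m : ℕ} (t t₁ t₂ : Term n m) →
                 t ▷* t₁ → t ▷* t₂ → ∃[ t₃ ] (t₁ ▷* t₃ × t₂ ▷* t₃)
mainTheorem1 t t₁ t₂ = ▷-confluent
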